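{- For indeterminates $t,u,x_1,\dots,x_{2n}$, $$\sum_{\lambda}\prod_{i=1}^{n}(1-ut^{\lambda_{2i}-2i+2n})\,s_\lambda(x_1,\dots,x_{2n})=\prod_{1\le i<j\le 2n}\frac{1}{x_i-x_j}\ \mathop{\rm Pf}_{1\le i<j\le 2n}\left[\frac{(x_i-x_j)(1-u+(u-t)x_ix_j)}{(1-x_ix_j)(1-tx_ix_j)}\right],$$ where the sum runs over all partitions $\lambda$ of length at most $2n$ whose conjugate $\lambda'$ has only even parts (all columns of even length).
   Context: $s_\lambda$ is the Schur polynomial; $\lambda$ is regarded as $(\lambda_1,\dots,\lambda_{2n})$ padded with zeros. $\mathop{\rm Pf}_{1\le i<j\le 2n}[a_{ij}]$ is the Pfaffian of the antisymmetric matrix with upper-triangular entries $a_{ij}$. Identity of formal power series. -}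

module Defs where

-- Formal power series with integer coefficients in the 2n+2 variables
--   t (index 0), u (index 1), x_1 .. x_{2n} (index i+1 for x_i).
-- A power series is its coefficient function on exponent vectors.

open import Data.Nat as ℕ using (ℕ; zero; suc; _∸_; _≤ᵇ_; _<ᵇ_; _≡ᵇ_; _%_)
open import Data.Integer as ℤ using (ℤ; +_; -_)
open import Data.Vec as Vec using (Vec; []; _∷_)
import Data.Vec.Properties as VecP
import Data.Nat.ListAction
open import Data.List as List using (List; []; _∷_; map; concatMap; foldr; length; zipWith)
open import Data.Bool using (Bool; true; false; _∧_; if_then_else_)
open import Data.Product using (_×_; _,_; proj₁; proj₂)
open import Relation.Nullary.Decidable using (⌊_⌋)

keep : {A : Set} → (A → Bool) → List A → List A
keep p [] = []
keep p (a ∷ as) = if p a then a ∷ keep p as else keep p as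

allᵇ : {A : Set} → (A → Bool) → List A → Bool
allᵇ p [] = true
allᵇ p (a ∷ as) = p a ∧ allᵇ p as

-- [a, a+1, ..., b]  (empty if b < a)
range : ℕ → ℕ → List ℕ
range a b = map (ℕ._+ a) (List.upTo (suc b ∸ a))

-- 1-based indexing of a list, padded with zeros: la ‼ i = λ_i
_‼_ : List ℕ → ℕ → ℕ
[] ‼ _ = 0
(a ∷ as) ‼ zero = 0
(a ∷ as) ‼ suc zero = a
(a ∷ as) ‼ suc (suc i) = as ‼ suc i

sumℤ : List ℤ → ℤ
sumℤ = foldr ℤ._+_ (+ 0)

PS : ℕ → Set
PS m = Vec ℕ m → ℤ

splits : ∀ {m} → Vec ℕ m → List (Vec ℕ m × Vec ℕ m)
splits [] = ([] , []) ∷ []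
splits (a ∷ α) =
  concatMap (λ k → map (λ p → (k ∷ proj₁ p , (a ∸ k) ∷ proj₂ p)) (splits α))
            (List.upTo (suc a))

module _ {m : ℕ} where

  mono : Vec ℕ m → PS m
  mono e α = if ⌊ VecP.≡-dec ℕ._≟_ e α ⌋ then + 1 else + 0

  0ₚ : PS m
  0ₚ _ = + 0

  1ₚ : PS m
  1ₚ = mono (Vec.replicate m 0)

  infixl 6 _+ₚ_ _-ₚ_
  infixl 7 _*ₚ_

  _+ₚ_ : PS m → PS m → PS m
  (f +ₚ g) α = f α ℤ.+ g α

  -ₚ_ : PS m → PS m
  (-ₚ f) α = ℤ.- f α

  _-ₚ_ : PS m → PS m → PS m
  f -ₚ g = f +ₚ (-ₚ g)

  _*ₚ_ : PS m → PS m → PS m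
  (f *ₚ g) α = sumℤ (map (λ p → f (proj₁ p) ℤ.* g (proj₂ p)) (splits α))

  _^ₚ_ : PS m → ℕ → PS m
  f ^ₚ zero = 1ₚ
  f ^ₚ suc k = f *ₚ (f ^ₚ k)

  sumₚ : List (PS m) → PS m
  sumₚ = foldr _+ₚ_ 0ₚ

  prodₚ : List (PS m) → PS m
  prodₚ = foldr _*ₚ_ 1ₚ

  -- 1/(1 - f) = Σ_k f^k, for f without constant term
  -- (terms f^k with k > total degree of α do not contribute to coefficient α)
  geomₚ : PS m → PS m
  geomₚ f α = sumℤ (map (λ k → (f ^ₚ k) α) (List.upTo (suc (Vec.sum α))))

unitExp : (m k : ℕ) → Vec ℕ m
unitExp zero k = []
unitExp (suc m) zero = 1 ∷ Vec.replicate m 0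
unitExp (suc m) (suc k) = 0 ∷ unitExp m k

nv : ℕ → ℕ
nv n = 2 ℕ.+ 2 ℕ.* n

tv : (n : ℕ) → PS (nv n)
tv n = mono (unitExp (nv n) 0)

uv : (n : ℕ) → PS (nv n)
uv n = mono (unitExp (nv n) 1)

-- x_i, 1-based
xv : (n : ℕ) → ℕ → PS (nv n)
xv n i = mono (unitExp (nv n) (suc i))

vecsUpTo : ℕ → ℕ → List (List ℕ)
vecsUpTo zero d = [] ∷ []
vecsUpTo (suc k) d = concatMap (λ a → map (a ∷_) (vecsUpTo k d)) (List.upTo (suc d))

weaklyDecreasing : List ℕ → Bool
weaklyDecreasing [] = true
weaklyDecreasing (a ∷ []) = true
weaklyDecreasing (a ∷ b ∷ as) = (b ≤ᵇ a) ∧ weaklyDecreasing (b ∷ as)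

conjPart : List ℕ → ℕ → ℕ
conjPart la k = length (keep (k ≤ᵇ_) la)

-- all parts λ'_1, ..., λ'_{λ_1} of the conjugate are even
-- (checked for k = 1..|λ| ; for k > λ_1 the value is 0, which is even)
conjEven : List ℕ → Bool
conjEven la = allᵇ (λ k → conjPart la k % 2 ≡ᵇ 0) (range 1 (Data.Nat.ListAction.sum la))

-- partitions of length ≤ 2n (as 2n-lists padded with zeros) with all parts ≤ d
-- and all columns of even length
evenColPartitions : (n d : ℕ) → List (List ℕ)
evenColPartitions n d = keep (λ la → weaklyDecreasing la ∧ conjEven la) (vecsUpTo (2 ℕ.* n) d)

rowsIn : ℕ → ℕ → List (List ℕ)
rowsIn zero k = [] ∷ []
rowsIn (suc r) k = concatMap (λ a → map (a ∷_) (rowsIn r k)) (range 1 k)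

fillings : List ℕ → ℕ → List (List (List ℕ))
fillings [] k = [] ∷ []
fillings (r ∷ la) k = concatMap (λ row → map (row ∷_) (fillings la k)) (rowsIn r k)

rowsWeak : List (List ℕ) → Bool
rowsWeak = allᵇ weaklyIncreasing
  where
  weaklyIncreasing : List ℕ → Bool
  weaklyIncreasing [] = true
  weaklyIncreasing (a ∷ []) = true
  weaklyIncreasing (a ∷ b ∷ as) = (a ≤ᵇ b) ∧ weaklyIncreasing (b ∷ as)

-- columns strictly increasing (downwards); rows have weakly decreasing lengths
colsStrict : List (List ℕ) → Bool
colsStrict [] = true
colsStrict (r ∷ []) = true
colsStrict (r ∷ s ∷ rs) = allᵇ (λ b → b) (zipWith _<ᵇ_ r s) ∧ colsStrict (s ∷ rs)

ssyt : List ℕ → ℕ → List (List (List ℕ))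
ssyt la k = keep (λ T → rowsWeak T ∧ colsStrict T) (fillings la k)

schur : (n : ℕ) → List ℕ → PS (nv n)
schur n la = sumₚ (map (λ T → prodₚ (map (xv n) (List.concat T))) (ssyt la (2 ℕ.* n)))

lhsFactor : (n : ℕ) → List ℕ → PS (nv n)
lhsFactor n la =
  prodₚ (map (λ i → 1ₚ -ₚ uv n *ₚ (tv n ^ₚ ((la ‼ (2 ℕ.* i)) ℕ.+ (2 ℕ.* n ∸ 2 ℕ.* i))))
             (range 1 n))

-- Σ_λ Π_i (1 - u t^{...}) s_λ(x).  The family is summable: the term for λ only has
-- monomials of x-degree |λ|, so for the coefficient of x^α (total degree d) only
-- partitions with parts ≤ d matter.
lhs : (n : ℕ) → PS (nv n)
lhs n α = sumℤ (map (λ la → (lhsFactor n la *ₚ schur n la) α)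
                    (evenColPartitions n (Vec.sum α)))

pfEntry : (n : ℕ) → ℕ → ℕ → PS (nv n)
pfEntry n i j =
  (xv n i -ₚ xv n j)
  *ₚ (1ₚ -ₚ uv n +ₚ (uv n -ₚ tv n) *ₚ xv n i *ₚ xv n j)
  *ₚ geomₚ (xv n i *ₚ xv n j)
  *ₚ geomₚ (tv n *ₚ xv n i *ₚ xv n j)

picks : List ℕ → List (ℕ × List ℕ × ℕ)
picks [] = []
picks (a ∷ as) = (a , as , 0) ∷ map (λ p → (proj₁ p , a ∷ proj₁ (proj₂ p) , suc (proj₂ (proj₂ p)))) (picks as)

sgn : {m : ℕ} → ℕ → PS m → PS m
sgn k f = if k % 2 ≡ᵇ 0 then f else -ₚ f

-- Pfaffian of the antisymmetric matrix with upper entries a i j (i < j), restricted to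
-- the (increasing) index list, of length 2k; expansion along the first row:
-- Pf = Σ_{j} (-1)^{pos} a_{i₁ j} Pf(remove i₁, j)
pfaffian : {m : ℕ} → (ℕ → ℕ → PS m) → ℕ → List ℕ → PS m
pfaffian a zero [] = 1ₚ
pfaffian a zero (_ ∷ _) = 0ₚ
pfaffian a (suc k) [] = 0ₚ
pfaffian a (suc k) (i ∷ rest) =
  sumₚ (map (λ p → sgn (proj₂ (proj₂ p)) (a i (proj₁ p) *ₚ pfaffian a k (proj₁ (proj₂ p))))
            (picks rest))

rhsPf : (n : ℕ) → PS (nv n)
rhsPf n = pfaffian (pfEntry n) n (range 1 (2 ℕ.* n))

vandermonde : (n : ℕ) → PS (nv n)
vandermonde n =
  prodₚ (concatMap (λ i → map (λ j → xv n i -ₚ xv n j) (range (suc i) (2 ℕ.* n)))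
                   (range 1 (2 ℕ.* n)))

{-# OPTIONS --safe #-}
-- The entry of the Pfaffian is ∑ₘ (1 - u tᵐ) (xᵢᵐ⁺¹ xⱼᵐ - xᵢᵐ xⱼᵐ⁺¹), a weighted sum of the decomposable
-- forms of the pairs of exponents {m + 1, m}. Hence the Pfaffian is the sum over m₁ > ... > mₙ of
-- ∏ᵢ (1 - u t^mᵢ) times the alternant with exponents m₁ + 1, m₁, ..., mₙ + 1, mₙ, which vanishes unless
-- the pairs are disjoint. The disjoint ones are λⱼ + 2n - j for the partitions λ with λ_{2i-1} = λ_{2i},
-- that is, with columns of even length, and mᵢ = λ_{2i} + 2n - 2i. It remains to identify the alternant with
-- the Vandermonde product times s_λ: peeling off the largest letter of the tableaux on one side, and
-- clearing the last row of the alternant by column operations on the other, gives the same recursion over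
-- the partitions that interlace with λ.
module Submission where

open import Defs
open import Algebra using (CommutativeRing)
open import Algebra.Solver.Ring.AlmostCommutativeRing
  using (fromCommutativeRing; _-Raw-AlmostCommutative⟶_)
open import Data.Bool using (Bool; true; false; T; _∧_; if_then_else_)
import Data.Bool.Properties as Boolₚ
open import Data.Empty using (⊥-elim)
open import Data.Integer as ℤ using (ℤ; +_; -[1+_])
import Data.Integer.Properties as ℤₚ
open import Data.List
  using (List; []; _∷_; [_]; _++_; map; foldr; length; zipWith; replicate; concat; concatMap; upTo; applyUpTo;
         downFrom)
import Data.List.Properties as Listₚ
open import Data.List.Relation.Unary.All as All using (All; []; _∷_)
import Data.List.Relation.Unary.All.Properties as Allₚ
open import Data.List.Relation.Unary.Linked as Linked using (Linked; []; [-]; _∷_)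
open import Data.Maybe using (Maybe; just; nothing)
open import Data.Nat as ℕ using (ℕ; zero; suc; _≤_; _≥_; _<_; z≤n; s≤s; _∸_; _≤ᵇ_; _<ᵇ_; _≡ᵇ_; _%_)
open import Data.Nat.ListAction using (sum)
import Data.Nat.Properties as ℕₚ
open import Data.Product using (_×_; _,_; proj₁; proj₂)
open import Data.Unit using (tt)
open import Data.Vec as Vec using (Vec; []; _∷_)
import Data.Vec.Properties as Vecₚ
open import Function using (Equivalence)
open import Level using (0ℓ)
open import Relation.Binary using (tri<; tri≈; tri>)
open import Relation.Binary.PropositionalEquality as ≡ using (_≡_; _≢_)
open import Relation.Nullary using (yes; no)

-- The combinatorial identities are proved over an arbitrary commutative ring with elements x, t, u,
-- where every sum has to be finite. Power series enter through a ring in which two series are equal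
-- when they agree up to total degree d. There xᵢxⱼ is nilpotent, so a finite geometric sum is an
-- exact inverse of 1 - xᵢxⱼ, and only partitions with parts at most d contribute. The coefficient
-- at α is read off with d = |α|. The Vandermonde product stays on the left as a factor, so nothing
-- is ever divided by xᵢ - xⱼ.
--
-- The Pfaffian becomes a sum of minors without signs because columns travel in pairs, and a pair
-- passes other columns evenly.
--
-- The two recursions for the alternant do not match literally: removing the largest letter keeps
-- the number of rows of a shape, while clearing a row of the alternant removes a column. They agree
-- because a shape with more positive rows than letters has no tableau, so the surplus last row is
-- empty.

-- Coefficients in ℤ let the solver decide cancellations, which an abstract ring does not.
module IntegerCoefficientSolver (R : CommutativeRing 0ℓ 0ℓ) where
  open CommutativeRing R hiding (zero)
  open import Algebra.Properties.Ring ring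
  open import Algebra.Properties.AbelianGroup +-abelianGroup using (⁻¹-∙-comm)
  open import Algebra.Properties.Group +-group using (⁻¹-involutive; ε⁻¹≈ε)
  open import Algebra.Properties.Semiring.Mult.TCOptimised semiring
    using (1+×; ×-homo-+; ×1-homo-*) renaming (_×_ to _·_)
  open import Relation.Binary.Reasoning.Setoid setoid

  ⟦_⟧ℤ : ℤ → Carrier
  ⟦ + n ⟧ℤ = n · 1#
  ⟦ -[1+ n ] ⟧ℤ = - (suc n · 1#)

  neg-homo : ∀ i → ⟦ ℤ.- i ⟧ℤ ≈ - ⟦ i ⟧ℤ
  neg-homo (+ zero) = sym ε⁻¹≈ε
  neg-homo (+ suc n) = refl
  neg-homo -[1+ n ] = sym (⁻¹-involutive _)

  ⊖-homo : ∀ m n → ⟦ m ℤ.⊖ n ⟧ℤ ≈ m · 1# - n · 1#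
  ⊖-homo m zero = sym (trans (+-congˡ ε⁻¹≈ε) (+-identityʳ _))
  ⊖-homo zero (suc n) = sym (+-identityˡ _)
  ⊖-homo (suc m) (suc n) = begin
    ⟦ suc m ℤ.⊖ suc n ⟧ℤ                  ≡⟨ ≡.cong ⟦_⟧ℤ (ℤₚ.[1+m]⊖[1+n]≡m⊖n m n) ⟩
    ⟦ m ℤ.⊖ n ⟧ℤ                          ≈⟨ ⊖-homo m n ⟩
    m · 1# - n · 1#                       ≈⟨ +-congˡ (+-identityˡ _) ⟨
    m · 1# + (0# - n · 1#)                ≈⟨ +-congˡ (+-congʳ (-‿inverseʳ 1#)) ⟨
    m · 1# + (1# - 1# - n · 1#)           ≈⟨ +-congˡ (+-assoc _ _ _) ⟩
    m · 1# + (1# + (- 1# - n · 1#))       ≈⟨ +-assoc _ _ _ ⟨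
    m · 1# + 1# + (- 1# - n · 1#)         ≈⟨ +-cong (+-comm _ _) (⁻¹-∙-comm _ _) ⟩
    1# + m · 1# - (1# + n · 1#)           ≈⟨ +-cong (1+× m 1#) (-‿cong (1+× n 1#)) ⟨
    suc m · 1# - suc n · 1#               ∎

  +-homo : ∀ i j → ⟦ i ℤ.+ j ⟧ℤ ≈ ⟦ i ⟧ℤ + ⟦ j ⟧ℤ
  +-homo (+ m) (+ n) = ×-homo-+ 1# m n
  +-homo (+ m) -[1+ n ] = ⊖-homo m (suc n)
  +-homo -[1+ m ] (+ n) = trans (⊖-homo n (suc m)) (+-comm _ _)
  +-homo -[1+ m ] -[1+ n ] = begin
    - (suc (suc (m ℕ.+ n)) · 1#)       ≡⟨ ≡.cong (λ k → - (suc k · 1#)) (ℕₚ.+-suc m n) ⟨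
    - ((suc m ℕ.+ suc n) · 1#)         ≈⟨ -‿cong (×-homo-+ 1# (suc m) (suc n)) ⟩
    - (suc m · 1# + suc n · 1#)        ≈⟨ ⁻¹-∙-comm _ _ ⟨
    - (suc m · 1#) - suc n · 1#        ∎

  pos-*-homo : ∀ m j → ⟦ + m ℤ.* j ⟧ℤ ≈ m · 1# * ⟦ j ⟧ℤ
  pos-*-homo m (+ n) = begin
    ⟦ + m ℤ.* + n ⟧ℤ                   ≡⟨ ≡.cong ⟦_⟧ℤ (ℤₚ.pos-* m n) ⟨
    (m ℕ.* n) · 1#                     ≈⟨ ×1-homo-* m n ⟩
    m · 1# * n · 1#                    ∎
  pos-*-homo m -[1+ n ] = begin
    ⟦ + m ℤ.* (ℤ.- + suc n) ⟧ℤ         ≡⟨ ≡.cong ⟦_⟧ℤ (ℤₚ.neg-distribʳ-* (+ m) (+ suc n)) ⟨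
    ⟦ ℤ.- (+ m ℤ.* + suc n) ⟧ℤ         ≈⟨ neg-homo (+ m ℤ.* + suc n) ⟩
    - ⟦ + m ℤ.* + suc n ⟧ℤ             ≈⟨ -‿cong (pos-*-homo m (+ suc n)) ⟩
    - (m · 1# * suc n · 1#)            ≈⟨ -‿distribʳ-* _ _ ⟩
    m · 1# * - (suc n · 1#)            ∎

  *-homo : ∀ i j → ⟦ i ℤ.* j ⟧ℤ ≈ ⟦ i ⟧ℤ * ⟦ j ⟧ℤ
  *-homo (+ m) j = pos-*-homo m j
  *-homo -[1+ m ] j = begin
    ⟦ (ℤ.- + suc m) ℤ.* j ⟧ℤ           ≡⟨ ≡.cong ⟦_⟧ℤ (ℤₚ.neg-distribˡ-* (+ suc m) j) ⟨
    ⟦ ℤ.- (+ suc m ℤ.* j) ⟧ℤ           ≈⟨ neg-homo (+ suc m ℤ.* j) ⟩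
    - ⟦ + suc m ℤ.* j ⟧ℤ               ≈⟨ -‿cong (pos-*-homo (suc m) j) ⟩
    - (suc m · 1# * ⟦ j ⟧ℤ)            ≈⟨ -‿distribˡ-* _ _ ⟩
    - (suc m · 1#) * ⟦ j ⟧ℤ            ∎

  ℤ-morphism : CommutativeRing.rawRing ℤₚ.+-*-commutativeRing
               -Raw-AlmostCommutative⟶ fromCommutativeRing R
  ℤ-morphism = record
    { ⟦_⟧ = ⟦_⟧ℤ ; +-homo = +-homo ; *-homo = *-homo ; -‿homo = neg-homo
    ; 0-homo = refl ; 1-homo = refl }

  ⟦⟧-cong? : ∀ i j → Maybe (⟦ i ⟧ℤ ≈ ⟦ j ⟧ℤ)
  ⟦⟧-cong? i j with i ℤ.≟ j
  ... | yes ≡.refl = just refl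
  ... | no _ = nothing

  open import Algebra.Solver.Ring
    (CommutativeRing.rawRing ℤₚ.+-*-commutativeRing) (fromCommutativeRing R) ℤ-morphism ⟦⟧-cong?
    public using (solve; _:=_; _:+_; _:*_; _:-_; :-_; con)

-- Finite sums as linear functionals

module LinearFunctionals (R : CommutativeRing 0ℓ 0ℓ) where
  open CommutativeRing R hiding (zero)
  open import Algebra.Properties.Ring ring
  open import Relation.Binary.Reasoning.Setoid setoid
  open IntegerCoefficientSolver R

  -- Every summation operator below (over lists, signed choices, subsets, interlacing partitions,
  -- rows, exponent vectors) is linear in its summand. Two of them are interchanged by one induction
  -- on one operator, with the other an arbitrary `Φ`, instead of one lemma for each pair of
  -- operators.
  record Linear {A : Set} (Φ : (A → Carrier) → Carrier) : Set where
    field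
      cong : ∀ {f g} → (∀ a → f a ≈ g a) → Φ f ≈ Φ g
      +-hom : ∀ f g → Φ (λ a → f a + g a) ≈ Φ f + Φ g
      *-hom : ∀ c f → Φ (λ a → c * f a) ≈ c * Φ f

    vanish : ∀ {f} → (∀ a → f a ≈ 0#) → Φ f ≈ 0#
    vanish {f} f≈0 = begin
      Φ f                  ≈⟨ cong (λ a → trans (f≈0 a) (sym (zeroˡ (f a)))) ⟩
      Φ (λ a → 0# * f a)   ≈⟨ *-hom 0# f ⟩
      0# * Φ f             ≈⟨ zeroˡ _ ⟩
      0#                   ∎

    neg-hom : ∀ f → Φ (λ a → - f a) ≈ - Φ f
    neg-hom f = begin
      Φ (λ a → - f a)        ≈⟨ cong (λ a → sym (-1*x≈-x (f a))) ⟩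
      Φ (λ a → - 1# * f a)   ≈⟨ *-hom (- 1#) f ⟩
      - 1# * Φ f             ≈⟨ -1*x≈-x (Φ f) ⟩
      - Φ f                  ∎

    minus-hom : ∀ f g → Φ (λ a → f a - g a) ≈ Φ f - Φ g
    minus-hom f g = trans (+-hom f (λ a → - g a)) (+-congˡ (neg-hom g))

    *-homʳ : ∀ f c → Φ (λ a → f a * c) ≈ Φ f * c
    *-homʳ f c = trans (cong (λ a → *-comm (f a) c)) (trans (*-hom c f) (*-comm c (Φ f)))

  open Linear

  eval-linear : ∀ {A} (a : A) → Linear (λ f → f a)
  eval-linear a .cong f≈g = f≈g a
  eval-linear a .+-hom f g = refl
  eval-linear a .*-hom c f = refl

  0-linear : ∀ {A} → Linear {A} (λ _ → 0#)
  0-linear .cong _ = refl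
  0-linear .+-hom f g = sym (+-identityˡ 0#)
  0-linear .*-hom c f = sym (zeroʳ c)

  +-linear : ∀ {A} {Φ Ψ : (A → Carrier) → Carrier} →
             Linear Φ → Linear Ψ → Linear (λ f → Φ f + Ψ f)
  +-linear L M .cong f≈g = +-cong (L .cong f≈g) (M .cong f≈g)
  +-linear L M .+-hom f g = trans (+-cong (L .+-hom f g) (M .+-hom f g))
    (solve 4 (λ a b c d → (a :+ b) :+ (c :+ d) := (a :+ c) :+ (b :+ d)) refl _ _ _ _)
  +-linear L M .*-hom c f = trans (+-cong (L .*-hom c f) (M .*-hom c f)) (sym (distribˡ c _ _))

  *-linear : ∀ {A} {Φ : (A → Carrier) → Carrier} b → Linear Φ → Linear (λ f → b * Φ f)
  *-linear b L .cong f≈g = *-congˡ (L .cong f≈g)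
  *-linear b L .+-hom f g = trans (*-congˡ (L .+-hom f g)) (distribˡ b _ _)
  *-linear b L .*-hom c f = trans (*-congˡ (L .*-hom c f))
    (solve 3 (λ b c x → b :* (c :* x) := c :* (b :* x)) refl _ _ _)

  bind-linear : ∀ {A B} {Φ : (A → Carrier) → Carrier} {Ψ : A → (B → Carrier) → Carrier} →
                Linear Φ → (∀ a → Linear (Ψ a)) → Linear (λ f → Φ (λ a → Ψ a f))
  bind-linear L M .cong f≈g = L .cong (λ a → M a .cong f≈g)
  bind-linear L M .+-hom f g = trans (L .cong (λ a → M a .+-hom f g)) (L .+-hom _ _)
  bind-linear L M .*-hom c f = trans (L .cong (λ a → M a .*-hom c f)) (L .*-hom c _)

  reindex-linear : ∀ {A B} {Φ : (A → Carrier) → Carrier} (h : A → B) →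
                   Linear Φ → Linear (λ f → Φ (λ a → f (h a)))
  reindex-linear h L = bind-linear L (λ a → eval-linear (h a))

  infixr 8 [_]·_
  -- Iverson bracket: side conditions sit in the summand, so the ranges of summation stay fixed and
  -- linearity applies.
  [_]·_ : Bool → Carrier → Carrier
  [ b ]· r = if b then r else 0#

  []·-linear : ∀ {A} {Φ : (A → Carrier) → Carrier} b → Linear Φ → Linear (λ f → [ b ]· Φ f)
  []·-linear true L = L
  []·-linear false L = 0-linear

  []·-cong : ∀ b {r s} → r ≈ s → [ b ]· r ≈ [ b ]· s
  []·-cong true r≈s = r≈s
  []·-cong false r≈s = refl

  []·-*ˡ : ∀ b c r → [ b ]· (c * r) ≈ c * [ b ]· r
  []·-*ˡ true c r = refl
  []·-*ˡ false c r = sym (zeroʳ c)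

  []·-∧ : ∀ a b r → [ a ∧ b ]· r ≈ [ a ]· [ b ]· r
  []·-∧ true b r = refl
  []·-∧ false b r = refl

  ∑ : {A : Set} → List A → (A → Carrier) → Carrier
  ∑ xs f = foldr _+_ 0# (map f xs)

  ∏ : {A : Set} → List A → (A → Carrier) → Carrier
  ∏ xs f = foldr _*_ 1# (map f xs)

  ∑-linear : ∀ {A} (xs : List A) → Linear (∑ xs)
  ∑-linear [] = 0-linear
  ∑-linear (x ∷ xs) = +-linear (eval-linear x) (∑-linear xs)

  ∑-cong : ∀ {A} (xs : List A) {f g : A → Carrier} → (∀ a → f a ≈ g a) → ∑ xs f ≈ ∑ xs g
  ∑-cong xs = ∑-linear xs .cong

  linear-∑ : ∀ {A B} {Φ : (A → Carrier) → Carrier} → Linear Φ → (xs : List B) (F : A → B → Carrier) →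
             Φ (λ a → ∑ xs (F a)) ≈ ∑ xs (λ b → Φ (λ a → F a b))
  linear-∑ L [] F = vanish L (λ a → refl)
  linear-∑ L (x ∷ xs) F = trans (L .+-hom _ _) (+-congˡ (linear-∑ L xs F))

  linear-[]· : ∀ {A} {Φ : (A → Carrier) → Carrier} → Linear Φ → ∀ b (f : A → Carrier) →
               Φ (λ a → [ b ]· f a) ≈ [ b ]· Φ f
  linear-[]· L true f = refl
  linear-[]· L false f = vanish L (λ a → refl)

  ∑-map : ∀ {A B} (h : A → B) xs (f : B → Carrier) → ∑ (map h xs) f ≈ ∑ xs (λ a → f (h a))
  ∑-map h [] f = refl
  ∑-map h (x ∷ xs) f = +-congˡ (∑-map h xs f)

  ∑-++ : ∀ {A} (xs ys : List A) f → ∑ (xs ++ ys) f ≈ ∑ xs f + ∑ ys f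
  ∑-++ [] ys f = sym (+-identityˡ _)
  ∑-++ (x ∷ xs) ys f = trans (+-congˡ (∑-++ xs ys f)) (sym (+-assoc _ _ _))

  ∑-concatMap : ∀ {A B} (h : A → List B) xs (f : B → Carrier) →
                ∑ (concatMap h xs) f ≈ ∑ xs (λ a → ∑ (h a) f)
  ∑-concatMap h [] f = refl
  ∑-concatMap h (x ∷ xs) f = trans (∑-++ (h x) (concatMap h xs) f) (+-congˡ (∑-concatMap h xs f))

  ∑-keep : ∀ {A} (p : A → Bool) xs f → ∑ (keep p xs) f ≈ ∑ xs (λ a → [ p a ]· f a)
  ∑-keep p [] f = refl
  ∑-keep p (x ∷ xs) f with p x
  ... | true = +-congˡ (∑-keep p xs f)
  ... | false = trans (∑-keep p xs f) (sym (+-identityˡ _))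

  ∏-++ : ∀ {A} (xs ys : List A) f → ∏ (xs ++ ys) f ≈ ∏ xs f * ∏ ys f
  ∏-++ [] ys f = sym (*-identityˡ _)
  ∏-++ (x ∷ xs) ys f = trans (*-congˡ (∏-++ xs ys f)) (sym (*-assoc _ _ _))

  -- The sum over i + j = a, with both indices as arguments so that no subtraction occurs.
  ∑ˢ : ℕ → (ℕ → ℕ → Carrier) → Carrier
  ∑ˢ zero h = h 0 0
  ∑ˢ (suc a) h = h 0 (suc a) + ∑ˢ a (λ i j → h (suc i) j)

  ∑ˢ-cong : ∀ a {h k : ℕ → ℕ → Carrier} → (∀ i j → h i j ≈ k i j) → ∑ˢ a h ≈ ∑ˢ a k
  ∑ˢ-cong zero e = e 0 0
  ∑ˢ-cong (suc a) e = +-cong (e 0 (suc a)) (∑ˢ-cong a (λ i → e (suc i)))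

  ∑ˢ-cong-+ : ∀ a {h k : ℕ → ℕ → Carrier} → (∀ i j → i ℕ.+ j ≡ a → h i j ≈ k i j) → ∑ˢ a h ≈ ∑ˢ a k
  ∑ˢ-cong-+ zero e = e 0 0 ≡.refl
  ∑ˢ-cong-+ (suc a) e = +-cong (e 0 (suc a) ≡.refl) (∑ˢ-cong-+ a (λ i j eq → e (suc i) j (≡.cong suc eq)))

  linear-∑ˢ : ∀ {A} {Φ : (A → Carrier) → Carrier} → Linear Φ → ∀ n (F : A → ℕ → ℕ → Carrier) →
              Φ (λ a → ∑ˢ n (F a)) ≈ ∑ˢ n (λ i j → Φ (λ a → F a i j))
  linear-∑ˢ L zero F = refl
  linear-∑ˢ L (suc n) F = trans (L .+-hom _ _) (+-congˡ (linear-∑ˢ L n _))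

  ∑ˢ-+ : ∀ a h k → ∑ˢ a (λ i j → h i j + k i j) ≈ ∑ˢ a h + ∑ˢ a k
  ∑ˢ-+ zero h k = refl
  ∑ˢ-+ (suc a) h k = trans (+-congˡ (∑ˢ-+ a _ _))
    (solve 4 (λ a b c d → (a :+ b) :+ (c :+ d) := (a :+ c) :+ (b :+ d)) refl _ _ _ _)

  ∑ˢ-last : ∀ a h → ∑ˢ (suc a) h ≈ ∑ˢ a (λ i j → h i (suc j)) + h (suc a) 0
  ∑ˢ-last zero h = refl
  ∑ˢ-last (suc a) h = trans (+-congˡ (∑ˢ-last a (λ i → h (suc i)))) (sym (+-assoc _ _ _))

  ∑ˢ-comm : ∀ a h → ∑ˢ a h ≈ ∑ˢ a (λ i j → h j i)
  ∑ˢ-comm zero h = refl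
  ∑ˢ-comm (suc a) h = begin
    h 0 (suc a) + ∑ˢ a (λ i j → h (suc i) j)   ≈⟨ +-comm _ _ ⟩
    ∑ˢ a (λ i j → h (suc i) j) + h 0 (suc a)   ≈⟨ +-congʳ (∑ˢ-comm a _) ⟩
    ∑ˢ a (λ i j → h (suc j) i) + h 0 (suc a)   ≈⟨ ∑ˢ-last a (λ i j → h j i) ⟨
    ∑ˢ (suc a) (λ i j → h j i)                 ∎

  -- Both sides run over the triples i + j + c = a; the induction splits off i = 0. This is
  -- associativity of the Cauchy product in one variable.
  ∑ˢ-assoc : ∀ a (h : ℕ → ℕ → ℕ → Carrier) →
             ∑ˢ a (λ k c → ∑ˢ k (λ i j → h i j c)) ≈ ∑ˢ a (λ i k → ∑ˢ k (λ j c → h i j c))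
  ∑ˢ-assoc zero h = refl
  ∑ˢ-assoc (suc a) h = begin
    h 0 0 (suc a) + ∑ˢ a (λ k c → h 0 (suc k) c + ∑ˢ k (λ i j → h (suc i) j c))
      ≈⟨ +-congˡ (∑ˢ-+ a _ _) ⟩
    h 0 0 (suc a) + (∑ˢ a (λ k c → h 0 (suc k) c) + ∑ˢ a (λ k c → ∑ˢ k (λ i j → h (suc i) j c)))
      ≈⟨ +-assoc _ _ _ ⟨
    ∑ˢ (suc a) (h 0) + ∑ˢ a (λ k c → ∑ˢ k (λ i j → h (suc i) j c))
      ≈⟨ +-congˡ (∑ˢ-assoc a (λ i → h (suc i))) ⟩
    ∑ˢ (suc a) (h 0) + ∑ˢ a (λ i k → ∑ˢ k (λ j c → h (suc i) j c))
      ∎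

-- Alternating sums and determinants

module Determinants (R : CommutativeRing 0ℓ 0ℓ) where
  open CommutativeRing R hiding (zero)
  open import Algebra.Properties.Ring ring
  open import Algebra.Properties.Group +-group using (⁻¹-involutive; inverseˡ-unique; ε⁻¹≈ε)
  open import Relation.Binary.Reasoning.Setoid setoid
  open IntegerCoefficientSolver R
  open LinearFunctionals R
  open Linear

  -- The choice of the member in position k (from 0) has the sign (-1)^k; the rest keeps its order.
  alt : {A : Set} → List A → (A → List A → Carrier) → Carrier
  alt [] G = 0#
  alt (a ∷ as) G = G a as - alt as (λ b bs → G b (a ∷ bs))

  alt-cong : ∀ {A} (as : List A) {G H : A → List A → Carrier} →
             (∀ b bs → G b bs ≈ H b bs) → alt as G ≈ alt as H
  alt-cong [] e = refl
  alt-cong (a ∷ as) e = +-cong (e a as) (-‿cong (alt-cong as (λ b bs → e b (a ∷ bs))))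

  alt-+ : ∀ {A} (as : List A) (G H : A → List A → Carrier) →
          alt as (λ b bs → G b bs + H b bs) ≈ alt as G + alt as H
  alt-+ [] G H = sym (+-identityˡ _)
  alt-+ (a ∷ as) G H = trans (+-congˡ (-‿cong (alt-+ as _ _)))
    (solve 4 (λ x y z w → (x :+ y) :- (z :+ w) := (x :- z) :+ (y :- w)) refl _ _ _ _)

  alt-* : ∀ {A} (as : List A) c (G : A → List A → Carrier) →
          alt as (λ b bs → c * G b bs) ≈ c * alt as G
  alt-* [] c G = sym (zeroʳ c)
  alt-* (a ∷ as) c G = trans (+-congˡ (-‿cong (alt-* as c _)))
    (solve 3 (λ c x y → c :* x :- c :* y := c :* (x :- y)) refl _ _ _)

  alt-linear : ∀ {A} (as : List A) → Linear (λ f → alt as (λ b bs → f (b , bs)))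
  alt-linear as .cong e = alt-cong as (λ b bs → e (b , bs))
  alt-linear as .+-hom f g = alt-+ as _ _
  alt-linear as .*-hom c f = alt-* as c _

  alt-vanish : ∀ {A} (as : List A) {G : A → List A → Carrier} →
               (∀ b bs → G b bs ≈ 0#) → alt as G ≈ 0#
  alt-vanish as e = vanish (alt-linear as) (λ { (b , bs) → e b bs })

  linear-alt : ∀ {A B} {Φ : (A → Carrier) → Carrier} → Linear Φ → (bs : List B)
               (F : A → B → List B → Carrier) →
               Φ (λ a → alt bs (F a)) ≈ alt bs (λ b cs → Φ (λ a → F a b cs))
  linear-alt L [] F = vanish L (λ a → refl)
  linear-alt L (b ∷ bs) F = trans (minus-hom L _ _) (+-congˡ (-‿cong (linear-alt L bs _)))

  -- Choosing a and then b has the opposite sign to choosing b and then a, so the terms cancel in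
  -- pairs; no division by 2 is involved.
  alt-alt-symmetric : ∀ {A} (as : List A) (H : A → A → List A → Carrier) →
    (∀ a b cs → H a b cs ≈ H b a cs) → alt as (λ a bs → alt bs (H a)) ≈ 0#
  alt-alt-symmetric [] H s = refl
  alt-alt-symmetric (a ∷ as) H s = begin
    alt as (H a) - alt as (λ b bs → H b a bs - alt bs (λ c cs → H b c (a ∷ cs)))
      ≈⟨ +-congˡ (-‿cong (minus-hom (alt-linear as)
           (λ (b , bs) → H b a bs) (λ (b , bs) → alt bs (λ c cs → H b c (a ∷ cs))))) ⟩
    alt as (H a) - (alt as (λ b bs → H b a bs) - alt as (λ b bs → alt bs (λ c cs → H b c (a ∷ cs))))
      ≈⟨ +-congˡ (-‿cong (+-cong (alt-cong as (λ b bs → s b a bs))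
           (-‿cong (alt-alt-symmetric as (λ b c cs → H b c (a ∷ cs)) (λ b c cs → s b c (a ∷ cs)))))) ⟩
    alt as (H a) - (alt as (H a) - 0#)
      ≈⟨ solve 1 (λ x → x :- (x :- con (+ 0)) := con (+ 0)) refl _ ⟩
    0#
      ∎

  -- Polarisation of `alt-alt-symmetric`, applied to `H a b + H b a`.
  alt-alt-swap : ∀ {A} (as : List A) (H : A → A → List A → Carrier) →
    alt as (λ a bs → alt bs (H a)) ≈ - alt as (λ a bs → alt bs (λ b → H b a))
  alt-alt-swap as H = inverseˡ-unique _ _ (begin
    alt as (λ a bs → alt bs (H a)) + alt as (λ a bs → alt bs (λ b → H b a))
      ≈⟨ alt-+ as _ _ ⟨
    alt as (λ a bs → alt bs (H a) + alt bs (λ b → H b a))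
      ≈⟨ alt-cong as (λ a bs → sym (alt-+ bs _ _)) ⟩
    alt as (λ a bs → alt bs (λ b cs → H a b cs + H b a cs))
      ≈⟨ alt-alt-symmetric as (λ a b cs → H a b cs + H b a cs) (λ a b cs → +-comm _ _) ⟩
    0#
      ∎)

  module _ {I J : Set} (M : J → I → Carrier) where

    -- Expansion along the first column: `js` lists the columns and `is` the rows. Lists of unequal
    -- length give 0.
    det : List J → List I → Carrier
    det [] [] = 1#
    det [] (_ ∷ _) = 0#
    det (j ∷ js) is = alt is (λ i is′ → M j i * det js is′)

    det-swap-head : ∀ j k js is → det (j ∷ k ∷ js) is ≈ - det (k ∷ j ∷ js) is
    det-swap-head j k js is = begin
      alt is (λ i is′ → M j i * alt is′ (λ i′ is″ → M k i′ * det js is″))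
        ≈⟨ alt-cong is (λ i is′ → sym (alt-* is′ _ _)) ⟩
      alt is (λ i is′ → alt is′ (λ i′ is″ → M j i * (M k i′ * det js is″)))
        ≈⟨ alt-alt-swap is _ ⟩
      - alt is (λ i is′ → alt is′ (λ i′ is″ → M j i′ * (M k i * det js is″)))
        ≈⟨ -‿cong (alt-cong is (λ i is′ → alt-cong is′ (λ i′ is″ →
             solve 3 (λ x y z → x :* (y :* z) := y :* (x :* z)) refl _ _ _))) ⟩
      - alt is (λ i is′ → alt is′ (λ i′ is″ → M k i * (M j i′ * det js is″)))
        ≈⟨ -‿cong (alt-cong is (λ i is′ → alt-* is′ _ _)) ⟩
      - det (k ∷ j ∷ js) is
        ∎

    det-swap : ∀ ps j k js is → det (ps ++ j ∷ k ∷ js) is ≈ - det (ps ++ k ∷ j ∷ js) is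
    det-swap [] j k js is = det-swap-head j k js is
    det-swap (p ∷ ps) j k js is = begin
      alt is (λ i is′ → M p i * det (ps ++ j ∷ k ∷ js) is′)
        ≈⟨ alt-cong is (λ i is′ → trans (*-congˡ (det-swap ps j k js is′)) (sym (-‿distribʳ-* _ _))) ⟩
      alt is (λ i is′ → - (M p i * det (ps ++ k ∷ j ∷ js) is′))
        ≈⟨ neg-hom (alt-linear is) (λ (i , is′) → M p i * det (ps ++ k ∷ j ∷ js) is′) ⟩
      - det (p ∷ ps ++ k ∷ j ∷ js) is
        ∎

    -- Passing two columns is an even permutation. This moves a column across a whole pair in
    -- `alt-pairs`.
    det-rotate : ∀ ps j k l js is → det (ps ++ j ∷ k ∷ l ∷ js) is ≈ det (ps ++ l ∷ j ∷ k ∷ js) is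
    det-rotate ps j k l js is = begin
      det (ps ++ j ∷ k ∷ l ∷ js) is           ≈⟨ under ps is ⟩
      - det (ps ++ j ∷ l ∷ k ∷ js) is         ≈⟨ -‿cong (det-swap ps j l (k ∷ js) is) ⟩
      - - det (ps ++ l ∷ j ∷ k ∷ js) is       ≈⟨ ⁻¹-involutive _ ⟩
      det (ps ++ l ∷ j ∷ k ∷ js) is           ∎
      where
      under : ∀ ps is → det (ps ++ j ∷ k ∷ l ∷ js) is ≈ - det (ps ++ j ∷ l ∷ k ∷ js) is
      under ps is = begin
        det (ps ++ j ∷ k ∷ l ∷ js) is            ≡⟨ ≡.cong (λ x → det x is) (Listₚ.++-assoc ps [ j ] _) ⟨
        det ((ps ++ [ j ]) ++ k ∷ l ∷ js) is     ≈⟨ det-swap (ps ++ [ j ]) k l js is ⟩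
        - det ((ps ++ [ j ]) ++ l ∷ k ∷ js) is   ≡⟨ ≡.cong (λ x → - det x is) (Listₚ.++-assoc ps [ j ] _) ⟩
        - det (ps ++ j ∷ l ∷ k ∷ js) is          ∎

    -- Antisymmetry would only give 2 det = 0 in a general ring; the summand of the double expansion
    -- is symmetric in the two rows chosen, and that gives 0 itself.
    det-repeat-head : ∀ j js is → det (j ∷ j ∷ js) is ≈ 0#
    det-repeat-head j js is = begin
      alt is (λ i is′ → M j i * alt is′ (λ i′ is″ → M j i′ * det js is″))
        ≈⟨ alt-cong is (λ i is′ → sym (alt-* is′ _ _)) ⟩
      alt is (λ i is′ → alt is′ (λ i′ is″ → M j i * (M j i′ * det js is″)))
        ≈⟨ alt-alt-symmetric is (λ i i′ is″ → M j i * (M j i′ * det js is″)) (λ i i′ is″ →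
             solve 3 (λ x y z → x :* (y :* z) := y :* (x :* z)) refl _ _ _) ⟩
      0#
        ∎

    det-vanish-tail : ∀ j js is → (∀ is′ → det js is′ ≈ 0#) → det (j ∷ js) is ≈ 0#
    det-vanish-tail j js is e = alt-vanish is (λ i is′ → trans (*-congˡ (e is′)) (zeroʳ _))

    det-repeat : ∀ j ps qs is → det (j ∷ ps ++ j ∷ qs) is ≈ 0#
    det-repeat j [] qs is = det-repeat-head j qs is
    det-repeat j (p ∷ ps) qs is = begin
      det (j ∷ p ∷ ps ++ j ∷ qs) is     ≈⟨ det-swap-head j p (ps ++ j ∷ qs) is ⟩
      - det (p ∷ j ∷ ps ++ j ∷ qs) is   ≈⟨ -‿cong (det-vanish-tail p (j ∷ ps ++ j ∷ qs) is (det-repeat j ps qs)) ⟩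
      - 0#                              ≈⟨ ε⁻¹≈ε ⟩
      0#                                ∎

    -- The term in which column `j` takes row `i` is common to both sides. In all others row `i`
    -- survives into the minor, is expanded there by induction, and the two alternating sums
    -- commute.
    det-expand-row : ∀ js i is → det js (i ∷ is) ≈ alt js (λ j js′ → M j i * det js′ is)
    det-expand-row [] i is = refl
    det-expand-row (j ∷ js) i is = +-congˡ (-‿cong (begin
      alt is (λ i′ is′ → M j i′ * det js (i ∷ is′))
        ≈⟨ alt-cong is (λ i′ is′ → *-congˡ (det-expand-row js i is′)) ⟩
      alt is (λ i′ is′ → M j i′ * alt js (λ k ks → M k i * det ks is′))
        ≈⟨ alt-cong is (λ i′ is′ → alt-* js _ _) ⟨
      alt is (λ i′ is′ → alt js (λ k ks → M j i′ * (M k i * det ks is′)))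
        ≈⟨ linear-alt (alt-linear is) js (λ (i′ , is′) k ks → M j i′ * (M k i * det ks is′)) ⟩
      alt js (λ k ks → alt is (λ i′ is′ → M j i′ * (M k i * det ks is′)))
        ≈⟨ alt-cong js (λ k ks → alt-cong is (λ i′ is′ →
             solve 3 (λ x y z → x :* (y :* z) := y :* (x :* z)) refl _ _ _)) ⟩
      alt js (λ k ks → alt is (λ i′ is′ → M k i * (M j i′ * det ks is′)))
        ≈⟨ alt-cong js (λ k ks → alt-* is _ _) ⟩
      alt js (λ k ks → M k i * det (j ∷ ks) is)
        ∎))

    alt-snoc : ∀ {A : Set} (as : List A) z (G : A → List A → Carrier) → (∀ bs → G z bs ≈ 0#) →
               alt (as ++ [ z ]) G ≈ alt as (λ b bs → G b (bs ++ [ z ]))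
    alt-snoc [] z G e = trans (+-congʳ (e [])) (-‿inverseʳ 0#)
    alt-snoc (a ∷ as) z G e = +-congˡ (-‿cong (alt-snoc as z _ (λ bs → e (a ∷ bs))))

    -- Row `z` meets only the column `l`, and they cross in the bottom right corner, so the
    -- surviving minor has the sign +.
    det-vanishing-row : ∀ js is z → All (λ j → M j z ≈ 0#) js → ∀ l →
                        det (js ++ [ l ]) (is ++ [ z ]) ≈ det js is * M l z
    det-vanishing-row [] [] z [] l = solve 1 (λ x → x :* con (+ 1) :- con (+ 0) := con (+ 1) :* x) refl (M l z)
    det-vanishing-row [] (i ∷ is) z [] l = trans (many is) (sym (zeroˡ _))
      where
      many : ∀ is → alt (i ∷ is ++ [ z ]) (λ i is′ → M l i * det [] is′) ≈ 0#
      many [] = trans (+-cong (zeroʳ _) (-‿cong (alt-vanish [ z ] (λ i is′ → zeroʳ (M l i))))) (-‿inverseʳ 0#)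
      many (i′ ∷ is) = trans (+-cong (zeroʳ _) (-‿cong (alt-vanish (i′ ∷ is ++ [ z ]) (λ i is′ → zeroʳ _)))) (-‿inverseʳ 0#)
    det-vanishing-row (j ∷ js) is z (e ∷ es) l = begin
      alt (is ++ [ z ]) (λ i is′ → M j i * det (js ++ [ l ]) is′)
        ≈⟨ alt-snoc is z (λ i is′ → M j i * det (js ++ [ l ]) is′) (λ bs →
             trans (*-congʳ e) (zeroˡ (det (js ++ [ l ]) bs))) ⟩
      alt is (λ i is′ → M j i * det (js ++ [ l ]) (is′ ++ [ z ]))
        ≈⟨ alt-cong is (λ i is′ → trans (*-congˡ (det-vanishing-row js is′ z es l)) (sym (*-assoc _ _ _))) ⟩
      alt is (λ i is′ → M j i * det js is′ * M l z)
        ≈⟨ *-homʳ (alt-linear is) (λ (i , is′) → M j i * det js is′) (M l z) ⟩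
      det (j ∷ js) is * M l z
        ∎

    -- Whichever `i` is chosen, `f i * ∏ is′ f` is the product over all of `is`.
    alt-∏ : ∀ is (f : I → Carrier) (G : I → List I → Carrier) →
            alt is (λ i is′ → f i * ∏ is′ f * G i is′) ≈ ∏ is f * alt is G
    alt-∏ [] f G = sym (zeroʳ _)
    alt-∏ (i ∷ is) f G = begin
      f i * ∏ is f * G i is - alt is (λ i′ is′ → f i′ * (f i * ∏ is′ f) * G i′ (i ∷ is′))
        ≈⟨ +-congˡ (-‿cong (alt-cong is (λ i′ is′ →
             solve 4 (λ x y z w → x :* (y :* z) :* w := x :* z :* (y :* w)) refl _ _ _ _))) ⟩
      f i * ∏ is f * G i is - alt is (λ i′ is′ → f i′ * ∏ is′ f * (f i * G i′ (i ∷ is′)))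
        ≈⟨ +-congˡ (-‿cong (trans (alt-∏ is f _) (*-congˡ (alt-* is (f i) _)))) ⟩
      f i * ∏ is f * G i is - ∏ is f * (f i * alt is (λ i′ is′ → G i′ (i ∷ is′)))
        ≈⟨ solve 4 (λ x y z w → x :* y :* z :- y :* (x :* w) := x :* y :* (z :- w)) refl _ _ _ _ ⟩
      f i * ∏ is f * (G i is - alt is (λ i′ is′ → G i′ (i ∷ is′)))
        ∎

  det-scale-rows : ∀ {I J} (M : J → I → Carrier) (f : I → Carrier) js is →
                   det (λ j i → f i * M j i) js is ≈ ∏ is f * det M js is
  det-scale-rows M f [] [] = sym (*-identityˡ _)
  det-scale-rows M f [] (_ ∷ _) = sym (zeroʳ _)
  det-scale-rows M f (j ∷ js) is = begin
    alt is (λ i is′ → f i * M j i * det (λ j i → f i * M j i) js is′)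
      ≈⟨ alt-cong is (λ i is′ → trans (*-congˡ (det-scale-rows M f js is′))
           (solve 4 (λ x y z w → x :* y :* (z :* w) := x :* z :* (y :* w)) refl _ _ _ _)) ⟩
    alt is (λ i is′ → f i * ∏ is′ f * (M j i * det M js is′))
      ≈⟨ alt-∏ M is f _ ⟩
    ∏ is f * det M (j ∷ js) is
      ∎

-- Pfaffians as sums of minors

module Pfaffians (R : CommutativeRing 0ℓ 0ℓ) where
  open CommutativeRing R hiding (zero)
  open import Relation.Binary.Reasoning.Setoid setoid
  open IntegerCoefficientSolver R
  open LinearFunctionals R
  open Linear
  open Determinants R

  pf : {I : Set} → (I → I → Carrier) → ℕ → List I → Carrier
  pf a zero [] = 1#
  pf a zero (_ ∷ _) = 0#
  pf a (suc k) [] = 0#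
  pf a (suc k) (i ∷ is) = alt is (λ j js → a i j * pf a k js)

  -- The counterpart of `alt` without signs, for choosing a pair of columns rather than a single
  -- column.
  pick : {K : Set} → List K → (K → List K → Carrier) → Carrier
  pick [] G = 0#
  pick (m ∷ ms) G = G m ms + pick ms (λ m′ ms′ → G m′ (m ∷ ms′))

  pick-cong : ∀ {K} (ms : List K) {G H : K → List K → Carrier} →
              (∀ m S → G m S ≈ H m S) → pick ms G ≈ pick ms H
  pick-cong [] e = refl
  pick-cong (m ∷ ms) e = +-cong (e m ms) (pick-cong ms (λ m′ S → e m′ (m ∷ S)))

  module _ {K : Set} (w : K → Carrier) where

    -- `F` is summed over the subsequences of `ms` of length k, each weighted by the product of `w`
    -- over its members.
    ∑ₛ : ℕ → List K → (List K → Carrier) → Carrier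
    ∑ₛ zero ms F = F []
    ∑ₛ (suc k) [] F = 0#
    ∑ₛ (suc k) (m ∷ ms) F = w m * ∑ₛ k ms (λ S → F (m ∷ S)) + ∑ₛ (suc k) ms F

    ∑ₛ-linear : ∀ k ms → Linear (∑ₛ k ms)
    ∑ₛ-linear zero ms = eval-linear []
    ∑ₛ-linear (suc k) [] = 0-linear
    ∑ₛ-linear (suc k) (m ∷ ms) =
      +-linear (*-linear (w m) (reindex-linear (m ∷_) (∑ₛ-linear k ms))) (∑ₛ-linear (suc k) ms)

    ∑ₛ-vanish-∷ : ∀ k ms {F} → (∀ m S → F (m ∷ S) ≈ 0#) → ∑ₛ (suc k) ms F ≈ 0#
    ∑ₛ-vanish-∷ k [] e = refl
    ∑ₛ-vanish-∷ k (m ∷ ms) e = trans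
      (+-cong (trans (*-congˡ (vanish (∑ₛ-linear k ms) (e m))) (zeroʳ _)) (∑ₛ-vanish-∷ k ms e))
      (+-identityˡ 0#)

    -- Choosing a subsequence and a member of it amounts to choosing the member and the rest
    -- independently, as the choices in which the rest contains the member contribute nothing.
    ∑ₛ-pick : ∀ k ms (G : K → List K → Carrier) → (∀ m P Q → G m (P ++ m ∷ Q) ≈ 0#) →
              ∑ₛ (suc k) ms (λ T → pick T G) ≈ ∑ ms (λ m → w m * ∑ₛ k ms (G m))
    ∑ₛ-pick k [] G e = refl
    ∑ₛ-pick zero (m ∷ ms) G e = +-cong (*-congˡ (+-identityʳ _)) (∑ₛ-pick zero ms G e)
    ∑ₛ-pick (suc k) (m ∷ ms) G e = begin
      w m * ∑ₛ (suc k) ms (λ S → G m S + pick S (λ m′ S′ → G m′ (m ∷ S′)))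
        + ∑ₛ (suc (suc k)) ms (λ T → pick T G)
        ≈⟨ +-cong (*-congˡ (L .+-hom _ _)) (∑ₛ-pick (suc k) ms G e) ⟩
      w m * (∑ₛ (suc k) ms (G m) + ∑ₛ (suc k) ms (λ S → pick S (λ m′ S′ → G m′ (m ∷ S′))))
        + ∑ ms (λ m′ → w m′ * ∑ₛ (suc k) ms (G m′))
        ≈⟨ +-congʳ (*-congˡ (+-congˡ
             (∑ₛ-pick k ms (λ m′ S′ → G m′ (m ∷ S′)) (λ m′ P Q → e m′ (m ∷ P) Q)))) ⟩
      w m * (∑ₛ (suc k) ms (G m) + ∑ ms (λ m′ → w m′ * ∑ₛ k ms (λ S′ → G m′ (m ∷ S′))))
        + ∑ ms (λ m′ → w m′ * ∑ₛ (suc k) ms (G m′))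
        ≈⟨ solve 4 (λ w x y z → w :* (x :+ y) :+ z := w :* x :+ (w :* y :+ z)) refl _ _ _ _ ⟩
      w m * ∑ₛ (suc k) ms (G m)
        + (w m * ∑ ms (λ m′ → w m′ * ∑ₛ k ms (λ S′ → G m′ (m ∷ S′)))
           + ∑ ms (λ m′ → w m′ * ∑ₛ (suc k) ms (G m′)))
        ≈⟨ +-congˡ (+-congʳ (∑-linear ms .*-hom _ _)) ⟨
      w m * ∑ₛ (suc k) ms (G m)
        + (∑ ms (λ m′ → w m * (w m′ * ∑ₛ k ms (λ S′ → G m′ (m ∷ S′))))
           + ∑ ms (λ m′ → w m′ * ∑ₛ (suc k) ms (G m′)))
        ≈⟨ +-congˡ (∑-linear ms .+-hom _ _) ⟨
      w m * ∑ₛ (suc k) ms (G m)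
        + ∑ ms (λ m′ → w m * (w m′ * ∑ₛ k ms (λ S′ → G m′ (m ∷ S′)))
                        + w m′ * ∑ₛ (suc k) ms (G m′))
        ≈⟨ +-cong (*-congˡ (sym first)) (∑-cong ms (λ m′ →
             solve 4 (λ w x y z → w :* (x :* y) :+ x :* z := x :* (w :* y :+ z)) refl _ _ _ _)) ⟩
      ∑ (m ∷ ms) (λ m′ → w m′ * ∑ₛ (suc k) (m ∷ ms) (G m′))
        ∎
      where
      L = ∑ₛ-linear (suc k) ms
      first : w m * ∑ₛ k ms (λ S → G m (m ∷ S)) + ∑ₛ (suc k) ms (G m) ≈ ∑ₛ (suc k) ms (G m)
      first = trans (+-congʳ (trans (*-congˡ (vanish (∑ₛ-linear k ms) (e m []))) (zeroʳ _)))
                    (+-identityˡ _)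

    module _ {I J : Set} (M : J → I → Carrier) (p q : K → J) where

      pairs : List K → List J
      pairs [] = []
      pairs (m ∷ ms) = p m ∷ q m ∷ pairs ms

      pairs-++ : ∀ S T → pairs (S ++ T) ≡ pairs S ++ pairs T
      pairs-++ [] T = ≡.refl
      pairs-++ (m ∷ S) T = ≡.cong (λ js → p m ∷ q m ∷ js) (pairs-++ S T)

      -- An even number of columns precedes each pair, so its first member is chosen with the sign +
      -- and its second with the sign -. The partner left behind is then rotated past the preceding
      -- pairs to the front.
      alt-pairs : ∀ T (H : J → List J → Carrier) →
        (∀ j P a b c Q → H j (P ++ a ∷ b ∷ c ∷ Q) ≈ H j (P ++ c ∷ a ∷ b ∷ Q)) →
        alt (pairs T) H ≈ pick T (λ m S → H (p m) (q m ∷ pairs S) - H (q m) (p m ∷ pairs S))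
      alt-pairs [] H rot = refl
      alt-pairs (m ∷ T) H rot = begin
        H (p m) (q m ∷ pairs T)
          - (H (q m) (p m ∷ pairs T) - alt (pairs T) (λ j js → H j (p m ∷ q m ∷ js)))
          ≈⟨ solve 3 (λ x y z → x :- (y :- z) := x :- y :+ z) refl _ _ _ ⟩
        H (p m) (q m ∷ pairs T) - H (q m) (p m ∷ pairs T)
          + alt (pairs T) (λ j js → H j (p m ∷ q m ∷ js))
          ≈⟨ +-congˡ (alt-pairs T _ (λ j P → rot j (p m ∷ q m ∷ P))) ⟩
        H (p m) (q m ∷ pairs T) - H (q m) (p m ∷ pairs T)
          + pick T (λ m′ S → H (p m′) (p m ∷ q m ∷ q m′ ∷ pairs S)
                             - H (q m′) (p m ∷ q m ∷ p m′ ∷ pairs S))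
          ≈⟨ +-congˡ (pick-cong T (λ m′ S → +-cong (rot _ [] _ _ _ _) (-‿cong (rot _ [] _ _ _ _)))) ⟩
        pick (m ∷ T) (λ m S → H (p m) (q m ∷ pairs S) - H (q m) (p m ∷ pairs S))
          ∎

      -- Minor summation: the Pfaffian of ∑ₘ w(m) (p m ∧ q m) is a weighted sum of minors.
      pf-minors : ∀ (a : I → I → Carrier) ms →
        (∀ i j → a i j ≈ ∑ ms (λ m → w m * (M (p m) i * M (q m) j - M (q m) i * M (p m) j))) →
        ∀ k is → pf a k is ≈ ∑ₛ k ms (λ T → det M (pairs T) is)
      pf-minors a ms e zero [] = refl
      pf-minors a ms e zero (_ ∷ _) = refl
      pf-minors a ms e (suc k) [] = sym (∑ₛ-vanish-∷ k ms (λ m S → refl))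
      pf-minors a ms e (suc k) (i ∷ is) = begin
        alt is (λ j js → a i j * pf a k js)
          ≈⟨ alt-cong is (λ j js → *-cong (e i j) (pf-minors a ms e k js)) ⟩
        alt is (λ j js → ∑ ms (λ m → w m * c m j) * ∑ₛ k ms (λ S → det M (pairs S) js))
          ≈⟨ alt-cong is (λ j js → trans (sym (*-homʳ (∑-linear ms) _ _)) (∑-cong ms (λ m →
               trans (*-assoc _ _ _) (*-congˡ (sym (∑ₛ-linear k ms .*-hom _ _)))))) ⟩
        alt is (λ j js → ∑ ms (λ m → w m * ∑ₛ k ms (λ S → c m j * det M (pairs S) js)))
          ≈⟨ linear-∑ (alt-linear is) ms
               (λ (j , js) m → w m * ∑ₛ k ms (λ S → c m j * det M (pairs S) js)) ⟩
        ∑ ms (λ m → alt is (λ j js → w m * ∑ₛ k ms (λ S → c m j * det M (pairs S) js)))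
          ≈⟨ ∑-cong ms (λ m → trans (alt-* is _ _) (*-congˡ
               (sym (linear-alt (∑ₛ-linear k ms) is (λ S j js → c m j * det M (pairs S) js))))) ⟩
        ∑ ms (λ m → w m * ∑ₛ k ms (λ S → alt is (λ j js → c m j * det M (pairs S) js)))
          ≈⟨ ∑-cong ms (λ m → *-congˡ (∑ₛ-linear k ms .cong (λ S → expand m S))) ⟩
        ∑ ms (λ m → w m * ∑ₛ k ms (G m))
          -- Here `m` and `S` range independently, but a minor with m in S repeats a column. What
          -- remains is a set T with a marked member, which is also what expansion of the minor of T
          -- along row `i` produces.
          ≈⟨ ∑ₛ-pick k ms G G-repeat ⟨
        ∑ₛ (suc k) ms (λ T → pick T G)
          ≈⟨ ∑ₛ-linear (suc k) ms .cong (λ T →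
               trans (det-expand-row M (pairs T) i is)
                     (alt-pairs T (λ j js → M j i * det M js is)
                        (λ j P a b c Q → *-congˡ (det-rotate M P a b c Q is)))) ⟨
        ∑ₛ (suc k) ms (λ T → det M (pairs T) (i ∷ is))
          ∎
        where
        c : K → I → Carrier
        c m j = M (p m) i * M (q m) j - M (q m) i * M (p m) j

        G : K → List K → Carrier
        G m S = M (p m) i * det M (q m ∷ pairs S) is - M (q m) i * det M (p m ∷ pairs S) is

        -- The alternating sum over the rows `j` absorbs the entries `M (q m) j` and `M (p m) j` as
        -- a new first column of the minor.
        expand : ∀ m S → alt is (λ j js → c m j * det M (pairs S) js) ≈ G m S
        expand m S = begin
          alt is (λ j js → c m j * det M (pairs S) js)
            ≈⟨ alt-cong is (λ j js → solve 5
                 (λ x y z w d → (x :* y :- z :* w) :* d := x :* (y :* d) :- z :* (w :* d)) refl _ _ _ _ _) ⟩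
          alt is (λ j js → M (p m) i * (M (q m) j * det M (pairs S) js)
                           - M (q m) i * (M (p m) j * det M (pairs S) js))
            ≈⟨ minus-hom (alt-linear is)
                 (λ (j , js) → M (p m) i * (M (q m) j * det M (pairs S) js))
                 (λ (j , js) → M (q m) i * (M (p m) j * det M (pairs S) js)) ⟩
          alt is (λ j js → M (p m) i * (M (q m) j * det M (pairs S) js))
            - alt is (λ j js → M (q m) i * (M (p m) j * det M (pairs S) js))
            ≈⟨ +-cong (alt-* is _ _) (-‿cong (alt-* is _ _)) ⟩
          G m S
            ∎

        repeat-q : ∀ m P Q → det M (q m ∷ pairs P ++ p m ∷ q m ∷ pairs Q) is ≈ 0#
        repeat-q m P Q = begin
          det M (q m ∷ pairs P ++ p m ∷ q m ∷ pairs Q) is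
            ≡⟨ ≡.cong (λ js → det M (q m ∷ js) is) (Listₚ.++-assoc (pairs P) [ p m ] _) ⟨
          det M (q m ∷ (pairs P ++ [ p m ]) ++ q m ∷ pairs Q) is
            ≈⟨ det-repeat M (q m) (pairs P ++ [ p m ]) (pairs Q) is ⟩
          0#
            ∎

        G-repeat : ∀ m P Q → G m (P ++ m ∷ Q) ≈ 0#
        G-repeat m P Q rewrite pairs-++ P (m ∷ Q) = begin
          M (p m) i * det M (q m ∷ pairs P ++ p m ∷ q m ∷ pairs Q) is
            - M (q m) i * det M (p m ∷ pairs P ++ p m ∷ q m ∷ pairs Q) is
            ≈⟨ +-cong (*-congˡ (repeat-q m P Q))
                      (-‿cong (*-congˡ (det-repeat M (p m) (pairs P) (q m ∷ pairs Q) is))) ⟩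
          M (p m) i * 0# - M (q m) i * 0#
            ≈⟨ solve 2 (λ x y → x :* con (+ 0) :- y :* con (+ 0) := con (+ 0)) refl _ _ ⟩
          0#
            ∎

-- Interlacing partitions and the recursion for the alternant

≤ᵇ-true : ∀ {m n} → m ≤ n → (m ≤ᵇ n) ≡ true
≤ᵇ-true {m} {n} p with m ≤ᵇ n | ℕₚ.≤⇒≤ᵇ p
... | true | _ = ≡.refl

≤ᵇ-false : ∀ {m n} → n < m → (m ≤ᵇ n) ≡ false
≤ᵇ-false {m} {n} p with m ≤ᵇ n in eq
... | false = ≡.refl
... | true with () ← ℕₚ.<⇒≱ p (ℕₚ.≤ᵇ⇒≤ m n (≡.subst T (≡.sym eq) tt))

≤ᵇ-sound : ∀ m n → (m ≤ᵇ n) ≡ true → m ≤ n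
≤ᵇ-sound m n eq = ℕₚ.≤ᵇ⇒≤ m n (≡.subst T (≡.sym eq) tt)

raise-head : ∀ {p b as} → b ≤ p → Linked _≥_ (b ∷ as) → Linked _≥_ (p ∷ as)
raise-head b≤p [-] = [-]
raise-head b≤p (c≤b ∷ desc) = ℕₚ.≤-trans c≤b b≤p ∷ desc

module Branching (R : CommutativeRing 0ℓ 0ℓ) where
  open CommutativeRing R hiding (zero)
  open import Algebra.Properties.Semiring.Exp semiring using (_^_)
  open import Relation.Binary.Reasoning.Setoid setoid
  open IntegerCoefficientSolver R
  open LinearFunctionals R
  open Linear
  open Determinants R

  -- ∑_{m ≤ a} y^(a - m) F(m), without subtraction.
  ∑ʰ : Carrier → ℕ → (ℕ → Carrier) → Carrier
  ∑ʰ y zero F = F 0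
  ∑ʰ y (suc a) F = y * ∑ʰ y a F + F (suc a)

  ∑ʰ-linear : ∀ y a → Linear (∑ʰ y a)
  ∑ʰ-linear y zero = eval-linear 0
  ∑ʰ-linear y (suc a) = +-linear (*-linear y (∑ʰ-linear y a)) (eval-linear (suc a))

  ∑ʰ-cong-≤ : ∀ y a {F G} → (∀ m → m ≤ a → F m ≈ G m) → ∑ʰ y a F ≈ ∑ʰ y a G
  ∑ʰ-cong-≤ y zero e = e 0 z≤n
  ∑ʰ-cong-≤ y (suc a) e =
    +-cong (*-congˡ (∑ʰ-cong-≤ y a (λ m m≤a → e m (ℕₚ.m≤n⇒m≤1+n m≤a)))) (e (suc a) ℕₚ.≤-refl)

  -- The Horner form on the right is what column operations produce. The left is what tableaux
  -- produce: a row of length a has m smaller letters and q copies of the largest.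
  ∑ʰ-∑ˢ : ∀ y a (F : ℕ → Carrier) → ∑ˢ a (λ m q → y ^ q * F m) ≈ ∑ʰ y a F
  ∑ʰ-∑ˢ y zero F = *-identityˡ _
  ∑ʰ-∑ˢ y (suc a) F = begin
    ∑ˢ (suc a) (λ m q → y ^ q * F m)
      ≈⟨ ∑ˢ-last a (λ m q → y ^ q * F m) ⟩
    ∑ˢ a (λ m q → y * y ^ q * F m) + 1# * F (suc a)
      ≈⟨ +-cong (∑ˢ-cong a (λ m q → *-assoc _ _ _)) (*-identityˡ _) ⟩
    ∑ˢ a (λ m q → y * (y ^ q * F m)) + F (suc a)
      ≈⟨ +-congʳ (sym (linear-∑ˢ (*-linear y (eval-linear 0)) a (λ _ m q → y ^ q * F m))) ⟩
    y * ∑ˢ a (λ m q → y ^ q * F m) + F (suc a)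
      ≈⟨ +-congʳ (*-congˡ (∑ʰ-∑ˢ y a F)) ⟩
    ∑ʰ y (suc a) F
      ∎

  ∑ʰ-<-vanish : ∀ y a b (F : ℕ → Carrier) → a < b → ∑ʰ y a (λ m → [ b ≤ᵇ m ]· F m) ≈ 0#
  ∑ʰ-<-vanish y a b F a<b = trans
    (∑ʰ-cong-≤ y a (λ m m≤a → reflexive (≡.cong ([_]· F m) (≤ᵇ-false (ℕₚ.≤-<-trans m≤a a<b)))))
    (vanish (∑ʰ-linear y a) (λ _ → refl))

  ∑ʰ-start : ∀ y b (F : ℕ → Carrier) → ∑ʰ y b (λ m → [ b ≤ᵇ m ]· F m) ≈ F b
  ∑ʰ-start y zero F = refl
  ∑ʰ-start y (suc b) F rewrite ≤ᵇ-true (ℕₚ.≤-refl {suc b}) = begin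
    y * ∑ʰ y b (λ m → [ suc b ≤ᵇ m ]· F m) + F (suc b)
      ≈⟨ +-congʳ (*-congˡ (∑ʰ-<-vanish y b (suc b) F ℕₚ.≤-refl)) ⟩
    y * 0# + F (suc b)
      ≈⟨ solve 2 (λ y f → y :* con (+ 0) :+ f := f) refl _ _ ⟩
    F (suc b)
      ∎

  -- The factorisation of x^(d+1) - y^(d+1), multiplied by x^(b+s). The upper limit is written
  -- `d + b` so that the induction runs over the length of the interval.
  ∑ʰ-geometric : ∀ x y s b d →
    (x - y) * ∑ʰ y (d ℕ.+ b) (λ m → [ b ≤ᵇ m ]· x ^ (m ℕ.+ s))
      ≈ x ^ suc (d ℕ.+ b ℕ.+ s) - y ^ suc d * x ^ (b ℕ.+ s)
  ∑ʰ-geometric x y s b zero = trans (*-congˡ (∑ʰ-start y b (λ m → x ^ (m ℕ.+ s))))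
    (solve 3 (λ x y p → (x :- y) :* p := x :* p :- y :* con (+ 1) :* p) refl _ _ _)
  ∑ʰ-geometric x y s b (suc d) rewrite ≤ᵇ-true (ℕₚ.m≤n+m b (suc d)) = begin
    (x - y) * (y * S + P)
      ≈⟨ solve 4 (λ x y S P → (x :- y) :* (y :* S :+ P) := y :* ((x :- y) :* S) :+ (x :- y) :* P) refl _ _ _ _ ⟩
    y * ((x - y) * S) + (x - y) * P
      ≈⟨ +-congʳ (*-congˡ (∑ʰ-geometric x y s b d)) ⟩
    y * (P - y ^ suc d * Q) + (x - y) * P
      ≈⟨ solve 5 (λ x y Z P Q → y :* (P :- Z :* Q) :+ (x :- y) :* P := x :* P :- y :* Z :* Q) refl _ _ _ _ _ ⟩
    x * P - y ^ suc (suc d) * Q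
      ∎
    where
    S = ∑ʰ y (d ℕ.+ b) (λ m → [ b ≤ᵇ m ]· x ^ (m ℕ.+ s))
    P = x ^ suc (d ℕ.+ b ℕ.+ s)
    Q = x ^ (b ℕ.+ s)

  -- Sum over the partitions μ with one part less that interlace with λ, weighted by y^(|λ| - |μ|).
  branch : Carrier → List ℕ → (List ℕ → Carrier) → Carrier
  branch y [] F = F []
  branch y (a ∷ []) F = y ^ a * F []
  branch y (a ∷ b ∷ as) F = ∑ʰ y a (λ m → [ b ≤ᵇ m ]· branch y (b ∷ as) (λ μ → F (m ∷ μ)))

  branch-linear : ∀ y λs → Linear (branch y λs)
  branch-linear y [] = eval-linear []
  branch-linear y (a ∷ []) = *-linear (y ^ a) (eval-linear [])
  branch-linear y (a ∷ b ∷ as) = bind-linear (∑ʰ-linear y a) (λ m →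
    []·-linear (b ≤ᵇ m) (reindex-linear (m ∷_) (branch-linear y (b ∷ as))))

  []·-cong-if : ∀ b {r s} → (b ≡ true → r ≈ s) → [ b ]· r ≈ [ b ]· s
  []·-cong-if true e = e ≡.refl
  []·-cong-if false e = refl

  -- The parts chosen so far are at least `b`, and the remaining ones are bounded by `b`; hence
  -- every μ that occurs is a partition bounded by `a`.
  branch-cong : ∀ y a as {F G} → Linked _≥_ (a ∷ as) →
    (∀ μ → Linked _≥_ (a ∷ μ) → length μ ≡ length as → F μ ≈ G μ) →
    branch y (a ∷ as) F ≈ branch y (a ∷ as) G
  branch-cong y a [] _ e = *-congˡ (e [] [-] ≡.refl)
  branch-cong y a (b ∷ as) (_ ∷ desc) e = ∑ʰ-cong-≤ y a (λ m m≤a → []·-cong-if (b ≤ᵇ m) (λ eq →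
    branch-cong y b as desc (λ μ desc′ len →
      e (m ∷ μ) (m≤a ∷ raise-head (≤ᵇ-sound b m eq) desc′) (≡.cong suc len))))

  -- λ + δ, where the staircase δ is that of the full list: trailing zeros count.
  exponents : List ℕ → List ℕ
  exponents [] = []
  exponents (a ∷ as) = (a ℕ.+ length as) ∷ exponents as

  module _ {I : Set} (x : I → Carrier) where

    powers : ℕ → I → Carrier
    powers l i = x i ^ l

    private
      -- Columns are arbitrary functions here, because the column operations lead out of the pure
      -- powers.
      columns : List (I → Carrier) → List I → Carrier
      columns = det (λ c → c)

    det-map : ∀ {J : Set} (M : J → I → Carrier) js is → columns (map M js) is ≈ det M js is
    det-map M [] [] = refl
    det-map M [] (_ ∷ _) = refl
    det-map M (j ∷ js) is = alt-cong is (λ i is′ → *-congˡ (det-map M js is′))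

    module _ (z : I) where

      private
        y = x z

        lastPart : List ℕ → ℕ
        lastPart [] = 0
        lastPart (a ∷ []) = a
        lastPart (a ∷ b ∷ as) = lastPart (b ∷ as)

        -- Each entry is a column minus a multiple of the next one, divided by `x i - y` (see
        -- `quotient-step`). The last column has no successor, so there is one entry fewer than
        -- there are parts.
        quotients : List ℕ → List (I → Carrier)
        quotients (a ∷ b ∷ as) =
          (λ i → ∑ʰ y a (λ m → [ b ≤ᵇ m ]· x i ^ (m ℕ.+ length as))) ∷ quotients (b ∷ as)
        quotients _ = []

        scaled : (I → Carrier) → I → Carrier
        scaled c i = (x i - y) * c i

      quotient-step : ∀ a b s i → b ≤ a →
        (x i - y) * ∑ʰ y a (λ m → [ b ≤ᵇ m ]· x i ^ (m ℕ.+ s))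
          ≈ x i ^ (a ℕ.+ suc s) - y ^ suc (a ∸ b) * x i ^ (b ℕ.+ s)
      quotient-step a b s i b≤a with ∑ʰ-geometric (x i) y s b (a ∸ b)
      ... | e rewrite ℕₚ.m∸n+n≡m b≤a | ℕₚ.+-suc a s = e

      -- From each column subtract the multiple of the next one that makes its row z vanish.
      column-operations : ∀ a as → Linked _≥_ (a ∷ as) → ∀ is →
        det powers (exponents (a ∷ as)) is
          ≈ columns (map scaled (quotients (a ∷ as)) ++ [ powers (lastPart (a ∷ as)) ]) is
      column-operations a [] _ is rewrite ℕₚ.+-identityʳ a = sym (det-map powers [ a ] is)
      column-operations a (b ∷ as) (b≤a ∷ desc) is = begin
        alt is (λ i is′ → x i ^ l * D is′)
          -- A multiple of a determinant with the column `l′` twice is subtracted, with the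
          -- coefficient that makes the first column vanish at `x i = y`. The later columns are
          -- still pure powers at this moment; the induction changes them afterwards.
          ≈⟨ solve 2 (λ d e → d := d :- e :* con (+ 0)) refl _ (y ^ suc (a ∸ b)) ⟩
        alt is (λ i is′ → x i ^ l * D is′) - y ^ suc (a ∸ b) * 0#
          ≈⟨ +-congˡ (-‿cong (*-congˡ (det-repeat-head powers l′ (exponents as) is))) ⟨
        alt is (λ i is′ → x i ^ l * D is′) - y ^ suc (a ∸ b) * alt is (λ i is′ → x i ^ l′ * D is′)
          ≈⟨ +-congˡ (-‿cong (alt-* is _ _)) ⟨
        alt is (λ i is′ → x i ^ l * D is′) - alt is (λ i is′ → y ^ suc (a ∸ b) * (x i ^ l′ * D is′))
          ≈⟨ minus-hom (alt-linear is) (λ (i , is′) → x i ^ l * D is′)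
               (λ (i , is′) → y ^ suc (a ∸ b) * (x i ^ l′ * D is′)) ⟨
        alt is (λ i is′ → x i ^ l * D is′ - y ^ suc (a ∸ b) * (x i ^ l′ * D is′))
          ≈⟨ alt-cong is (λ i is′ → trans
               (solve 4 (λ p e q d → p :* d :- e :* (q :* d) := (p :- e :* q) :* d) refl _ _ _ _)
               (*-cong (sym (quotient-step a b (length as) i b≤a)) (column-operations b as desc is′))) ⟩
        columns (map scaled (quotients (a ∷ b ∷ as)) ++ [ powers (lastPart (b ∷ as)) ]) is
          ∎
        where
        l = a ℕ.+ suc (length as)
        l′ = b ℕ.+ length as
        D = det powers (exponents (b ∷ as))

      -- Multilinearity in the columns: each quotient is itself a sum over a part m between b and a
      -- with weight y^(a - m). The factor for the last part completes the weight to y^(|λ| - |μ|).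
      branch-quotients : ∀ a as → Linked _≥_ (a ∷ as) → ∀ is →
        columns (quotients (a ∷ as)) is * y ^ lastPart (a ∷ as)
          ≈ branch y (a ∷ as) (λ μ → det powers (exponents μ) is)
      branch-quotients a [] _ [] = *-comm _ _
      branch-quotients a [] _ (_ ∷ _) = *-comm _ _
      branch-quotients a (b ∷ as) (b≤a ∷ desc) is = begin
        alt is (λ i is′ → q i * columns (quotients (b ∷ as)) is′) * Y
          ≈⟨ *-homʳ (alt-linear is) (λ (i , is′) → q i * columns (quotients (b ∷ as)) is′) Y ⟨
        alt is (λ i is′ → q i * columns (quotients (b ∷ as)) is′ * Y)
          ≈⟨ alt-cong is (λ i is′ → trans (*-assoc _ _ _) (*-congˡ (branch-quotients b as desc is′))) ⟩
        alt is (λ i is′ → q i * branch y (b ∷ as) (λ μ → det powers (exponents μ) is′))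
          ≈⟨ alt-cong is (λ i is′ → trans (sym (*-homʳ (∑ʰ-linear y a) _ _)) (∑ʰ-linear y a .cong (λ m →
               trans (*-comm _ _) (trans (sym ([]·-*ˡ (b ≤ᵇ m) _ _)) ([]·-cong (b ≤ᵇ m)
                 (trans (*-comm _ _) (sym (branch-linear y (b ∷ as) .*-hom _ _)))))))) ⟩
        alt is (λ i is′ → Φ (λ (m , μ) → x i ^ (m ℕ.+ length as) * det powers (exponents μ) is′))
          ≈⟨ linear-alt Φ-linear is
               (λ (m , μ) i is′ → x i ^ (m ℕ.+ length as) * det powers (exponents μ) is′) ⟨
        Φ (λ (m , μ) → det powers (m ℕ.+ length as ∷ exponents μ) is)
          -- As μ has the length of `as`, the exponent of m is the one that `exponents (m ∷ μ)`
          -- assigns to it.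
          ≈⟨ ∑ʰ-linear y a .cong (λ m → []·-cong (b ≤ᵇ m) (branch-cong y b as desc (λ μ _ len →
               reflexive (≡.cong (λ n → det powers (m ℕ.+ n ∷ exponents μ) is) (≡.sym len))))) ⟩
        branch y (a ∷ b ∷ as) (λ μ → det powers (exponents μ) is)
          ∎
        where
        q : I → Carrier
        q i = ∑ʰ y a (λ m → [ b ≤ᵇ m ]· x i ^ (m ℕ.+ length as))
        Y = y ^ lastPart (b ∷ as)
        Φ : (ℕ × List ℕ → Carrier) → Carrier
        Φ f = ∑ʰ y a (λ m → [ b ≤ᵇ m ]· branch y (b ∷ as) (λ μ → f (m , μ)))
        Φ-linear : Linear Φ
        Φ-linear = bind-linear (∑ʰ-linear y a) (λ m →
          []·-linear (b ≤ᵇ m) (reindex-linear (m ,_) (branch-linear y (b ∷ as))))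

      scaled-vanish : ∀ cs → All (λ c → c z ≈ 0#) (map scaled cs)
      scaled-vanish [] = []
      scaled-vanish (c ∷ cs) = trans (*-congʳ (-‿inverseʳ y)) (zeroˡ _) ∷ scaled-vanish cs

      -- After the column operations row `z` is zero outside the last column, and each remaining row
      -- i carries the factor `x i - x z`.
      alternant-branch : ∀ a as → Linked _≥_ (a ∷ as) → ∀ is →
        det powers (exponents (a ∷ as)) (is ++ [ z ])
          ≈ ∏ is (λ i → x i - x z) * branch (x z) (a ∷ as) (λ μ → det powers (exponents μ) is)
      alternant-branch a as desc is = begin
        det powers (exponents (a ∷ as)) (is ++ [ z ])
          ≈⟨ column-operations a as desc (is ++ [ z ]) ⟩
        columns (map scaled Q ++ [ powers (lastPart (a ∷ as)) ]) (is ++ [ z ])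
          ≈⟨ det-vanishing-row _ _ is z (scaled-vanish Q) _ ⟩
        columns (map scaled Q) is * Y
          ≈⟨ *-congʳ (trans (det-map scaled Q is) (det-scale-rows (λ c → c) (λ i → x i - y) Q is)) ⟩
        ∏ is (λ i → x i - y) * columns Q is * Y
          ≈⟨ trans (*-assoc _ _ _) (*-congˡ (branch-quotients a as desc is)) ⟩
        ∏ is (λ i → x i - y) * branch y (a ∷ as) (λ μ → det powers (exponents μ) is)
          ∎
        where
        Q = quotients (a ∷ as)
        Y = y ^ lastPart (a ∷ as)

-- Semistandard tableaux row by row

range-snoc : ∀ k → range 1 (suc k) ≡ range 1 k ++ [ suc k ]
range-snoc k = begin
  map (ℕ._+ 1) (upTo (suc k))              ≡⟨ ≡.cong (map (ℕ._+ 1)) (Listₚ.upTo-∷ʳ k) ⟨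
  map (ℕ._+ 1) (upTo k ++ [ k ])           ≡⟨ Listₚ.map-++ (ℕ._+ 1) (upTo k) [ k ] ⟩
  map (ℕ._+ 1) (upTo k) ++ [ k ℕ.+ 1 ]     ≡⟨ ≡.cong (λ l → range 1 k ++ [ l ]) (ℕₚ.+-comm k 1) ⟩
  range 1 k ++ [ suc k ]                   ∎
  where open ≡.≡-Reasoning

range-bounds : ∀ k → All (λ a → 1 ≤ a × a ≤ k) (range 1 k)
range-bounds k = Allₚ.map⁺ (Allₚ.applyUpTo⁺₁ (λ a → a) k (λ {a} a<k →
  ℕₚ.m≤n+m 1 a , ≡.subst (_≤ k) (ℕₚ.+-comm 1 a) a<k))

≤ᵇ-suc : ∀ m n → (suc m ≤ᵇ suc n) ≡ (m ≤ᵇ n)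
≤ᵇ-suc zero n = ≡.refl
≤ᵇ-suc (suc m) n = ≡.refl

-- The row condition with a running lower bound, so that a row can be summed letter by letter as in
-- `∑-rows`.
weaklyIncreasingFrom : ℕ → List ℕ → Bool
weaklyIncreasingFrom lo [] = true
weaklyIncreasingFrom lo (a ∷ as) = (lo ≤ᵇ a) ∧ weaklyIncreasingFrom a as

rowsWeak-∷ : ∀ row T → rowsWeak (row ∷ T) ≡ weaklyIncreasingFrom 0 row ∧ rowsWeak T
rowsWeak-∷ [] T = ≡.refl
rowsWeak-∷ (a ∷ as) T = from a as
  where
  from : ∀ a as → rowsWeak ((a ∷ as) ∷ T) ≡ weaklyIncreasingFrom a as ∧ rowsWeak T
  from a [] = ≡.refl
  from a (b ∷ as) = begin
    rowsWeak ((a ∷ b ∷ as) ∷ T)                                  ≡⟨ Boolₚ.∧-assoc (a ≤ᵇ b) _ _ ⟩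
    (a ≤ᵇ b) ∧ rowsWeak ((b ∷ as) ∷ T)                           ≡⟨ ≡.cong ((a ≤ᵇ b) ∧_) (from b as) ⟩
    (a ≤ᵇ b) ∧ (weaklyIncreasingFrom b as ∧ rowsWeak T)          ≡⟨ Boolₚ.∧-assoc (a ≤ᵇ b) _ _ ⟨
    weaklyIncreasingFrom a (b ∷ as) ∧ rowsWeak T                 ∎
    where open ≡.≡-Reasoning

-- `zipWith` truncates, so an empty upper row imposes nothing; the top row of a tableau is treated
-- as lying below `[]`.
strict : List ℕ → List ℕ → Bool
strict r s = allᵇ (λ b → b) (zipWith _<ᵇ_ r s)

strict-[] : ∀ r → strict r [] ≡ true
strict-[] [] = ≡.refl
strict-[] (_ ∷ _) = ≡.refl

<ᵇ-true : ∀ {m n} → m < n → (m <ᵇ n) ≡ true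
<ᵇ-true {m} {n} p = ≤ᵇ-true p

<ᵇ-false : ∀ {m n} → n ≤ m → (m <ᵇ n) ≡ false
<ᵇ-false {m} {n} p = ≤ᵇ-false (s≤s p)

-- An upper entry k + 1 admits nothing below it, while a lower entry k + 1 may stand under anything
-- up to k. So the whole lower row must fit under the unpadded entries of the upper one: the length
-- test is the interlacing condition between the shape and its part in the letters up to k.
strict-padded : ∀ k {r s} q p → All (_≤ k) r → All (_≤ k) s → length s ℕ.+ p ≤ length r ℕ.+ q →
  strict (r ++ replicate q (suc k)) (s ++ replicate p (suc k))
    ≡ ((length s ℕ.+ p) ≤ᵇ length r) ∧ strict r s
strict-padded k q zero [] [] le = strict-[] (replicate q (suc k))
strict-padded k (suc q) (suc p) [] [] le rewrite <ᵇ-false {suc k} ℕₚ.≤-refl = ≡.refl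
strict-padded k (suc q) p [] (b≤k ∷ bs) le rewrite <ᵇ-false (ℕₚ.m≤n⇒m≤1+n b≤k) = ≡.refl
strict-padded k q zero (a≤k ∷ as) [] le = ≡.refl
strict-padded k {a ∷ r} q (suc p) (a≤k ∷ as) [] (s≤s le) = begin
  (a <ᵇ suc k) ∧ strict (r ++ replicate q (suc k)) (replicate p (suc k))
    ≡⟨ ≡.cong₂ _∧_ (<ᵇ-true (s≤s a≤k)) (strict-padded k q p as [] le) ⟩
  (p ≤ᵇ length r) ∧ strict r []
    ≡⟨ ≡.cong₂ _∧_ (≤ᵇ-suc p (length r)) (≡.sym (strict-[] r)) ⟨
  (suc p ≤ᵇ suc (length r)) ∧ true
    ∎
  where open ≡.≡-Reasoning
strict-padded k {a ∷ r} {b ∷ s} q p (a≤k ∷ as) (b≤k ∷ bs) (s≤s le) = begin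
  (a <ᵇ b) ∧ strict (r ++ replicate q (suc k)) (s ++ replicate p (suc k))
    ≡⟨ ≡.cong ((a <ᵇ b) ∧_) (strict-padded k q p as bs le) ⟩
  (a <ᵇ b) ∧ (((length s ℕ.+ p) ≤ᵇ length r) ∧ strict r s)
    ≡⟨ Boolₚ.∧-assoc (a <ᵇ b) _ _ ⟨
  ((a <ᵇ b) ∧ ((length s ℕ.+ p) ≤ᵇ length r)) ∧ strict r s
    ≡⟨ ≡.cong (_∧ strict r s) (Boolₚ.∧-comm (a <ᵇ b) _) ⟩
  (((length s ℕ.+ p) ≤ᵇ length r) ∧ (a <ᵇ b)) ∧ strict r s
    ≡⟨ Boolₚ.∧-assoc ((length s ℕ.+ p) ≤ᵇ length r) _ _ ⟩
  ((length s ℕ.+ p) ≤ᵇ length r) ∧ strict (a ∷ r) (b ∷ s)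
    ≡⟨ ≡.cong (_∧ strict (a ∷ r) (b ∷ s)) (≤ᵇ-suc (length s ℕ.+ p) (length r)) ⟨
  (suc (length s ℕ.+ p) ≤ᵇ suc (length r)) ∧ strict (a ∷ r) (b ∷ s)
    ∎
  where open ≡.≡-Reasoning

module Tableaux (R : CommutativeRing 0ℓ 0ℓ) (x : ℕ → CommutativeRing.Carrier R) where
  open CommutativeRing R hiding (zero)
  open import Relation.Binary.Reasoning.Setoid setoid
  open LinearFunctionals R
  open Linear

  ∑-cong-All : ∀ {A : Set} {P : A → Set} {xs : List A} → All P xs → {f g : A → Carrier} →
               (∀ a → P a → f a ≈ g a) → ∑ xs f ≈ ∑ xs g
  ∑-cong-All [] e = refl
  ∑-cong-All (p ∷ ps) e = +-cong (e _ p) (∑-cong-All ps e)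

  -- The rows have length r and entries between max(lo, 1) and k.
  ∑-rows : ℕ → ℕ → ℕ → (List ℕ → Carrier) → Carrier
  ∑-rows k lo zero f = f []
  ∑-rows k lo (suc r) f = ∑ (range 1 k) (λ a → [ lo ≤ᵇ a ]· ∑-rows k a r (λ as → f (a ∷ as)))

  ∑-rows-cong : ∀ k lo r {f g} →
    (∀ row → All (_≤ k) row → length row ≡ r → f row ≈ g row) → ∑-rows k lo r f ≈ ∑-rows k lo r g
  ∑-rows-cong k lo zero e = e [] [] ≡.refl
  ∑-rows-cong k lo (suc r) e = ∑-cong-All (range-bounds k) (λ a (_ , a≤k) → []·-cong (lo ≤ᵇ a)
    (∑-rows-cong k a r (λ row row≤k len → e (a ∷ row) (a≤k ∷ row≤k) (≡.cong suc len))))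

  ∑-rows-linear : ∀ k lo r → Linear (∑-rows k lo r)
  ∑-rows-linear k lo zero = eval-linear []
  ∑-rows-linear k lo (suc r) = bind-linear (∑-linear (range 1 k)) (λ a →
    []·-linear (lo ≤ᵇ a) (reindex-linear (a ∷_) (∑-rows-linear k a r)))

  linear-∑-rows : ∀ {A} {Φ : (A → Carrier) → Carrier} → Linear Φ → ∀ k lo r (F : A → List ℕ → Carrier) →
                  Φ (λ a → ∑-rows k lo r (F a)) ≈ ∑-rows k lo r (λ row → Φ (λ a → F a row))
  linear-∑-rows L k lo zero F = refl
  linear-∑-rows L k lo (suc r) F = trans (linear-∑ L (range 1 k) _) (∑-cong (range 1 k) (λ b →
    trans (linear-[]· L (lo ≤ᵇ b) _) ([]·-cong (lo ≤ᵇ b) (linear-∑-rows L k b r _))))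

  ∑-rowsIn : ∀ k lo r f →
    ∑ (rowsIn r k) (λ row → [ weaklyIncreasingFrom lo row ]· f row) ≈ ∑-rows k lo r f
  ∑-rowsIn k lo zero f = +-identityʳ _
  ∑-rowsIn k lo (suc r) f = begin
    ∑ (concatMap (λ a → map (a ∷_) (rowsIn r k)) (range 1 k)) (λ row → [ weaklyIncreasingFrom lo row ]· f row)
      ≈⟨ ∑-concatMap _ (range 1 k) _ ⟩
    ∑ (range 1 k) (λ a → ∑ (map (a ∷_) (rowsIn r k)) (λ row → [ weaklyIncreasingFrom lo row ]· f row))
      ≈⟨ ∑-cong (range 1 k) (λ a → trans (∑-map (a ∷_) (rowsIn r k) _) (trans
           (∑-cong (rowsIn r k) (λ row → []·-∧ (lo ≤ᵇ a) (weaklyIncreasingFrom a row) _))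
           (trans (linear-[]· (∑-linear (rowsIn r k)) (lo ≤ᵇ a) _)
                  ([]·-cong (lo ≤ᵇ a) (∑-rowsIn k a r _))))) ⟩
    ∑-rows k lo (suc r) f
      ∎

  -- r is the row above the rows of lengths λs.
  tableaux : ℕ → List ℕ → List ℕ → Carrier
  tableaux k r [] = 1#
  tableaux k r (l ∷ λs) = ∑-rows k 0 l (λ s → [ strict r s ]· (∏ s x * tableaux k s λs))

  ∑-fillings : ∀ k r λs →
    ∑ (fillings λs k) (λ T → [ rowsWeak T ∧ colsStrict (r ∷ T) ]· ∏ (concat T) x) ≈ tableaux k r λs
  ∑-fillings k r [] = +-identityʳ _
  ∑-fillings k r (l ∷ λs) = begin
    ∑ (fillings (l ∷ λs) k) (λ T → [ rowsWeak T ∧ colsStrict (r ∷ T) ]· ∏ (concat T) x)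
      ≈⟨ ∑-concatMap _ (rowsIn l k) _ ⟩
    ∑ (rowsIn l k) (λ s → ∑ (map (s ∷_) (fillings λs k))
      (λ T → [ rowsWeak T ∧ colsStrict (r ∷ T) ]· ∏ (concat T) x))
      ≈⟨ ∑-cong (rowsIn l k) (λ s → trans (∑-map (s ∷_) (fillings λs k) _)
           (∑-cong (fillings λs k) (λ T → trans (split s T) (*-comm _ _)))) ⟩
    ∑ (rowsIn l k) (λ s → ∑ (fillings λs k)
      (λ T → [ rowsWeak T ∧ colsStrict (s ∷ T) ]· ∏ (concat T) x * c s))
      ≈⟨ ∑-cong (rowsIn l k) (λ s → trans (*-homʳ (∑-linear (fillings λs k)) _ _)
           (trans (*-congʳ (∑-fillings k s λs)) (regroup s))) ⟩
    ∑ (rowsIn l k) (λ s → [ weaklyIncreasingFrom 0 s ]· [ strict r s ]· (∏ s x * tableaux k s λs))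
      ≈⟨ ∑-rowsIn k 0 l _ ⟩
    tableaux k r (l ∷ λs)
      ∎
    where
    c : List ℕ → Carrier
    c s = [ weaklyIncreasingFrom 0 s ]· [ strict r s ]· ∏ s x

    regroup : ∀ s → tableaux k s λs * c s
                    ≈ [ weaklyIncreasingFrom 0 s ]· [ strict r s ]· (∏ s x * tableaux k s λs)
    regroup s = begin
      tableaux k s λs * c s
        ≈⟨ []·-*ˡ (weaklyIncreasingFrom 0 s) _ _ ⟨
      [ weaklyIncreasingFrom 0 s ]· (tableaux k s λs * [ strict r s ]· ∏ s x)
        ≈⟨ []·-cong (weaklyIncreasingFrom 0 s) ([]·-*ˡ (strict r s) _ _) ⟨
      [ weaklyIncreasingFrom 0 s ]· [ strict r s ]· (tableaux k s λs * ∏ s x)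
        ≈⟨ []·-cong (weaklyIncreasingFrom 0 s) ([]·-cong (strict r s) (*-comm _ _)) ⟩
      [ weaklyIncreasingFrom 0 s ]· [ strict r s ]· (∏ s x * tableaux k s λs)
        ∎

    split : ∀ s T → [ rowsWeak (s ∷ T) ∧ colsStrict (r ∷ s ∷ T) ]· ∏ (concat (s ∷ T)) x
                    ≈ c s * [ rowsWeak T ∧ colsStrict (s ∷ T) ]· ∏ (concat T) x
    split s T rewrite rowsWeak-∷ s T
      with weaklyIncreasingFrom 0 s | rowsWeak T | strict r s | colsStrict (s ∷ T)
    ... | false | _     | _     | _     = sym (zeroˡ _)
    ... | true  | false | _     | _     = sym (zeroʳ _)
    ... | true  | true  | false | _     = sym (zeroˡ _)
    ... | true  | true  | true  | false = sym (zeroʳ _)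
    ... | true  | true  | true  | true  = ∏-++ s (concat T) x

  schur-tableaux : ∀ k λs → ∑ (ssyt λs k) (λ T → ∏ (concat T) x) ≈ tableaux k [] λs
  schur-tableaux k λs = begin
    ∑ (ssyt λs k) (λ T → ∏ (concat T) x)
      ≈⟨ ∑-keep _ (fillings λs k) _ ⟩
    ∑ (fillings λs k) (λ T → [ rowsWeak T ∧ colsStrict T ]· ∏ (concat T) x)
      ≈⟨ ∑-cong (fillings λs k) (λ T → reflexive
           (≡.cong (λ b → [ rowsWeak T ∧ b ]· ∏ (concat T) x) (below-[] T))) ⟩
    ∑ (fillings λs k) (λ T → [ rowsWeak T ∧ colsStrict ([] ∷ T) ]· ∏ (concat T) x)
      ≈⟨ ∑-fillings k [] λs ⟩
    tableaux k [] λs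
      ∎
    where
    below-[] : ∀ T → colsStrict T ≡ colsStrict ([] ∷ T)
    below-[] [] = ≡.refl
    below-[] (_ ∷ _) = ≡.refl

  ∑-range-snoc : ∀ k f → ∑ (range 1 (suc k)) f ≈ ∑ (range 1 k) f + f (suc k)
  ∑-range-snoc k f = begin
    ∑ (range 1 (suc k)) f                  ≡⟨ ≡.cong (λ is → ∑ is f) (range-snoc k) ⟩
    ∑ (range 1 k ++ [ suc k ]) f           ≈⟨ ∑-++ (range 1 k) [ suc k ] f ⟩
    ∑ (range 1 k) f + (f (suc k) + 0#)     ≈⟨ +-congˡ (+-identityʳ _) ⟩
    ∑ (range 1 k) f + f (suc k)            ∎

  ∑-rows-top : ∀ k r f → ∑-rows (suc k) (suc k) r f ≈ f (replicate r (suc k))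
  ∑-rows-top k zero f = refl
  ∑-rows-top k (suc r) f = begin
    ∑ (range 1 (suc k)) g
      ≈⟨ ∑-range-snoc k g ⟩
    ∑ (range 1 k) g + g (suc k)
      ≈⟨ +-cong (trans (∑-cong-All (range-bounds k) (λ a (_ , a≤k) →
             reflexive (≡.cong ([_]· G a) (≤ᵇ-false (s≤s a≤k))))) (vanish (∑-linear (range 1 k)) (λ _ → refl)))
           (reflexive (≡.cong ([_]· G (suc k)) (≤ᵇ-true (ℕₚ.≤-refl {suc k})))) ⟩
    0# + G (suc k)
      ≈⟨ trans (+-identityˡ _) (∑-rows-top k r _) ⟩
    f (replicate (suc r) (suc k))
      ∎
    where
    G g : ℕ → Carrier
    G a = ∑-rows (suc k) a r (λ as → f (a ∷ as))
    g a = [ suc k ≤ᵇ a ]· G a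

  -- In a weakly increasing row the copies of the largest letter form a final segment, here of
  -- length q.
  ∑-rows-split : ∀ k lo r f → lo ≤ suc k →
    ∑-rows (suc k) lo r f ≈ ∑ˢ r (λ m q → ∑-rows k lo m (λ row → f (row ++ replicate q (suc k))))
  ∑-rows-split k lo zero f _ = refl
  ∑-rows-split k lo (suc r) f lo≤ = begin
    ∑ (range 1 (suc k)) (λ a → [ lo ≤ᵇ a ]· G a)
      ≈⟨ ∑-range-snoc k _ ⟩
    ∑ (range 1 k) (λ a → [ lo ≤ᵇ a ]· G a) + [ lo ≤ᵇ suc k ]· G (suc k)
      ≈⟨ +-comm _ _ ⟩
    [ lo ≤ᵇ suc k ]· G (suc k) + ∑ (range 1 k) (λ a → [ lo ≤ᵇ a ]· G a)
      -- A first letter k + 1 forces the constant row, which is the summand with m = 0.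
      ≈⟨ +-cong (trans (reflexive (≡.cong ([_]· G (suc k)) (≤ᵇ-true lo≤))) (∑-rows-top k r _))
           (∑-cong-All (range-bounds k) (λ a (_ , a≤k) →
             []·-cong (lo ≤ᵇ a) (∑-rows-split k a r _ (ℕₚ.m≤n⇒m≤1+n a≤k)))) ⟩
    f (replicate (suc r) (suc k)) + ∑ (range 1 k) (λ a → [ lo ≤ᵇ a ]· ∑ˢ r (H a))
      ≈⟨ +-congˡ (linear-∑ˢ (bind-linear (∑-linear (range 1 k)) (λ a →
           []·-linear (lo ≤ᵇ a) (eval-linear a))) r H) ⟩
    f (replicate (suc r) (suc k)) + ∑ˢ r (λ m q → ∑ (range 1 k) (λ a → [ lo ≤ᵇ a ]· H a m q))
      ∎
    where
    G : ℕ → Carrier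
    G a = ∑-rows (suc k) a r (λ as → f (a ∷ as))
    H : ℕ → ℕ → ℕ → Carrier
    H a m q = ∑-rows k a m (λ row → f (a ∷ row ++ replicate q (suc k)))

-- Schur polynomials and alternants

module Bialternants (R : CommutativeRing 0ℓ 0ℓ) (x : ℕ → CommutativeRing.Carrier R) where
  open CommutativeRing R hiding (zero)
  open import Algebra.Properties.Semiring.Exp semiring using (_^_)
  open import Relation.Binary.Reasoning.Setoid setoid
  open IntegerCoefficientSolver R
  open LinearFunctionals R
  open Linear
  open Determinants R
  open Branching R
  open Tableaux R x

  -- Unlike branch, these keep the number of rows; the first row of μ is at most p in branchBelow.
  branchBelow : Carrier → ℕ → List ℕ → (List ℕ → Carrier) → Carrier
  branchBelow y p [] F = F []
  branchBelow y p (b ∷ as) F =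
    [ b ≤ᵇ p ]· ∑ʰ y b (λ m → branchBelow y m as (λ μ → F (m ∷ μ)))

  branchRows : Carrier → ℕ → List ℕ → (List ℕ → Carrier) → Carrier
  branchRows y a as F = ∑ʰ y a (λ m → branchBelow y m as (λ μ → F (m ∷ μ)))

  branchBelow-linear : ∀ y p as → Linear (branchBelow y p as)
  branchBelow-linear y p [] = eval-linear []
  branchBelow-linear y p (b ∷ as) = []·-linear (b ≤ᵇ p)
    (bind-linear (∑ʰ-linear y b) (λ m → reindex-linear (m ∷_) (branchBelow-linear y m as)))

  ∏-replicate : ∀ q i → ∏ (replicate q i) x ≈ x i ^ q
  ∏-replicate zero i = refl
  ∏-replicate (suc q) i = *-congˡ (∏-replicate q i)

  mutual
    -- `r′` stands for the letters of `r` up to k, and `c` for the interlacing condition extracted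
    -- by `strict-padded`. The abstraction covers the top row, with nothing above and `c` true,
    -- together with all later rows.
    tableaux-branch-rows : ∀ k r r′ l λs c →
      (∀ s p → All (_≤ k) s → length s ℕ.+ p ≡ l →
        strict r (s ++ replicate p (suc k)) ≡ c ∧ strict r′ s) →
      Linked _≥_ (l ∷ λs) →
      tableaux (suc k) r (l ∷ λs) ≈ [ c ]· branchRows (x (suc k)) l λs (tableaux k r′)
    tableaux-branch-rows k r r′ l λs c strict-eq desc = begin
      ∑-rows (suc k) 0 l (λ s → [ strict r s ]· (∏ s x * tableaux (suc k) s λs))
        ≈⟨ ∑-rows-split k 0 l _ z≤n ⟩
      ∑ˢ l (λ m p → ∑-rows k 0 m (λ s → let s′ = s ++ replicate p (suc k) in
        [ strict r s′ ]· (∏ s′ x * tableaux (suc k) s′ λs)))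
        ≈⟨ ∑ˢ-cong-+ l (λ m p m+p≡l → ∑-rows-cong k 0 m (λ s s≤k len → summand m p m+p≡l s s≤k len)) ⟩
      ∑ˢ l (λ m p → ∑-rows k 0 m (λ s → [ c ]· (y ^ p * below m s)))
        ≈⟨ ∑ˢ-cong l (λ m p → trans (linear-[]· (∑-rows-linear k 0 m) c _)
             ([]·-cong c (∑-rows-linear k 0 m .*-hom _ _))) ⟩
      ∑ˢ l (λ m p → [ c ]· (y ^ p * ∑-rows k 0 m (below m)))
        ≈⟨ linear-∑ˢ ([]·-linear c (eval-linear 0)) l (λ _ m p → y ^ p * ∑-rows k 0 m (below m)) ⟨
      [ c ]· ∑ˢ l (λ m p → y ^ p * ∑-rows k 0 m (below m))
        ≈⟨ []·-cong c (∑ʰ-∑ˢ y l _) ⟩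
      [ c ]· ∑ʰ y l (λ m → ∑-rows k 0 m (below m))
        ≈⟨ []·-cong c (∑ʰ-linear y l .cong (λ m → linear-∑-rows (branchBelow-linear y m λs) k 0 m
             (λ μ s → [ strict r′ s ]· (∏ s x * tableaux k s μ)))) ⟨
      [ c ]· ∑ʰ y l (λ m → branchBelow y m λs (λ μ → tableaux k r′ (m ∷ μ)))
        ∎
      where
      y = x (suc k)
      below : ℕ → List ℕ → Carrier
      below m s = branchBelow y m λs (λ μ → [ strict r′ s ]· (∏ s x * tableaux k s μ))

      summand : ∀ m p → m ℕ.+ p ≡ l → ∀ s → All (_≤ k) s → length s ≡ m →
        [ strict r (s ++ replicate p (suc k)) ]·
          (∏ (s ++ replicate p (suc k)) x * tableaux (suc k) (s ++ replicate p (suc k)) λs)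
        ≈ [ c ]· (y ^ p * below m s)
      summand m p ≡.refl s s≤k ≡.refl rewrite strict-eq s p s≤k ≡.refl =
        trans ([]·-∧ c (strict r′ s) _) ([]·-cong c (begin
          [ strict r′ s ]· (∏ (s ++ replicate p (suc k)) x * tableaux (suc k) (s ++ replicate p (suc k)) λs)
            ≈⟨ []·-cong (strict r′ s) (*-cong
                 (trans (∏-++ s _ x) (*-congˡ (∏-replicate p (suc k))))
                 (tableaux-branch-below k s p λs s≤k desc)) ⟩
          [ strict r′ s ]· (∏ s x * y ^ p * branchBelow y m λs (tableaux k s))
            ≈⟨ []·-cong (strict r′ s) (trans (*-assoc _ _ _)
                 (solve 3 (λ a b c → a :* (b :* c) := b :* (a :* c)) refl _ _ _)) ⟩
          [ strict r′ s ]· (y ^ p * (∏ s x * branchBelow y m λs (tableaux k s)))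
            ≈⟨ []·-*ˡ (strict r′ s) _ _ ⟩
          y ^ p * [ strict r′ s ]· (∏ s x * branchBelow y m λs (tableaux k s))
            ≈⟨ *-congˡ ([]·-cong (strict r′ s) (branchBelow-linear y m λs .*-hom _ _)) ⟨
          y ^ p * [ strict r′ s ]· branchBelow y m λs (λ μ → ∏ s x * tableaux k s μ)
            ≈⟨ *-congˡ (linear-[]· (branchBelow-linear y m λs) (strict r′ s) _) ⟨
          y ^ p * below m s
            ∎))

    tableaux-branch-below : ∀ k r q λs → All (_≤ k) r → Linked _≥_ (length r ℕ.+ q ∷ λs) →
      tableaux (suc k) (r ++ replicate q (suc k)) λs
        ≈ branchBelow (x (suc k)) (length r) λs (tableaux k r)
    tableaux-branch-below k r q [] r≤k _ = refl
    tableaux-branch-below k r q (l ∷ λs) r≤k (l≤ ∷ desc) =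
      tableaux-branch-rows k (r ++ replicate q (suc k)) r l λs (l ≤ᵇ length r)
        (λ { s p s≤k ≡.refl → strict-padded k q p r≤k s≤k l≤ }) desc

  tableaux-branch : ∀ k l λs → Linked _≥_ (l ∷ λs) →
    tableaux (suc k) [] (l ∷ λs) ≈ branchRows (x (suc k)) l λs (tableaux k [])
  tableaux-branch k l λs = tableaux-branch-rows k [] [] l λs true (λ s p _ _ → ≡.refl)

  ∑ʰ-at-0 : ∀ y a F → (∀ m → F (suc m) ≈ 0#) → ∑ʰ y a F ≈ y ^ a * F 0
  ∑ʰ-at-0 y zero F e = sym (*-identityˡ _)
  ∑ʰ-at-0 y (suc a) F e = trans (+-cong (*-congˡ (∑ʰ-at-0 y a F e)) (e a))
    (trans (+-identityʳ _) (sym (*-assoc _ _ _)))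

  -- If `F` vanishes on shapes with a positive last part, the last row must lose all of its boxes.
  -- This yields the power of y with which `branch` drops the last part.
  branchRows-branch : ∀ y a as F → Linked _≥_ (a ∷ as) →
    (∀ μ m → Linked _≥_ (μ ++ [ suc m ]) → length μ ≡ length as → F (μ ++ [ suc m ]) ≈ 0#) →
    branchRows y a as F ≈ branch y (a ∷ as) (λ μ → F (μ ++ [ 0 ]))
  branchRows-branch y a as F desc e =
    go a as F desc (λ μ m desc′ → e μ m (Linked.tail desc′))
    where
    go : ∀ a as F → Linked _≥_ (a ∷ as) →
      (∀ μ m → Linked _≥_ (a ∷ μ ++ [ suc m ]) → length μ ≡ length as → F (μ ++ [ suc m ]) ≈ 0#) →
      branchRows y a as F ≈ branch y (a ∷ as) (λ μ → F (μ ++ [ 0 ]))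
    go a [] F desc e = trans
      -- The hypothesis only kills the positive values up to `a`. A function that is 0 at every
      -- positive value has the same sum and suits `∑ʰ-at-0`.
      (∑ʰ-cong-≤ y a {G = λ { zero → F [ 0 ] ; (suc m) → 0# }}
        (λ { zero _ → refl ; (suc m) m<a → e [] m (m<a ∷ [-]) ≡.refl }))
      (∑ʰ-at-0 y a _ (λ m → refl))
    go a (b ∷ as) F (_ ∷ desc) e = ∑ʰ-cong-≤ y a (λ m m≤a → []·-cong-if (b ≤ᵇ m) (λ eq →
      go b as (λ μ → F (m ∷ μ)) desc (λ μ m′ desc′ len →
        e (m ∷ μ) m′ (m≤a ∷ raise-head (≤ᵇ-sound b m eq) desc′) (≡.cong suc len))))

  -- Columns are strictly increasing, so a filling with entries at most k has at most k nonempty rows.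
  tableaux-vanish : ∀ k h r pre c rest →
    (∀ b bs → 1 ≤ b → strict r (b ∷ bs) ≡ true → h < b) →
    k ≤ h ℕ.+ length pre → All (0 <_) pre → tableaux k r (pre ++ suc c ∷ rest) ≈ 0#
  tableaux-vanish k h r [] c rest above k≤h [] = trans
    (∑-cong-All (range-bounds k) (λ b (1≤b , b≤k) → ∑-rows-linear k b c .cong (λ bs → empty b bs 1≤b b≤k)))
    (vanish (∑-linear (range 1 k)) (λ b → vanish (∑-rows-linear k b c) (λ bs → refl)))
    where
    empty : ∀ b bs → 1 ≤ b → b ≤ k →
            [ strict r (b ∷ bs) ]· (∏ (b ∷ bs) x * tableaux k (b ∷ bs) rest) ≈ 0#
    empty b bs 1≤b b≤k with strict r (b ∷ bs) in eq
    ... | false = refl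
    ... | true = ⊥-elim (ℕₚ.<⇒≱ (above b bs 1≤b eq)
      (ℕₚ.≤-trans b≤k (≡.subst (k ≤_) (ℕₚ.+-identityʳ h) k≤h)))
  tableaux-vanish k h r (suc a ∷ pre) c rest above k≤ (_ ∷ pos) = trans
    (∑-cong-All (range-bounds k) (λ b (1≤b , b≤k) → ∑-rows-linear k b a .cong (λ bs → step b bs 1≤b)))
    (vanish (∑-linear (range 1 k)) (λ b → vanish (∑-rows-linear k b a) (λ bs → refl)))
    where
    step : ∀ b bs → 1 ≤ b →
           [ strict r (b ∷ bs) ]· (∏ (b ∷ bs) x * tableaux k (b ∷ bs) (pre ++ suc c ∷ rest)) ≈ 0#
    step b bs 1≤b with strict r (b ∷ bs) in eq
    ... | false = refl
    -- The first entry `b` of this row exceeds h and is the new strict lower bound for the next row,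
    -- so the bound grows by at least 1 while `pre` loses one row.
    ... | true = trans (*-congˡ (tableaux-vanish k b (b ∷ bs) pre c rest
        (λ b′ bs′ _ eq′ → ℕₚ.<ᵇ⇒< b b′ (Boolₚ.T-≡ .Equivalence.from (first (b <ᵇ b′) _ eq′)))
        (ℕₚ.≤-trans k≤ (ℕₚ.≤-trans (ℕₚ.≤-reflexive (ℕₚ.+-suc h (length pre)))
          (ℕₚ.+-monoˡ-≤ (length pre) (above b bs 1≤b eq)))) pos)) (zeroʳ _)
      where
      first : ∀ a b → a ∧ b ≡ true → a ≡ true
      first true b _ = ≡.refl

  positive-initial : ∀ μ m → Linked _≥_ (μ ++ [ suc m ]) → All (0 <_) μ
  positive-initial [] m _ = []
  positive-initial (a ∷ []) m (m<a ∷ _) = ℕₚ.≤-trans (s≤s z≤n) m<a ∷ []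
  positive-initial (a ∷ b ∷ μ) m (b≤a ∷ desc) with positive-initial (b ∷ μ) m desc
  ... | 0<b ∷ pos = ℕₚ.≤-trans 0<b b≤a ∷ 0<b ∷ pos

  tableaux-trailing-0 : ∀ k r λs → tableaux k r (λs ++ [ 0 ]) ≈ tableaux k r λs
  tableaux-trailing-0 k r [] rewrite strict-[] r = *-identityˡ _
  tableaux-trailing-0 k r (l ∷ λs) = ∑-rows-linear k 0 l .cong (λ s →
    []·-cong (strict r s) (*-congˡ (tableaux-trailing-0 k s λs)))

  vand : List ℕ → Carrier
  vand [] = 1#
  vand (i ∷ is) = ∏ is (λ j → x i - x j) * vand is

  vand-snoc : ∀ is z → vand (is ++ [ z ]) ≈ vand is * ∏ is (λ i → x i - x z)
  vand-snoc [] z = refl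
  vand-snoc (i ∷ is) z = begin
    ∏ (is ++ [ z ]) (λ j → x i - x j) * vand (is ++ [ z ])
      ≈⟨ *-cong (∏-++ is [ z ] _) (vand-snoc is z) ⟩
    ∏ is (λ j → x i - x j) * ((x i - x z) * 1#) * (vand is * ∏ is (λ j → x j - x z))
      ≈⟨ solve 4 (λ a b c d → a :* (b :* con (+ 1)) :* (c :* d) := a :* c :* (b :* d)) refl _ _ _ _ ⟩
    vand (i ∷ is) * ∏ (i ∷ is) (λ i → x i - x z)
      ∎

  -- The partition carries its zeros, so there are as many columns as variables; an interlacing μ
  -- has one part fewer, in step with the variable removed.
  bialternant : ∀ k λs → length λs ≡ k → Linked _≥_ λs →
    vand (range 1 k) * tableaux k [] λs ≈ det (powers x) (exponents λs) (range 1 k)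
  bialternant zero [] len desc = *-identityˡ _
  bialternant (suc k) (a ∷ as) len desc = begin
    vand (range 1 (suc k)) * tableaux (suc k) [] (a ∷ as)
      ≈⟨ *-cong (trans (reflexive (≡.cong vand (range-snoc k))) (vand-snoc (range 1 k) (suc k)))
                (tableaux-branch k a as desc) ⟩
    V * P * branchRows y a as (tableaux k [])
      -- A shape with k + 1 positive rows has no tableau in k letters.
      ≈⟨ *-congˡ (branchRows-branch y a as (tableaux k []) desc (λ μ m desc′ len′ →
           tableaux-vanish k 0 [] μ m [] (λ b bs 1≤b _ → 1≤b)
             (ℕₚ.≤-reflexive (≡.sym (≡.trans len′ (ℕₚ.suc-injective len))))
             (positive-initial μ m desc′))) ⟩
    V * P * branch y (a ∷ as) (λ μ → tableaux k [] (μ ++ [ 0 ]))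
      ≈⟨ *-congˡ (branch-linear y (a ∷ as) .cong (λ μ → tableaux-trailing-0 k [] μ)) ⟩
    V * P * branch y (a ∷ as) (tableaux k [])
      ≈⟨ solve 3 (λ v p b → v :* p :* b := p :* (v :* b)) refl _ _ _ ⟩
    P * (V * branch y (a ∷ as) (tableaux k []))
      ≈⟨ *-congˡ (branch-linear y (a ∷ as) .*-hom _ _) ⟨
    P * branch y (a ∷ as) (λ μ → V * tableaux k [] μ)
      ≈⟨ *-congˡ (branch-cong y a as desc (λ μ desc′ len′ →
           bialternant k μ (≡.trans len′ (ℕₚ.suc-injective len)) (Linked.tail desc′))) ⟩
    P * branch y (a ∷ as) (λ μ → det (powers x) (exponents μ) (range 1 k))
      ≈⟨ alternant-branch x (suc k) a as desc (range 1 k) ⟨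
    det (powers x) (exponents (a ∷ as)) (range 1 k ++ [ suc k ])
      ≡⟨ ≡.cong (det (powers x) (exponents (a ∷ as))) (range-snoc k) ⟨
    det (powers x) (exponents (a ∷ as)) (range 1 (suc k))
      ∎
    where
    y = x (suc k)
    V = vand (range 1 k)
    P = ∏ (range 1 k) (λ i → x i - x (suc k))

-- Partitions with columns of even length

double : List ℕ → List ℕ
double [] = []
double (a ∷ as) = a ∷ a ∷ double as

-- m is λ_{2i} + 2n - 2i, for the partition with λ_{2i-1} = λ_{2i} = the i-th part of the argument.
shifted : List ℕ → List ℕ
shifted [] = []
shifted (a ∷ as) = (a ℕ.+ 2 ℕ.* length as) ∷ shifted as

2*suc : ∀ k → 2 ℕ.* suc k ≡ suc (suc (2 ℕ.* k))
2*suc k = ℕₚ.*-suc 2 k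

length-double : ∀ μ → length (double μ) ≡ 2 ℕ.* length μ
length-double [] = ≡.refl
length-double (a ∷ μ) = ≡.trans (≡.cong (λ l → suc (suc l)) (length-double μ)) (≡.sym (2*suc (length μ)))

double-linked : ∀ {μ} → Linked _≥_ μ → Linked _≥_ (double μ)
double-linked [] = []
double-linked [-] = ℕₚ.≤-refl ∷ [-]
double-linked (b≤a ∷ desc) = ℕₚ.≤-refl ∷ b≤a ∷ double-linked desc

lhsExponents : ℕ → List ℕ → List ℕ
lhsExponents n la = map (λ i → (la ‼ (2 ℕ.* i)) ℕ.+ (2 ℕ.* n ∸ 2 ℕ.* i)) (range 1 n)

range-suc : ∀ n → range 1 (suc n) ≡ 1 ∷ map suc (range 1 n)
range-suc n = ≡.cong (1 ∷_) (begin
  map (ℕ._+ 1) (applyUpTo suc n)            ≡⟨ ≡.cong (map (ℕ._+ 1)) (Listₚ.map-upTo suc n) ⟨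
  map (ℕ._+ 1) (map suc (upTo n))           ≡⟨ Listₚ.map-∘ (upTo n) ⟨
  map (λ i → suc (i ℕ.+ 1)) (upTo n)        ≡⟨ Listₚ.map-∘ (upTo n) ⟩
  map suc (range 1 n)                       ∎)
  where open ≡.≡-Reasoning

lhsExponents-double : ∀ μ → lhsExponents (length μ) (double μ) ≡ shifted μ
lhsExponents-double [] = ≡.refl
lhsExponents-double (a ∷ μ) = begin
  map f (range 1 (suc n))                   ≡⟨ ≡.cong (map f) (range-suc n) ⟩
  f 1 ∷ map f (map suc (range 1 n))         ≡⟨ ≡.cong₂ _∷_ head-eq tail-eq ⟩
  (a ℕ.+ 2 ℕ.* n) ∷ shifted μ               ∎
  where
  open ≡.≡-Reasoning
  n = length μ
  f : ℕ → ℕ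
  f i = (double (a ∷ μ) ‼ (2 ℕ.* i)) ℕ.+ (2 ℕ.* suc n ∸ 2 ℕ.* i)
  head-eq : f 1 ≡ a ℕ.+ 2 ℕ.* n
  head-eq = ≡.cong (λ l → a ℕ.+ (l ∸ 2)) (2*suc n)
  -- The bound on i keeps `2 * i` away from the index 0, where `‼` returns the default 0.
  step : ∀ i → 1 ≤ i → f (suc i) ≡ (double μ ‼ (2 ℕ.* i)) ℕ.+ (2 ℕ.* n ∸ 2 ℕ.* i)
  step (suc i) _ = ≡.cong₂ ℕ._+_
    (≡.trans (≡.cong (double (a ∷ μ) ‼_) (≡.trans (2*suc (suc i)) (≡.cong (λ l → suc (suc l)) (2*suc i))))
             (≡.cong (double μ ‼_) (≡.sym (2*suc i))))
    (≡.cong₂ _∸_ (2*suc n) (2*suc (suc i)))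
  tail-eq : map f (map suc (range 1 n)) ≡ shifted μ
  tail-eq = begin
    map f (map suc (range 1 n))               ≡⟨ Listₚ.map-∘ (range 1 n) ⟨
    map (λ i → f (suc i)) (range 1 n)         ≡⟨ Listₚ.map-cong-local
                                                   (All.map (λ {i} (1≤i , _) → step i 1≤i) (range-bounds n)) ⟩
    lhsExponents n (double μ)                 ≡⟨ lhsExponents-double μ ⟩
    shifted μ                                 ∎

bool-ext : ∀ {a b} → (a ≡ true → b ≡ true) → (b ≡ true → a ≡ true) → a ≡ b
bool-ext {true} {true} f g = ≡.refl
bool-ext {true} {false} f g = ≡.sym (f ≡.refl)
bool-ext {false} {true} f g = g ≡.refl
bool-ext {false} {false} f g = ≡.refl

∧-true : ∀ {a b} → a ∧ b ≡ true → a ≡ true × b ≡ true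
∧-true {true} {true} _ = ≡.refl , ≡.refl

allᵇ-sound : ∀ {A : Set} (p : A → Bool) xs → allᵇ p xs ≡ true → All (λ a → p a ≡ true) xs
allᵇ-sound p [] e = []
allᵇ-sound p (a ∷ as) e = proj₁ (∧-true e) ∷ allᵇ-sound p as (proj₂ (∧-true e))

allᵇ-complete : ∀ {A : Set} (p : A → Bool) xs → All (λ a → p a ≡ true) xs → allᵇ p xs ≡ true
allᵇ-complete p [] [] = ≡.refl
allᵇ-complete p (a ∷ as) (e ∷ es) rewrite e = allᵇ-complete p as es

All-range : ∀ {P : ℕ → Set} s → All P (range 1 s) → ∀ k → 1 ≤ k → k ≤ s → P k
All-range {P} s ps (suc k) _ k<s =
  ≡.subst P (ℕₚ.+-comm k 1) (Allₚ.applyUpTo⁻ (λ i → i) s (Allₚ.map⁻ ps) k<s)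

evenᵇ : ℕ → Bool
evenᵇ n = n % 2 ≡ᵇ 0

conjPart-zero : ∀ {v} k → All (_< k) v → conjPart v k ≡ 0
conjPart-zero k [] = ≡.refl
conjPart-zero k (a<k ∷ v<k) rewrite ≤ᵇ-false a<k = conjPart-zero k v<k

parts≤sum : ∀ v → All (_≤ sum v) v
parts≤sum [] = []
parts≤sum (a ∷ v) = ℕₚ.m≤m+n a (sum v) ∷ All.map (λ le → ℕₚ.≤-trans le (ℕₚ.m≤n+m (sum v) a)) (parts≤sum v)

-- Beyond |v| all conjugate parts are 0, so the finite test speaks for every k. This makes the tests
-- of two lists with different sums comparable.
conjEven-sound : ∀ v → conjEven v ≡ true → ∀ k → 1 ≤ k → evenᵇ (conjPart v k) ≡ true
conjEven-sound v e k 1≤k with k ℕ.≤? sum v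
... | yes k≤s = All-range (sum v) (allᵇ-sound _ (range 1 (sum v)) e) k 1≤k k≤s
... | no k≰s = ≡.cong evenᵇ (conjPart-zero k (All.map (λ le → ℕₚ.≤-<-trans le (ℕₚ.≰⇒> k≰s)) (parts≤sum v)))

conjEven-complete : ∀ v → (∀ k → 1 ≤ k → evenᵇ (conjPart v k) ≡ true) → conjEven v ≡ true
conjEven-complete v e = allᵇ-complete _ (range 1 (sum v)) (All.map (λ {k} (1≤k , _) → e k 1≤k) (range-bounds (sum v)))

evenᵇ-conjPart-repeat : ∀ a v k → evenᵇ (conjPart (a ∷ a ∷ v) k) ≡ evenᵇ (conjPart v k)
evenᵇ-conjPart-repeat a v k with k ≤ᵇ a
... | true = ≡.refl
... | false = ≡.refl

conjEven-repeat : ∀ a v → conjEven (a ∷ a ∷ v) ≡ conjEven v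
conjEven-repeat a v = bool-ext
  (λ e → conjEven-complete v (λ k 1≤k →
    ≡.trans (≡.sym (evenᵇ-conjPart-repeat a v k)) (conjEven-sound (a ∷ a ∷ v) e k 1≤k)))
  (λ e → conjEven-complete (a ∷ a ∷ v) (λ k 1≤k →
    ≡.trans (evenᵇ-conjPart-repeat a v k) (conjEven-sound v e k 1≤k)))

weaklyDecreasing-bound : ∀ b v → weaklyDecreasing (b ∷ v) ≡ true → All (_≤ b) v
weaklyDecreasing-bound b [] _ = []
weaklyDecreasing-bound b (c ∷ v) e with ∧-true e
... | c≤b , e′ = ≤ᵇ-sound c b c≤b ∷ All.map (λ le → ℕₚ.≤-trans le (≤ᵇ-sound c b c≤b)) (weaklyDecreasing-bound c v e′)

-- Only the first row reaches column `a`, so that column has length 1.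
conjEven-strict : ∀ a b v → b < a → weaklyDecreasing (b ∷ v) ≡ true → conjEven (a ∷ b ∷ v) ≡ false
conjEven-strict a b v b<a wd with conjEven (a ∷ b ∷ v) in eq
... | false = ≡.refl
... | true = ≡.trans (≡.sym (conjEven-sound (a ∷ b ∷ v) eq a (ℕₚ.≤-trans (s≤s z≤n) b<a))) odd
  where
  odd : evenᵇ (conjPart (a ∷ b ∷ v) a) ≡ false
  odd rewrite ≤ᵇ-true (ℕₚ.≤-refl {a}) | ≤ᵇ-false b<a
    | conjPart-zero {v} a (All.map (λ le → ℕₚ.≤-<-trans le b<a) (weaklyDecreasing-bound b v wd)) = ≡.refl

≡ᵇ-refl : ∀ a → (a ≡ᵇ a) ≡ true
≡ᵇ-refl zero = ≡.refl
≡ᵇ-refl (suc a) = ≡ᵇ-refl a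

≡ᵇ-false : ∀ {a b} → b < a → (a ≡ᵇ b) ≡ false
≡ᵇ-false {suc a} {zero} _ = ≡.refl
≡ᵇ-false {suc a} {suc b} (s≤s lt) = ≡ᵇ-false lt

≡ᵇ-false′ : ∀ {a b} → a < b → (a ≡ᵇ b) ≡ false
≡ᵇ-false′ {zero} {suc b} _ = ≡.refl
≡ᵇ-false′ {suc a} {suc b} (s≤s lt) = ≡ᵇ-false′ lt

admissible : List ℕ → Bool
admissible v = weaklyDecreasing v ∧ conjEven v

headBound : ℕ → List ℕ → Bool
headBound e [] = true
headBound e (a ∷ _) = a ≤ᵇ e

weaklyDecreasing-∷ : ∀ a v → weaklyDecreasing (a ∷ v) ≡ headBound a v ∧ weaklyDecreasing v
weaklyDecreasing-∷ a [] = ≡.refl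
weaklyDecreasing-∷ a (b ∷ v) = ≡.refl

-- Even columns force the first two rows to be equal. Deleting both changes each column length by 0
-- or 2, so the rest is again admissible.
admissible-∷∷ : ∀ a b v → admissible (a ∷ b ∷ v) ≡ (a ≡ᵇ b) ∧ (headBound b v ∧ admissible v)
admissible-∷∷ a b v with ℕₚ.<-cmp a b
... | tri< a<b _ _ rewrite ≤ᵇ-false a<b | ≡ᵇ-false′ a<b = ≡.refl
... | tri≈ _ ≡.refl _
  rewrite ≤ᵇ-true (ℕₚ.≤-refl {a}) | ≡ᵇ-refl a | conjEven-repeat a v | weaklyDecreasing-∷ a v =
  Boolₚ.∧-assoc (headBound a v) (weaklyDecreasing v) (conjEven v)
... | tri> _ _ b<a rewrite ≡ᵇ-false b<a with weaklyDecreasing (b ∷ v) in eq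
... | false = ≡.cong (_∧ conjEven (a ∷ b ∷ v)) (Boolₚ.∧-zeroʳ (b ≤ᵇ a))
... | true = ≡.trans (≡.cong (((b ≤ᵇ a) ∧ true) ∧_) (conjEven-strict a b v b<a eq)) (Boolₚ.∧-zeroʳ ((b ≤ᵇ a) ∧ true))

-- Sums over partitions with bounded parts

module PartitionSums (R : CommutativeRing 0ℓ 0ℓ) where
  open CommutativeRing R hiding (zero)
  open import Relation.Binary.Reasoning.Setoid setoid
  open LinearFunctionals R
  open Linear

  ∑-upTo-suc : ∀ d f → ∑ (upTo (suc d)) f ≈ ∑ (upTo d) f + f d
  ∑-upTo-suc d f = begin
    ∑ (upTo (suc d)) f            ≡⟨ ≡.cong (λ as → ∑ as f) (Listₚ.upTo-∷ʳ d) ⟨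
    ∑ (upTo d ++ [ d ]) f         ≈⟨ ∑-++ (upTo d) [ d ] f ⟩
    ∑ (upTo d) f + (f d + 0#)     ≈⟨ +-congˡ (+-identityʳ _) ⟩
    ∑ (upTo d) f + f d            ∎

  ∑-upTo-cong : ∀ d {f g} → (∀ a → a < d → f a ≈ g a) → ∑ (upTo d) f ≈ ∑ (upTo d) g
  ∑-upTo-cong zero e = refl
  ∑-upTo-cong (suc d) {f} {g} e = begin
    ∑ (upTo (suc d)) f            ≈⟨ ∑-upTo-suc d f ⟩
    ∑ (upTo d) f + f d            ≈⟨ +-cong (∑-upTo-cong d (λ a lt → e a (ℕₚ.m≤n⇒m≤1+n lt))) (e d ℕₚ.≤-refl) ⟩
    ∑ (upTo d) g + g d            ≈⟨ ∑-upTo-suc d g ⟨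
    ∑ (upTo (suc d)) g            ∎

  ∑-upTo-extend : ∀ k e f → (∀ a → e ≤ a → f a ≈ 0#) → ∑ (upTo (k ℕ.+ e)) f ≈ ∑ (upTo e) f
  ∑-upTo-extend zero e f v = refl
  ∑-upTo-extend (suc k) e f v = begin
    ∑ (upTo (suc (k ℕ.+ e))) f              ≈⟨ ∑-upTo-suc (k ℕ.+ e) f ⟩
    ∑ (upTo (k ℕ.+ e)) f + f (k ℕ.+ e)      ≈⟨ +-cong (∑-upTo-extend k e f v) (v (k ℕ.+ e) (ℕₚ.m≤n+m e k)) ⟩
    ∑ (upTo e) f + 0#                       ≈⟨ +-identityʳ _ ⟩
    ∑ (upTo e) f                            ∎

  ∑-upTo-truncate : ∀ d e f → e ≤ d → (∀ a → e ≤ a → f a ≈ 0#) → ∑ (upTo d) f ≈ ∑ (upTo e) f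
  ∑-upTo-truncate d e f e≤d v = begin
    ∑ (upTo d) f                  ≡⟨ ≡.cong (λ d → ∑ (upTo d) f) (ℕₚ.m∸n+n≡m e≤d) ⟨
    ∑ (upTo (d ∸ e ℕ.+ e)) f      ≈⟨ ∑-upTo-extend (d ∸ e) e f v ⟩
    ∑ (upTo e) f                  ∎

  ∑-upTo-bounded : ∀ d e (f : ℕ → Carrier) → e ≤ d → ∑ (upTo (suc d)) (λ a → [ a ≤ᵇ e ]· f a) ≈ ∑ (upTo (suc e)) f
  ∑-upTo-bounded d e f e≤d = trans
    (∑-upTo-truncate (suc d) (suc e) _ (s≤s e≤d) (λ a lt → reflexive (≡.cong ([_]· f a) (≤ᵇ-false lt))))
    (∑-upTo-cong (suc e) (λ a lt → reflexive (≡.cong ([_]· f a) (≤ᵇ-true (ℕₚ.≤-pred lt)))))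

  ∑-upTo-pick : ∀ d a (f : ℕ → Carrier) → a ≤ d → ∑ (upTo (suc d)) (λ b → [ a ≡ᵇ b ]· f b) ≈ f a
  ∑-upTo-pick d a f a≤d = begin
    ∑ (upTo (suc d)) g
      ≈⟨ ∑-upTo-truncate (suc d) (suc a) g (s≤s a≤d) (λ b lt → reflexive (≡.cong ([_]· f b) (≡ᵇ-false′ lt))) ⟩
    ∑ (upTo (suc a)) g
      ≈⟨ ∑-upTo-suc a g ⟩
    ∑ (upTo a) g + g a
      ≈⟨ +-cong (trans (∑-upTo-cong a (λ b lt → reflexive (≡.cong ([_]· f b) (≡ᵇ-false lt))))
                       (vanish (∑-linear (upTo a)) (λ _ → refl)))
                (reflexive (≡.cong ([_]· f a) (≡ᵇ-refl a))) ⟩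
    0# + f a
      ≈⟨ +-identityˡ _ ⟩
    f a
      ∎
    where
    g : ℕ → Carrier
    g b = [ a ≡ᵇ b ]· f b

  -- The sum over weakly decreasing lists of length k with parts at most d: each part chosen is the
  -- bound for the next.
  ∑↓ : ℕ → ℕ → (List ℕ → Carrier) → Carrier
  ∑↓ zero d F = F []
  ∑↓ (suc k) d F = ∑ (upTo (suc d)) (λ a → ∑↓ k a (λ μ → F (a ∷ μ)))

  ∑↓-linear : ∀ k d → Linear (∑↓ k d)
  ∑↓-linear zero d = eval-linear []
  ∑↓-linear (suc k) d = bind-linear (∑-linear (upTo (suc d))) (λ a → reindex-linear (a ∷_) (∑↓-linear k a))

  ∑↓-cong : ∀ k d {F G} → (∀ μ → length μ ≡ k → Linked _≥_ μ → F μ ≈ G μ) → ∑↓ k d F ≈ ∑↓ k d G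
  ∑↓-cong k d e = go k d (λ μ len desc → e μ len (Linked.tail desc))
    where
    go : ∀ k d {F G} → (∀ μ → length μ ≡ k → Linked _≥_ (d ∷ μ) → F μ ≈ G μ) → ∑↓ k d F ≈ ∑↓ k d G
    go zero d e = e [] ≡.refl [-]
    go (suc k) d e = ∑-upTo-cong (suc d) (λ a lt → go k a (λ μ len desc →
      e (a ∷ μ) (≡.cong suc len) (ℕₚ.≤-pred lt ∷ desc)))

  -- There are two bounds because `d` limits the enumeration throughout, whereas `e` limits the head
  -- and drops to the part just chosen. Entries are consumed two at a time.
  ∑-admissible : ∀ k d e (F : List ℕ → Carrier) → e ≤ d →
    ∑ (vecsUpTo (2 ℕ.* k) d) (λ v → [ headBound e v ∧ admissible v ]· F v) ≈ ∑↓ k e (λ μ → F (double μ))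
  ∑-admissible zero d e F e≤d = +-identityʳ _
  ∑-admissible (suc k) d e F e≤d = begin
    ∑ (vecsUpTo (2 ℕ.* suc k) d) f
      ≡⟨ ≡.cong (λ l → ∑ (vecsUpTo l d) f) (2*suc k) ⟩
    ∑ (vecsUpTo (suc (suc (2 ℕ.* k))) d) f
      ≈⟨ ∑-vecs (suc (2 ℕ.* k)) f ⟩
    ∑ (upTo (suc d)) (λ a → ∑ (vecsUpTo (suc (2 ℕ.* k)) d) (λ v → f (a ∷ v)))
      ≈⟨ ∑-cong (upTo (suc d)) (λ a → ∑-vecs (2 ℕ.* k) (λ v → f (a ∷ v))) ⟩
    ∑ (upTo (suc d)) (λ a → ∑ (upTo (suc d)) (λ b → ∑ V (λ v → f (a ∷ b ∷ v))))
      ≈⟨ ∑-cong (upTo (suc d)) (λ a → ∑-cong (upTo (suc d)) (λ b → inner a b)) ⟩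
    ∑ (upTo (suc d)) (λ a → ∑ (upTo (suc d)) (λ b → [ a ≤ᵇ e ]· [ a ≡ᵇ b ]· h a b))
      ≈⟨ ∑-cong (upTo (suc d)) (λ a → linear-[]· (∑-linear (upTo (suc d))) (a ≤ᵇ e) _) ⟩
    ∑ (upTo (suc d)) (λ a → [ a ≤ᵇ e ]· ∑ (upTo (suc d)) (λ b → [ a ≡ᵇ b ]· h a b))
      ≈⟨ ∑-upTo-bounded d e _ e≤d ⟩
    ∑ (upTo (suc e)) (λ a → ∑ (upTo (suc d)) (λ b → [ a ≡ᵇ b ]· h a b))
      ≈⟨ ∑-upTo-cong (suc e) (λ a lt → let a≤d = ℕₚ.≤-trans (ℕₚ.≤-pred lt) e≤d in
           trans (∑-upTo-pick d a (h a) a≤d) (∑-admissible k d a (λ v → F (a ∷ a ∷ v)) a≤d)) ⟩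
    ∑↓ (suc k) e (λ μ → F (double μ))
      ∎
    where
    V = vecsUpTo (2 ℕ.* k) d
    f : List ℕ → Carrier
    f v = [ headBound e v ∧ admissible v ]· F v
    h : ℕ → ℕ → Carrier
    h a b = ∑ V (λ v → [ headBound b v ∧ admissible v ]· F (a ∷ b ∷ v))
    ∑-vecs : ∀ l (f : List ℕ → Carrier) →
      ∑ (vecsUpTo (suc l) d) f ≈ ∑ (upTo (suc d)) (λ a → ∑ (vecsUpTo l d) (λ v → f (a ∷ v)))
    ∑-vecs l f = trans (∑-concatMap (λ a → map (a ∷_) (vecsUpTo l d)) (upTo (suc d)) f)
      (∑-cong (upTo (suc d)) (λ a → ∑-map (a ∷_) (vecsUpTo l d) f))
    inner : ∀ a b → ∑ V (λ v → f (a ∷ b ∷ v)) ≈ [ a ≤ᵇ e ]· [ a ≡ᵇ b ]· h a b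
    inner a b = begin
      ∑ V (λ v → [ (a ≤ᵇ e) ∧ admissible (a ∷ b ∷ v) ]· F (a ∷ b ∷ v))
        ≈⟨ ∑-cong V (λ v → trans
             (reflexive (≡.cong (λ t → [ (a ≤ᵇ e) ∧ t ]· F (a ∷ b ∷ v)) (admissible-∷∷ a b v)))
             (trans ([]·-∧ (a ≤ᵇ e) _ _) ([]·-cong (a ≤ᵇ e) ([]·-∧ (a ≡ᵇ b) _ _)))) ⟩
      ∑ V (λ v → [ a ≤ᵇ e ]· [ a ≡ᵇ b ]· [ headBound b v ∧ admissible v ]· F (a ∷ b ∷ v))
        ≈⟨ trans (linear-[]· (∑-linear V) (a ≤ᵇ e) _) ([]·-cong (a ≤ᵇ e) (linear-[]· (∑-linear V) (a ≡ᵇ b) _)) ⟩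
      [ a ≤ᵇ e ]· [ a ≡ᵇ b ]· h a b
        ∎

  ∑-evenColPartitions : ∀ k d (F : List ℕ → Carrier) → ∑ (evenColPartitions k d) F ≈ ∑↓ k d (λ μ → F (double μ))
  ∑-evenColPartitions k d F = begin
    ∑ (evenColPartitions k d) F
      ≈⟨ ∑-keep admissible (vecsUpTo (2 ℕ.* k) d) F ⟩
    ∑ (vecsUpTo (2 ℕ.* k) d) (λ v → [ admissible v ]· F v)
      ≈⟨ bounded (2 ℕ.* k) ⟩
    ∑ (vecsUpTo (2 ℕ.* k) d) (λ v → [ headBound d v ∧ admissible v ]· F v)
      ≈⟨ ∑-admissible k d d F ℕₚ.≤-refl ⟩
    ∑↓ k d (λ μ → F (double μ))
      ∎
    where
    bounded : ∀ l → ∑ (vecsUpTo l d) (λ v → [ admissible v ]· F v)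
                    ≈ ∑ (vecsUpTo l d) (λ v → [ headBound d v ∧ admissible v ]· F v)
    bounded zero = refl
    bounded (suc l) = begin
      ∑ (vecsUpTo (suc l) d) (λ v → [ admissible v ]· F v)
        ≈⟨ ∑-concatMap (λ a → map (a ∷_) (vecsUpTo l d)) (upTo (suc d)) _ ⟩
      ∑ (upTo (suc d)) (λ a → ∑ (map (a ∷_) (vecsUpTo l d)) (λ v → [ admissible v ]· F v))
        ≈⟨ ∑-upTo-cong (suc d) (λ a lt → trans (∑-map (a ∷_) (vecsUpTo l d) _) (trans
             (∑-cong (vecsUpTo l d) (λ v → reflexive (≡.cong (λ t → [ t ∧ admissible (a ∷ v) ]· F (a ∷ v))
               (≡.sym (≤ᵇ-true (ℕₚ.≤-pred lt))))))
             (sym (∑-map (a ∷_) (vecsUpTo l d) _)))) ⟩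
      ∑ (upTo (suc d)) (λ a → ∑ (map (a ∷_) (vecsUpTo l d)) (λ v → [ headBound d v ∧ admissible v ]· F v))
        ≈⟨ ∑-concatMap (λ a → map (a ∷_) (vecsUpTo l d)) (upTo (suc d)) _ ⟨
      ∑ (vecsUpTo (suc l) d) (λ v → [ headBound d v ∧ admissible v ]· F v)
        ∎

  ∑↓-truncate : ∀ k d e F → e ≤ d → (∀ a μ → e < a → F (a ∷ μ) ≈ 0#) → ∑↓ k d F ≈ ∑↓ k e F
  ∑↓-truncate zero d e F e≤d v = refl
  ∑↓-truncate (suc k) d e F e≤d v = ∑-upTo-truncate (suc d) (suc e) _ (s≤s e≤d)
    (λ a lt → vanish (∑↓-linear k a) (λ μ → v a μ lt))

-- From sets of exponents to partitions

module SubsetSums (R : CommutativeRing 0ℓ 0ℓ) (w : ℕ → CommutativeRing.Carrier R) where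
  open CommutativeRing R hiding (zero)
  open import Relation.Binary.Reasoning.Setoid setoid
  open IntegerCoefficientSolver R
  open LinearFunctionals R
  open Linear
  open Pfaffians R
  open PartitionSums R

  -- In a strictly decreasing list the pairs {m + 1, m} of two members overlap only for consecutive
  -- integers, and these stand next to each other in the list.
  NoAdjacent : (List ℕ → Carrier) → Set
  NoAdjacent F = ∀ P m Q → F (P ++ suc m ∷ m ∷ Q) ≈ 0#

  step-vanish : ∀ k B {F : List ℕ → Carrier} → (∀ S → F (B ∷ S) ≈ 0#) →
                ∑ₛ w (suc k) (downFrom (suc B)) F ≈ ∑ₛ w (suc k) (downFrom B) F
  step-vanish k B {F} e = begin
    w B * ∑ₛ w k (downFrom B) (λ S → F (B ∷ S)) + ∑ₛ w (suc k) (downFrom B) F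
      ≈⟨ +-congʳ (trans (*-congˡ (vanish (∑ₛ-linear w k (downFrom B)) e)) (zeroʳ _)) ⟩
    0# + ∑ₛ w (suc k) (downFrom B) F
      ≈⟨ +-identityˡ _ ⟩
    ∑ₛ w (suc k) (downFrom B) F
      ∎

  -- k + 1 pairwise non-adjacent numbers need an interval of length 2k + 1.
  ∑ₛ-crowded : ∀ k B F → NoAdjacent F → B ≤ 2 ℕ.* k → ∑ₛ w (suc k) (downFrom B) F ≈ 0#
  ∑ₛ-crowded k zero F na _ = refl
  ∑ₛ-crowded (suc k) (suc B) F na le = begin
    w B * ∑ₛ w (suc k) (downFrom B) (λ S → F (B ∷ S)) + ∑ₛ w (suc (suc k)) (downFrom B) F
      ≈⟨ +-cong (*-congˡ (after B (ℕₚ.≤-pred (≡.subst (suc B ≤_) (2*suc k) le))))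
                (∑ₛ-crowded (suc k) B F na (ℕₚ.≤-trans (ℕₚ.n≤1+n B) le)) ⟩
    w B * 0# + 0#
      ≈⟨ solve 1 (λ b → b :* con (+ 0) :+ con (+ 0) := con (+ 0)) refl _ ⟩
    0#
      ∎
    where
    after : ∀ B → B ≤ suc (2 ℕ.* k) → ∑ₛ w (suc k) (downFrom B) (λ S → F (B ∷ S)) ≈ 0#
    after zero _ = refl
    after (suc B) (s≤s le) = trans (step-vanish k B (λ S → na [] B S))
      (∑ₛ-crowded k B (λ S → F (suc B ∷ S)) (λ P → na (suc B ∷ P)) le)

  -- A set without neighbours, read from the top, drops by at least 2 each time; subtracting the
  -- staircase 2k, ..., 2, 0 leaves a partition with parts at most d. The induction asks whether the
  -- top value d + 2k is chosen, that is, whether the first part equals d or is smaller.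
  ∑ₛ-∑↓ : ∀ k d F → NoAdjacent F →
    ∑ₛ w (suc k) (downFrom (d ℕ.+ suc (2 ℕ.* k))) F
      ≈ ∑↓ (suc k) d (λ μ → ∏ (shifted μ) w * F (shifted μ))
  ∑ₛ-∑↓ k d F na = begin
    ∑ₛ w (suc k) (downFrom (d ℕ.+ suc (2 ℕ.* k))) F
      ≡⟨ ≡.cong (λ B → ∑ₛ w (suc k) (downFrom B) F) (ℕₚ.+-suc d (2 ℕ.* k)) ⟩
    w m * ∑ₛ w k (downFrom m) (λ S → F (m ∷ S)) + ∑ₛ w (suc k) (downFrom m) F
      ≈⟨ +-comm _ _ ⟩
    ∑ₛ w (suc k) (downFrom m) F + w m * ∑ₛ w k (downFrom m) (λ S → F (m ∷ S))
      ≈⟨ +-cong (smaller d) (*-congˡ (rest k (λ S → F (m ∷ S)) (λ P → na (m ∷ P)) (λ m′ S eq →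
           trans (reflexive (≡.cong (λ l → F (l ∷ m′ ∷ S)) eq)) (na [] m′ S)))) ⟩
    ∑ (upTo d) (λ a → ∑↓ k a (λ μ → G (a ∷ μ))) + w m * ∑↓ k d (λ μ → ∏ (shifted μ) w * F (m ∷ shifted μ))
      ≈⟨ +-congˡ (trans (sym (∑↓-linear k d .*-hom _ _)) (∑↓-cong k d (λ μ len _ →
           trans (sym (*-assoc _ _ _)) (reflexive (≡.cong
             (λ l → w (d ℕ.+ 2 ℕ.* l) * ∏ (shifted μ) w * F (d ℕ.+ 2 ℕ.* l ∷ shifted μ)) (≡.sym len)))))) ⟩
    ∑ (upTo d) (λ a → ∑↓ k a (λ μ → G (a ∷ μ))) + ∑↓ k d (λ μ → G (d ∷ μ))
      ≈⟨ ∑-upTo-suc d _ ⟨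
    ∑↓ (suc k) d G
      ∎
    where
    m = d ℕ.+ 2 ℕ.* k
    G : List ℕ → Carrier
    G μ = ∏ (shifted μ) w * F (shifted μ)

    smaller : ∀ d → ∑ₛ w (suc k) (downFrom (d ℕ.+ 2 ℕ.* k)) F ≈ ∑ (upTo d) (λ a → ∑↓ k a (λ μ → G (a ∷ μ)))
    smaller zero = ∑ₛ-crowded k (2 ℕ.* k) F na ℕₚ.≤-refl
    smaller (suc d) = trans
      (reflexive (≡.cong (λ B → ∑ₛ w (suc k) (downFrom B) F) (≡.sym (ℕₚ.+-suc d (2 ℕ.* k)))))
      (∑ₛ-∑↓ k d F na)

    -- Once d + 2k is chosen in the outer problem, the value just below it is forbidden. Dropping it
    -- from the interval leaves exactly the room of the same problem with one exponent fewer.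
    rest : ∀ k (H : List ℕ → Carrier) → NoAdjacent H →
      (∀ m′ S → d ℕ.+ 2 ℕ.* k ≡ suc m′ → H (m′ ∷ S) ≈ 0#) →
      ∑ₛ w k (downFrom (d ℕ.+ 2 ℕ.* k)) H ≈ ∑↓ k d (λ μ → ∏ (shifted μ) w * H (shifted μ))
    rest zero H na′ v = sym (*-identityˡ _)
    rest (suc k) H na′ v = begin
      ∑ₛ w (suc k) (downFrom (d ℕ.+ 2 ℕ.* suc k)) H
        ≡⟨ ≡.cong (λ B → ∑ₛ w (suc k) (downFrom B) H) room ⟩
      ∑ₛ w (suc k) (downFrom (suc (d ℕ.+ suc (2 ℕ.* k)))) H
        ≈⟨ step-vanish k (d ℕ.+ suc (2 ℕ.* k)) (λ S → v _ S room) ⟩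
      ∑ₛ w (suc k) (downFrom (d ℕ.+ suc (2 ℕ.* k))) H
        ≈⟨ ∑ₛ-∑↓ k d H na′ ⟩
      ∑↓ (suc k) d (λ μ → ∏ (shifted μ) w * H (shifted μ))
        ∎
      where
      room : d ℕ.+ 2 ℕ.* suc k ≡ suc (d ℕ.+ suc (2 ℕ.* k))
      room = ≡.trans (≡.cong (d ℕ.+_) (2*suc k)) (ℕₚ.+-suc d (suc (2 ℕ.* k)))

-- The identity over a commutative ring

module LittlewoodSums (R : CommutativeRing 0ℓ 0ℓ) (x : ℕ → CommutativeRing.Carrier R)
                      (t u : CommutativeRing.Carrier R) where
  open CommutativeRing R hiding (zero)
  open import Algebra.Properties.Semiring.Exp semiring using (_^_; ^-congˡ)
  open import Algebra.Properties.CommutativeSemiring.Exp commutativeSemiring using (^-distrib-*)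
  open import Relation.Binary.Reasoning.Setoid setoid
  open IntegerCoefficientSolver R
  open LinearFunctionals R
  open Linear
  open Determinants R
  open Pfaffians R
  open Branching R
  open Tableaux R x
  open Bialternants R x
  open PartitionSums R

  weight : ℕ → Carrier
  weight m = 1# - u * t ^ m

  open SubsetSums R weight

  adjacentPairs : List ℕ → List ℕ
  adjacentPairs = pairs weight (powers x) suc (λ m → m)

  exponents-double : ∀ μ → exponents (double μ) ≡ adjacentPairs (shifted μ)
  exponents-double [] = ≡.refl
  exponents-double (a ∷ μ) = ≡.cong₂ _∷_
    (≡.trans (ℕₚ.+-suc a (length (double μ))) (≡.cong (λ l → suc (a ℕ.+ l)) (length-double μ)))
    (≡.cong₂ _∷_ (≡.cong (a ℕ.+_) (length-double μ)) (exponents-double μ))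

  minor : List ℕ → List ℕ → Carrier
  minor is T = det (powers x) (adjacentPairs T) is

  -- The neighbours m + 1 and m both contribute the column m + 1, and the two copies stand side by
  -- side.
  minor-noAdjacent : ∀ is → NoAdjacent (minor is)
  minor-noAdjacent is [] m Q = det-vanish-tail (powers x) (suc (suc m)) (suc m ∷ suc m ∷ m ∷ adjacentPairs Q) is
    (det-repeat-head (powers x) (suc m) (m ∷ adjacentPairs Q))
  minor-noAdjacent is (a ∷ P) m Q = det-vanish-tail (powers x) (suc a)
    (a ∷ adjacentPairs (P ++ suc m ∷ m ∷ Q)) is (λ is′ →
    det-vanish-tail (powers x) a (adjacentPairs (P ++ suc m ∷ m ∷ Q)) is′ (λ is″ → minor-noAdjacent is″ P m Q))

  schurSum : ℕ → ℕ → Carrier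
  schurSum n d = ∑ (evenColPartitions n d) (λ la →
    ∏ (lhsExponents n la) weight * ∑ (ssyt la (2 ℕ.* n)) (λ T → ∏ (concat T) x))

  vand-schurSum : ∀ k d → let n = suc k ; is = range 1 (2 ℕ.* n) in
    vand is * schurSum n d ≈ ∑ₛ weight n (downFrom (d ℕ.+ suc (2 ℕ.* k))) (minor is)
  vand-schurSum k d = begin
    vand is * schurSum n d
      ≈⟨ *-congˡ (∑-evenColPartitions n d (λ la → ∏ (lhsExponents n la) weight * s la)) ⟩
    vand is * ∑↓ n d (λ μ → ∏ (lhsExponents n (double μ)) weight * s (double μ))
      ≈⟨ ∑↓-linear n d .*-hom _ (λ μ → ∏ (lhsExponents n (double μ)) weight * s (double μ)) ⟨
    ∑↓ n d (λ μ → vand is * (∏ (lhsExponents n (double μ)) weight * s (double μ)))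
      ≈⟨ ∑↓-cong n d (λ μ len desc → trans
           (solve 3 (λ v p s → v :* (p :* s) := p :* (v :* s)) refl _ _ _)
           (*-cong (reflexive (≡.cong (λ ms → ∏ ms weight) (≡.trans
                     (≡.cong (λ l → lhsExponents l (double μ)) (≡.sym len)) (lhsExponents-double μ))))
                   (alternant μ len desc))) ⟩
    ∑↓ n d (λ μ → ∏ (shifted μ) weight * minor is (shifted μ))
      ≈⟨ ∑ₛ-∑↓ k d (minor is) (minor-noAdjacent is) ⟨
    ∑ₛ weight n (downFrom (d ℕ.+ suc (2 ℕ.* k))) (minor is)
      ∎
    where
    n = suc k
    is = range 1 (2 ℕ.* n)
    s : List ℕ → Carrier
    s la = ∑ (ssyt la (2 ℕ.* n)) (λ T → ∏ (concat T) x)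
    alternant : ∀ μ → length μ ≡ n → Linked _≥_ μ → vand is * s (double μ) ≈ minor is (shifted μ)
    alternant μ len desc = begin
      vand is * s (double μ)
        ≈⟨ *-congˡ (schur-tableaux (2 ℕ.* n) (double μ)) ⟩
      vand is * tableaux (2 ℕ.* n) [] (double μ)
        ≈⟨ bialternant (2 ℕ.* n) (double μ)
             (≡.trans (length-double μ) (≡.cong (2 ℕ.*_) len)) (double-linked desc) ⟩
      det (powers x) (exponents (double μ)) is
        ≡⟨ ≡.cong (λ js → det (powers x) js is) (exponents-double μ) ⟩
      minor is (shifted μ)
        ∎

  geometric-telescope : ∀ X M → (1# - X) * ∑ (downFrom M) (λ m → X ^ m) ≈ 1# - X ^ M
  geometric-telescope X zero = solve 1 (λ X → (con (+ 1) :- X) :* con (+ 0) := con (+ 1) :- con (+ 1)) refl X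
  geometric-telescope X (suc M) = begin
    (1# - X) * (X ^ M + S)
      ≈⟨ distribˡ _ _ _ ⟩
    (1# - X) * X ^ M + (1# - X) * S
      ≈⟨ +-congˡ (geometric-telescope X M) ⟩
    (1# - X) * X ^ M + (1# - X ^ M)
      ≈⟨ solve 2 (λ X P → (con (+ 1) :- X) :* P :+ (con (+ 1) :- P) := con (+ 1) :- X :* P) refl _ _ ⟩
    1# - X ^ suc M
      ∎
    where S = ∑ (downFrom M) (λ m → X ^ m)

  -- Nilpotency of X turns the telescoping sum into an exact inverse of 1 - X; it will come from
  -- truncation in the degree.
  geometric-inverse : ∀ X M → X ^ M ≈ 0# → (1# - X) * ∑ (downFrom M) (λ m → X ^ m) ≈ 1#
  geometric-inverse X M e = trans (geometric-telescope X M)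
    (trans (+-congˡ (-‿cong e)) (solve 0 (con (+ 1) :- con (+ 0) := con (+ 1)) refl))

  entry : ℕ → ℕ → Carrier → Carrier → Carrier
  entry i j G H = (x i - x j) * (1# - u + (u - t) * x i * x j) * G * H

  -- With X = xᵢxⱼ, the numerator is 1 - u + (u - t)X = (1 - tX) - u(1 - X).
  entry-expand : ∀ i j M {G H} → (x i * x j) ^ M ≈ 0# →
    G ≈ ∑ (downFrom M) (λ m → (x i * x j) ^ m) →
    H ≈ ∑ (downFrom M) (λ m → (t * x i * x j) ^ m) →
    entry i j G H ≈ ∑ (downFrom M) (λ m →
      weight m * (powers x (suc m) i * powers x m j - powers x m i * powers x (suc m) j))
  entry-expand i j M {G} {H} nil G≈ H≈ = begin
    P * (1# - u + (u - t) * x i * x j) * G * H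
      ≈⟨ *-cong (*-congˡ G≈) (trans H≈ (∑-cong (downFrom M) (λ m → pow m))) ⟩
    P * (1# - u + (u - t) * x i * x j) * S₁ * S₂
      ≈⟨ solve 7 (λ P u t xi xj S₁ S₂ →
           P :* (con (+ 1) :- u :+ (u :- t) :* xi :* xj) :* S₁ :* S₂
           := P :* ((con (+ 1) :- t :* (xi :* xj)) :* S₂ :* S₁ :- u :* ((con (+ 1) :- xi :* xj) :* S₁ :* S₂)))
           refl P u t (x i) (x j) S₁ S₂ ⟩
    P * ((1# - t * X) * S₂ * S₁ - u * ((1# - X) * S₁ * S₂))
      ≈⟨ *-congˡ (+-cong (*-congʳ inv₂) (-‿cong (*-congˡ (*-congʳ (geometric-inverse X M nil))))) ⟩
    P * (1# * S₁ - u * (1# * S₂))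
      ≈⟨ *-congˡ (+-cong (*-identityˡ _) (-‿cong (*-congˡ (*-identityˡ _)))) ⟩
    P * (S₁ - u * S₂)
      ≈⟨ *-congˡ (+-congˡ (-‿cong (∑-linear (downFrom M) .*-hom _ _))) ⟨
    P * (S₁ - ∑ (downFrom M) (λ m → u * (t * X) ^ m))
      ≈⟨ *-congˡ (minus-hom (∑-linear (downFrom M)) _ _) ⟨
    P * ∑ (downFrom M) (λ m → X ^ m - u * (t * X) ^ m)
      ≈⟨ ∑-linear (downFrom M) .*-hom _ _ ⟨
    ∑ (downFrom M) (λ m → P * (X ^ m - u * (t * X) ^ m))
      ≈⟨ ∑-cong (downFrom M) term ⟩
    ∑ (downFrom M) (λ m → weight m * (powers x (suc m) i * powers x m j - powers x m i * powers x (suc m) j))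
      ∎
    where
    P = x i - x j
    X = x i * x j
    S₁ = ∑ (downFrom M) (λ m → X ^ m)
    S₂ = ∑ (downFrom M) (λ m → (t * X) ^ m)
    pow : ∀ m → (t * x i * x j) ^ m ≈ (t * X) ^ m
    pow m = ^-congˡ m (*-assoc t (x i) (x j))
    inv₂ : (1# - t * X) * S₂ ≈ 1#
    inv₂ = geometric-inverse (t * X) M (trans (^-distrib-* t X M) (trans (*-congˡ nil) (zeroʳ _)))
    term : ∀ m → P * (X ^ m - u * (t * X) ^ m)
               ≈ weight m * (powers x (suc m) i * powers x m j - powers x m i * powers x (suc m) j)
    term m = begin
      P * (X ^ m - u * (t * X) ^ m)
        ≈⟨ *-congˡ (+-cong (^-distrib-* (x i) (x j) m) (-‿cong (*-congˡ
             (trans (^-distrib-* t X m) (*-congˡ (^-distrib-* (x i) (x j) m)))))) ⟩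
      P * (x i ^ m * x j ^ m - u * (t ^ m * (x i ^ m * x j ^ m)))
        ≈⟨ solve 6 (λ xi xj a b u T → (xi :- xj) :* (a :* b :- u :* (T :* (a :* b)))
             := (con (+ 1) :- u :* T) :* (xi :* a :* b :- a :* (xj :* b))) refl _ _ _ _ _ _ ⟩
      weight m * (x i ^ suc m * x j ^ m - x i ^ m * x j ^ suc m)
        ∎

  alt-cong-All : ∀ {P : ℕ → Set} {as} → All P as → {G H : ℕ → List ℕ → Carrier} →
                 (∀ b bs → P b → All P bs → G b bs ≈ H b bs) → alt as G ≈ alt as H
  alt-cong-All [] e = refl
  alt-cong-All (p ∷ ps) e = +-cong (e _ _ p ps)
    (-‿cong (alt-cong-All ps (λ b bs q qs → e b (_ ∷ bs) q (p ∷ qs))))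

  pf-cong-All : ∀ {P : ℕ → Set} {a b : ℕ → ℕ → Carrier} → (∀ i j → P i → P j → a i j ≈ b i j) →
                ∀ k {is} → All P is → pf a k is ≈ pf b k is
  pf-cong-All e zero [] = refl
  pf-cong-All e zero (_ ∷ _) = refl
  pf-cong-All e (suc k) [] = refl
  pf-cong-All e (suc k) (p ∷ ps) = alt-cong-All ps (λ j js q qs →
    *-cong (e _ j p q) (pf-cong-All e k qs))

  schurSum-pfaffian : ∀ k d (a : ℕ → ℕ → Carrier) → let n = suc k ; is = range 1 (2 ℕ.* n) in
    (∀ i j → 1 ≤ i × i ≤ 2 ℕ.* n → 1 ≤ j × j ≤ 2 ℕ.* n →
      a i j ≈ ∑ (downFrom (d ℕ.+ suc (2 ℕ.* k))) (λ m →
        weight m * (powers x (suc m) i * powers x m j - powers x m i * powers x (suc m) j))) →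
    vand is * schurSum n d ≈ pf a n is
  schurSum-pfaffian k d a e = begin
    vand is * schurSum n d
      ≈⟨ vand-schurSum k d ⟩
    ∑ₛ weight n ms (minor is)
      ≈⟨ pf-minors weight (powers x) suc (λ m → m) _ ms (λ i j → refl) n is ⟨
    pf (λ i j → ∑ ms (λ m →
      weight m * (powers x (suc m) i * powers x m j - powers x m i * powers x (suc m) j))) n is
      ≈⟨ pf-cong-All e n (range-bounds (2 ℕ.* n)) ⟨
    pf a n is
      ∎
    where
    n = suc k
    is = range 1 (2 ℕ.* n)
    ms = downFrom (d ℕ.+ suc (2 ℕ.* k))

  signed : ℕ → Carrier → Carrier
  signed k f = if k % 2 ≡ᵇ 0 then f else - f

  signed-suc : ∀ k f → signed (suc k) f ≈ - signed k f
  signed-suc zero f = refl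
  signed-suc (suc zero) f = sym (⁻¹-involutive f)
    where open import Algebra.Properties.Group +-group using (⁻¹-involutive)
  signed-suc (suc (suc k)) f = signed-suc k f

  ∑-picks : ∀ as (G : ℕ → List ℕ → Carrier) →
    ∑ (picks as) (λ p → signed (proj₂ (proj₂ p)) (G (proj₁ p) (proj₁ (proj₂ p)))) ≈ alt as G
  ∑-picks [] G = refl
  ∑-picks (a ∷ as) G = +-congˡ (begin
    ∑ (map _ (picks as)) (λ p → signed (proj₂ (proj₂ p)) (G (proj₁ p) (proj₁ (proj₂ p))))
      ≈⟨ ∑-map _ (picks as) _ ⟩
    ∑ (picks as) (λ p → signed (suc (proj₂ (proj₂ p))) (G (proj₁ p) (a ∷ proj₁ (proj₂ p))))
      ≈⟨ ∑-cong (picks as) (λ p → signed-suc (proj₂ (proj₂ p)) _) ⟩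
    ∑ (picks as) (λ p → - signed (proj₂ (proj₂ p)) (G (proj₁ p) (a ∷ proj₁ (proj₂ p))))
      ≈⟨ neg-hom (∑-linear (picks as)) _ ⟩
    - ∑ (picks as) (λ p → signed (proj₂ (proj₂ p)) (G (proj₁ p) (a ∷ proj₁ (proj₂ p))))
      ≈⟨ -‿cong (∑-picks as (λ b bs → G b (a ∷ bs))) ⟩
    - alt as (λ b bs → G b (a ∷ bs))
      ∎)

  range-∷ : ∀ a b l → suc b ∸ a ≡ suc l → range a b ≡ a ∷ range (suc a) b × suc b ∸ suc a ≡ l
  range-∷ a b l eq = cons , len
    where
    len : b ∸ a ≡ l
    len = ≡.trans (≡.sym (ℕₚ.pred[m∸n]≡m∸[1+n] (suc b) a)) (≡.cong ℕ.pred eq)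
    cons : range a b ≡ a ∷ range (suc a) b
    cons = ≡.trans (≡.cong (λ l → map (ℕ._+ a) (upTo l)) eq) (≡.cong (a ∷_) (≡.trans
      (≡.cong (map (ℕ._+ a)) (≡.sym (Listₚ.map-upTo suc l)))
      (≡.trans (≡.sym (Listₚ.map-∘ (upTo l))) (≡.trans
        (Listₚ.map-cong (λ i → ≡.sym (ℕₚ.+-suc i a)) (upTo l))
        (≡.cong (λ l → map (ℕ._+ suc a) (upTo l)) (≡.sym len))))))

  foldr-++ : ∀ ps qs → foldr _*_ 1# (ps ++ qs) ≈ foldr _*_ 1# ps * foldr _*_ 1# qs
  foldr-++ [] qs = sym (*-identityˡ _)
  foldr-++ (p ∷ ps) qs = trans (*-congˡ (foldr-++ ps qs)) (sym (*-assoc _ _ _))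

  vand-range : ∀ N →
    foldr _*_ 1# (concatMap (λ i → map (λ j → x i - x j) (range (suc i) N)) (range 1 N)) ≈ vand (range 1 N)
  vand-range N = go N 1 ≡.refl
    where
    factors : ℕ → List Carrier
    factors i = map (λ j → x i - x j) (range (suc i) N)
    go : ∀ l a → suc N ∸ a ≡ l → foldr _*_ 1# (concatMap factors (range a N)) ≈ vand (range a N)
    go zero a eq rewrite eq = refl
    go (suc l) a eq with cons , len ← range-∷ a N l eq rewrite cons = begin
      foldr _*_ 1# (factors a ++ concatMap factors (range (suc a) N))
        ≈⟨ foldr-++ (factors a) _ ⟩
      foldr _*_ 1# (factors a) * foldr _*_ 1# (concatMap factors (range (suc a) N))
        ≈⟨ *-congˡ (go l (suc a) len) ⟩
      vand (a ∷ range (suc a) N)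
        ∎

-- The ring of power series up to a given total degree

module PowerSeries where
  open ≡ using (refl; sym; trans; cong; cong₂)
  open ≡.≡-Reasoning

  module ℤΣ = LinearFunctionals ℤₚ.+-*-commutativeRing
  open ℤΣ using (∑; ∑ˢ; ∑ˢ-cong; ∑ˢ-comm; ∑ˢ-assoc; ∑-cong; ∑-map; ∑-concatMap; Linear; linear-∑ˢ)

  ∑-upTo-∑ˢ : ∀ a h → ∑ (upTo (suc a)) (λ k → h k (a ∸ k)) ≡ ∑ˢ a h
  ∑-upTo-∑ˢ zero h = ℤₚ.+-identityʳ _
  ∑-upTo-∑ˢ (suc a) h = cong (λ z → h 0 (suc a) ℤ.+ z) (begin
    ∑ (applyUpTo suc (suc a)) (λ k → h k (suc a ∸ k))
      ≡⟨ cong (λ ks → ∑ ks (λ k → h k (suc a ∸ k))) (Listₚ.map-upTo suc (suc a)) ⟨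
    ∑ (map suc (upTo (suc a))) (λ k → h k (suc a ∸ k))
      ≡⟨ ∑-map suc (upTo (suc a)) (λ k → h k (suc a ∸ k)) ⟩
    ∑ (upTo (suc a)) (λ k → h (suc k) (a ∸ k))
      ≡⟨ ∑-upTo-∑ˢ a (λ i → h (suc i)) ⟩
    ∑ˢ a (λ i → h (suc i))
      ∎)

  -- The splittings of an exponent vector as nested sums, one for each variable. The ring laws of
  -- the product then reduce to one variable at a time.
  conv : ∀ {m} → Vec ℕ m → (Vec ℕ m → Vec ℕ m → ℤ) → ℤ
  conv [] H = H [] []
  conv (a ∷ α) H = ∑ˢ a (λ i j → conv α (λ β γ → H (i ∷ β) (j ∷ γ)))

  -- The degrees of the two factors add up to that of α. This makes agreement up to degree d a
  -- congruence for the product, and orders additive.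
  conv-cong-sum : ∀ {m} (α : Vec ℕ m) {H K} →
    (∀ β γ → Vec.sum β ℕ.+ Vec.sum γ ≡ Vec.sum α → H β γ ≡ K β γ) → conv α H ≡ conv α K
  conv-cong-sum [] e = e [] [] refl
  conv-cong-sum (a ∷ α) e = ℤΣ.∑ˢ-cong-+ a (λ i j i+j≡a → conv-cong-sum α (λ β γ eq → e (i ∷ β) (j ∷ γ)
    (trans (interchange i _ j _) (cong₂ ℕ._+_ i+j≡a eq))))
    where
    open import Algebra.Properties.CommutativeSemigroup ℕₚ.+-commutativeSemigroup using (interchange)

  conv-cong : ∀ {m} (α : Vec ℕ m) {H K} → (∀ β γ → H β γ ≡ K β γ) → conv α H ≡ conv α K
  conv-cong α e = conv-cong-sum α (λ β γ _ → e β γ)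

  splits-conv : ∀ {m} (α : Vec ℕ m) H → ∑ (splits α) (λ p → H (proj₁ p) (proj₂ p)) ≡ conv α H
  splits-conv [] H = ℤₚ.+-identityʳ _
  splits-conv (a ∷ α) H = begin
    ∑ (splits (a ∷ α)) (λ p → H (proj₁ p) (proj₂ p))
      ≡⟨ ∑-concatMap (λ k → map (prepend k) (splits α)) (upTo (suc a)) (λ p → H (proj₁ p) (proj₂ p)) ⟩
    ∑ (upTo (suc a)) (λ k → ∑ (map (prepend k) (splits α)) (λ p → H (proj₁ p) (proj₂ p)))
      ≡⟨ ∑-cong (upTo (suc a)) (λ k → trans (∑-map (prepend k) (splits α) (λ p → H (proj₁ p) (proj₂ p)))
           (splits-conv α (λ β γ → H (k ∷ β) (a ∸ k ∷ γ)))) ⟩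
    ∑ (upTo (suc a)) (λ k → conv α (λ β γ → H (k ∷ β) (a ∸ k ∷ γ)))
      ≡⟨ ∑-upTo-∑ˢ a (λ i j → conv α (λ β γ → H (i ∷ β) (j ∷ γ))) ⟩
    conv (a ∷ α) H
      ∎
    where
    prepend : ℕ → _ → _
    prepend k p = k ∷ proj₁ p , a ∸ k ∷ proj₂ p

  *ₚ-conv : ∀ {m} (f g : PS m) α → (f *ₚ g) α ≡ conv α (λ β γ → f β ℤ.* g γ)
  *ₚ-conv f g α = splits-conv α (λ β γ → f β ℤ.* g γ)

  ∑ˢ-linear : ∀ {A : Set} a {Φ : ℕ → ℕ → (A → ℤ) → ℤ} → (∀ i j → Linear (Φ i j)) →
              Linear (λ f → ∑ˢ a (λ i j → Φ i j f))
  ∑ˢ-linear zero L = L 0 0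
  ∑ˢ-linear (suc a) L = ℤΣ.+-linear (L 0 (suc a)) (∑ˢ-linear a (λ i j → L (suc i) j))

  conv-linear : ∀ {m} (α : Vec ℕ m) → Linear (λ f → conv α (λ β γ → f (β , γ)))
  conv-linear [] = ℤΣ.eval-linear ([] , [])
  conv-linear (a ∷ α) = ∑ˢ-linear a (λ i j →
    ℤΣ.reindex-linear (λ (β , γ) → (i ∷ β , j ∷ γ)) (conv-linear α))

  conv-comm : ∀ {m} (α : Vec ℕ m) H → conv α H ≡ conv α (λ β γ → H γ β)
  conv-comm [] H = refl
  conv-comm (a ∷ α) H = trans (∑ˢ-comm a _) (∑ˢ-cong a (λ i j → conv-comm α _))

  conv-assoc : ∀ {m} (α : Vec ℕ m) (H : Vec ℕ m → Vec ℕ m → Vec ℕ m → ℤ) →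
    conv α (λ κ δ → conv κ (λ β γ → H β γ δ)) ≡ conv α (λ β κ → conv κ (λ γ δ → H β γ δ))
  conv-assoc [] H = refl
  conv-assoc (a ∷ α) H = begin
    ∑ˢ a (λ k l → conv α (λ κ δ → ∑ˢ k (λ i j → conv κ (λ β γ → H (i ∷ β) (j ∷ γ) (l ∷ δ)))))
      ≡⟨ ∑ˢ-cong a (λ k l → linear-∑ˢ (conv-linear α) k
           (λ (κ , δ) i j → conv κ (λ β γ → H (i ∷ β) (j ∷ γ) (l ∷ δ)))) ⟩
    ∑ˢ a (λ k l → ∑ˢ k (λ i j → conv α (λ κ δ → conv κ (λ β γ → H (i ∷ β) (j ∷ γ) (l ∷ δ)))))
      ≡⟨ ∑ˢ-cong a (λ k l → ∑ˢ-cong k (λ i j → conv-assoc α (λ β γ δ → H (i ∷ β) (j ∷ γ) (l ∷ δ)))) ⟩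
    ∑ˢ a (λ k l → ∑ˢ k (λ i j → conv α (λ β κ → conv κ (λ γ δ → H (i ∷ β) (j ∷ γ) (l ∷ δ)))))
      ≡⟨ ∑ˢ-assoc a (λ i j l → conv α (λ β κ → conv κ (λ γ δ → H (i ∷ β) (j ∷ γ) (l ∷ δ)))) ⟩
    ∑ˢ a (λ i k → ∑ˢ k (λ j l → conv α (λ β κ → conv κ (λ γ δ → H (i ∷ β) (j ∷ γ) (l ∷ δ)))))
      ≡⟨ ∑ˢ-cong a (λ i k → linear-∑ˢ (conv-linear α) k
           (λ (β , κ) j l → conv κ (λ γ δ → H (i ∷ β) (j ∷ γ) (l ∷ δ)))) ⟨
    ∑ˢ a (λ i k → conv α (λ β κ → ∑ˢ k (λ j l → conv κ (λ γ δ → H (i ∷ β) (j ∷ γ) (l ∷ δ)))))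
      ∎

  conv-vanish : ∀ {m} (α : Vec ℕ m) {H} → (∀ β γ → H β γ ≡ + 0) → conv α H ≡ + 0
  conv-vanish α e = ℤΣ.Linear.vanish (conv-linear α) (λ (β , γ) → e β γ)

  conv-unit : ∀ {m} (α : Vec ℕ m) {H} → (∀ β γ → Vec.replicate m 0 ≢ β → H β γ ≡ + 0) →
              conv α H ≡ H (Vec.replicate m 0) α
  conv-unit [] e = refl
  conv-unit (zero ∷ α) e = conv-unit α (λ β γ ne → e (0 ∷ β) (0 ∷ γ) (λ eq → ne (Vecₚ.∷-injectiveʳ eq)))
  conv-unit (suc a ∷ α) {H} e = trans
    (cong₂ ℤ._+_ (conv-unit α (λ β γ ne → e (0 ∷ β) (suc a ∷ γ) (λ eq → ne (Vecₚ.∷-injectiveʳ eq))))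
      (ℤΣ.Linear.vanish (∑ˢ-linear a (λ i j → ℤΣ.eval-linear (i , j)))
        {λ (i , j) → conv α (λ β γ → H (suc i ∷ β) (j ∷ γ))}
        (λ (i , j) → conv-vanish α (λ β γ → e (suc i ∷ β) (j ∷ γ) (λ ())))))
    (ℤₚ.+-identityʳ _)

  mono-≡ : ∀ {m} (e : Vec ℕ m) → mono e e ≡ + 1
  mono-≡ e with Vecₚ.≡-dec ℕ._≟_ e e
  ... | yes _ = refl
  ... | no ne = ⊥-elim (ne refl)

  mono-≢ : ∀ {m} {e α : Vec ℕ m} → e ≢ α → mono e α ≡ + 0
  mono-≢ {e = e} {α} ne with Vecₚ.≡-dec ℕ._≟_ e α
  ... | yes eq = ⊥-elim (ne eq)
  ... | no _ = refl

  -- Modulo the terms of total degree greater than d, the infinite sums become finite.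
  module _ {m : ℕ} (d : ℕ) where

    infix 4 _≃_
    record _≃_ (f g : PS m) : Set where
      constructor agree
      field at : ∀ α → Vec.sum α ≤ d → f α ≡ g α
    open _≃_

    *ₚ-cong : ∀ {f f′ g g′} → f ≃ f′ → g ≃ g′ → f *ₚ g ≃ f′ *ₚ g′
    *ₚ-cong {f} {f′} {g} {g′} p q .at α le = begin
      (f *ₚ g) α                          ≡⟨ *ₚ-conv f g α ⟩
      conv α (λ β γ → f β ℤ.* g γ)        ≡⟨ conv-cong-sum α (λ β γ eq → cong₂ ℤ._*_
        (p .at β (ℕₚ.≤-trans (ℕₚ.m≤m+n _ _) (ℕₚ.≤-trans (ℕₚ.≤-reflexive eq) le)))
        (q .at γ (ℕₚ.≤-trans (ℕₚ.m≤n+m _ _) (ℕₚ.≤-trans (ℕₚ.≤-reflexive eq) le)))) ⟩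
      conv α (λ β γ → f′ β ℤ.* g′ γ)      ≡⟨ *ₚ-conv f′ g′ α ⟨
      (f′ *ₚ g′) α                        ∎

    *ₚ-assoc : ∀ f g h → (f *ₚ g) *ₚ h ≃ f *ₚ (g *ₚ h)
    *ₚ-assoc f g h .at α _ = begin
      ((f *ₚ g) *ₚ h) α
        ≡⟨ *ₚ-conv (f *ₚ g) h α ⟩
      conv α (λ κ δ → (f *ₚ g) κ ℤ.* h δ)
        ≡⟨ conv-cong α (λ κ δ → trans (cong (ℤ._* h δ) (*ₚ-conv f g κ))
             (sym (Linear.*-homʳ (conv-linear κ) (λ (β , γ) → f β ℤ.* g γ) (h δ)))) ⟩
      conv α (λ κ δ → conv κ (λ β γ → f β ℤ.* g γ ℤ.* h δ))
        ≡⟨ conv-assoc α (λ β γ δ → f β ℤ.* g γ ℤ.* h δ) ⟩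
      conv α (λ β κ → conv κ (λ γ δ → f β ℤ.* g γ ℤ.* h δ))
        ≡⟨ conv-cong α (λ β κ → trans (conv-cong κ (λ γ δ → ℤₚ.*-assoc (f β) (g γ) (h δ)))
             (trans (Linear.*-hom (conv-linear κ) (f β) (λ (γ , δ) → g γ ℤ.* h δ))
                    (cong (f β ℤ.*_) (sym (*ₚ-conv g h κ))))) ⟩
      conv α (λ β κ → f β ℤ.* (g *ₚ h) κ)
        ≡⟨ *ₚ-conv f (g *ₚ h) α ⟨
      (f *ₚ (g *ₚ h)) α
        ∎

    *ₚ-comm : ∀ f g → f *ₚ g ≃ g *ₚ f
    *ₚ-comm f g .at α _ = begin
      (f *ₚ g) α                          ≡⟨ *ₚ-conv f g α ⟩
      conv α (λ β γ → f β ℤ.* g γ)        ≡⟨ conv-comm α _ ⟩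
      conv α (λ β γ → f γ ℤ.* g β)        ≡⟨ conv-cong α (λ β γ → ℤₚ.*-comm (f γ) (g β)) ⟩
      conv α (λ β γ → g β ℤ.* f γ)        ≡⟨ *ₚ-conv g f α ⟨
      (g *ₚ f) α                          ∎

    *ₚ-identityˡ : ∀ f → 1ₚ *ₚ f ≃ f
    *ₚ-identityˡ f .at α _ = begin
      (1ₚ *ₚ f) α                         ≡⟨ *ₚ-conv 1ₚ f α ⟩
      conv α (λ β γ → 1ₚ β ℤ.* f γ)       ≡⟨ conv-unit α (λ β γ ne → cong (ℤ._* f γ) (mono-≢ ne)) ⟩
      1ₚ (Vec.replicate m 0) ℤ.* f α      ≡⟨ cong (ℤ._* f α) (mono-≡ (Vec.replicate m 0)) ⟩
      + 1 ℤ.* f α                         ≡⟨ ℤₚ.*-identityˡ (f α) ⟩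
      f α                                 ∎

    *ₚ-distribʳ : ∀ h f g → (f +ₚ g) *ₚ h ≃ f *ₚ h +ₚ g *ₚ h
    *ₚ-distribʳ h f g .at α _ = begin
      ((f +ₚ g) *ₚ h) α
        ≡⟨ *ₚ-conv (f +ₚ g) h α ⟩
      conv α (λ β γ → (f β ℤ.+ g β) ℤ.* h γ)
        ≡⟨ conv-cong α (λ β γ → ℤₚ.*-distribʳ-+ (h γ) (f β) (g β)) ⟩
      conv α (λ β γ → f β ℤ.* h γ ℤ.+ g β ℤ.* h γ)
        ≡⟨ Linear.+-hom (conv-linear α) (λ (β , γ) → f β ℤ.* h γ) (λ (β , γ) → g β ℤ.* h γ) ⟩
      conv α (λ β γ → f β ℤ.* h γ) ℤ.+ conv α (λ β γ → g β ℤ.* h γ)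
        ≡⟨ cong₂ ℤ._+_ (*ₚ-conv f h α) (*ₚ-conv g h α) ⟨
      (f *ₚ h +ₚ g *ₚ h) α
        ∎

    ≃-refl : ∀ {f} → f ≃ f
    ≃-refl .at α _ = refl
    ≃-sym : ∀ {f g} → f ≃ g → g ≃ f
    ≃-sym p .at α le = sym (p .at α le)
    ≃-trans : ∀ {f g h} → f ≃ g → g ≃ h → f ≃ h
    ≃-trans p q .at α le = trans (p .at α le) (q .at α le)

    *ₚ-identityʳ : ∀ f → f *ₚ 1ₚ ≃ f
    *ₚ-identityʳ f = ≃-trans (*ₚ-comm f 1ₚ) (*ₚ-identityˡ f)

    *ₚ-distribˡ : ∀ h f g → h *ₚ (f +ₚ g) ≃ h *ₚ f +ₚ h *ₚ g
    *ₚ-distribˡ h f g .at α le = begin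
      (h *ₚ (f +ₚ g)) α              ≡⟨ *ₚ-comm h (f +ₚ g) .at α le ⟩
      ((f +ₚ g) *ₚ h) α              ≡⟨ *ₚ-distribʳ h f g .at α le ⟩
      (f *ₚ h) α ℤ.+ (g *ₚ h) α      ≡⟨ cong₂ ℤ._+_ (*ₚ-comm f h .at α le) (*ₚ-comm g h .at α le) ⟩
      (h *ₚ f) α ℤ.+ (h *ₚ g) α      ∎

    truncatedRing : CommutativeRing 0ℓ 0ℓ
    truncatedRing = record
      { Carrier = PS m ; _≈_ = _≃_ ; _+_ = _+ₚ_ ; _*_ = _*ₚ_ ; -_ = -ₚ_ ; 0# = 0ₚ ; 1# = 1ₚ
      ; isCommutativeRing = record
        { isRing = record
          { +-isAbelianGroup = record
            { isGroup = record
              { isMonoid = record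
                { isSemigroup = record
                  { isMagma = record
                    { isEquivalence = record { refl = ≃-refl ; sym = ≃-sym ; trans = ≃-trans }
                    ; ∙-cong = λ p q → agree (λ α le → cong₂ ℤ._+_ (p .at α le) (q .at α le)) }
                  ; assoc = λ f g h → agree (λ α _ → ℤₚ.+-assoc (f α) (g α) (h α)) }
                ; identity = (λ f → agree (λ α _ → ℤₚ.+-identityˡ (f α)))
                           , (λ f → agree (λ α _ → ℤₚ.+-identityʳ (f α))) }
              ; inverse = (λ f → agree (λ α _ → ℤₚ.+-inverseˡ (f α)))
                        , (λ f → agree (λ α _ → ℤₚ.+-inverseʳ (f α)))
              ; ⁻¹-cong = λ p → agree (λ α le → cong ℤ.-_ (p .at α le)) }
            ; comm = λ f g → agree (λ α _ → ℤₚ.+-comm (f α) (g α)) }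
          ; *-cong = *ₚ-cong
          ; *-assoc = *ₚ-assoc
          ; *-identity = *ₚ-identityˡ , *ₚ-identityʳ
          ; distrib = *ₚ-distribˡ , *ₚ-distribʳ }
        ; *-comm = *ₚ-comm } }

-- Orders of power series and passage to the truncated ring

open PowerSeries

Order : ∀ {m} → ℕ → PS m → Set
Order k f = ∀ α → Vec.sum α < k → f α ≡ + 0

Order-* : ∀ {m k l} {f g : PS m} → Order k f → Order l g → Order (k ℕ.+ l) (f *ₚ g)
Order-* {k = k} {l} {f} {g} p q α lt = ≡.trans (*ₚ-conv f g α) (≡.trans
  (conv-cong-sum α (λ β γ eq → product β γ (≡.subst (_< k ℕ.+ l) (≡.sym eq) lt)))
  (conv-vanish α (λ β γ → ≡.refl)))
  where
  product : ∀ β γ → Vec.sum β ℕ.+ Vec.sum γ < k ℕ.+ l → f β ℤ.* g γ ≡ + 0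
  product β γ lt with Vec.sum β ℕ.<? k
  ... | yes β<k rewrite p β β<k = ≡.refl
  ... | no β≮k = ≡.trans (≡.cong (f β ℤ.*_) (q γ (ℕₚ.≰⇒> (λ l≤γ →
    ℕₚ.<⇒≱ lt (ℕₚ.+-mono-≤ (ℕₚ.≮⇒≥ β≮k) l≤γ))))) (ℤₚ.*-zeroʳ (f β))

Order-0 : ∀ {m} (f : PS m) → Order 0 f
Order-0 f α ()

Order-^ : ∀ {m} {f : PS m} → Order 1 f → ∀ k → Order k (f ^ₚ k)
Order-^ p zero = Order-0 _
Order-^ p (suc k) = Order-* p (Order-^ p k)

unitExp-sum : ∀ m k → k < m → Vec.sum (unitExp m k) ≡ 1
unitExp-sum (suc m) zero _ = ≡.cong suc (replicate-0 m)
  where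
  replicate-0 : ∀ m → Vec.sum (Vec.replicate m 0) ≡ 0
  replicate-0 zero = ≡.refl
  replicate-0 (suc m) = replicate-0 m
unitExp-sum (suc m) (suc k) (s≤s lt) = unitExp-sum m k lt

-- For i > 2n the vector `unitExp (nv n) (suc i)` is zero and `xv n i` is the constant 1, which has
-- no positive order. Index bounds are therefore carried through the Pfaffian and the tableaux.
Order-xv : ∀ n i → i ≤ 2 ℕ.* n → Order 1 (xv n i)
Order-xv n i i≤ α lt = mono-≢ (λ eq → ℕₚ.<⇒≢ lt
  (≡.trans (≡.cong Vec.sum (≡.sym eq)) (unitExp-sum (nv n) (suc i) (s≤s (s≤s i≤)))))

module Truncation (n d : ℕ) where
  R : CommutativeRing 0ℓ 0ℓ
  R = truncatedRing {nv n} d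
  open CommutativeRing R hiding (zero)
  open import Algebra.Properties.Semiring.Exp semiring using (_^_)
  open import Relation.Binary.Reasoning.Setoid setoid
  open LinearFunctionals R
  open Linear
  open Determinants R
  open Pfaffians R
  open Tableaux R (xv n)
  open LittlewoodSums R (xv n) (tv n) (uv n)
  module ℤ↓ = PartitionSums ℤₚ.+-*-commutativeRing

  Order⇒≈0 : ∀ {k f} → d < k → Order k f → f ≈ 0#
  Order⇒≈0 d<k p = agree (λ α le → p α (ℕₚ.≤-<-trans le d<k))

  ^ₚ-^ : ∀ f k → f ^ₚ k ≈ f ^ k
  ^ₚ-^ f zero = refl
  ^ₚ-^ f (suc k) = *-congˡ {f} (^ₚ-^ f k)

  ∑-at : ∀ {A : Set} (as : List A) (F : A → PS (nv n)) α → ∑ as F α ≡ ℤΣ.∑ as (λ a → F a α)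
  ∑-at [] F α = ≡.refl
  ∑-at (a ∷ as) F α = ≡.cong (λ z → F a α ℤ.+ z) (∑-at as F α)

  ∑-downFrom : ∀ M (f : ℕ → ℤ) → ℤΣ.∑ (upTo M) f ≡ ℤΣ.∑ (downFrom M) f
  ∑-downFrom zero f = ≡.refl
  ∑-downFrom (suc M) f = ≡.trans (ℤ↓.∑-upTo-suc M f)
    (≡.trans (ℤₚ.+-comm _ (f M)) (≡.cong (λ z → f M ℤ.+ z) (∑-downFrom M f)))

  -- `geomₚ` cuts the series off at the degree of each single coefficient. All cutoffs can be raised
  -- to the same `M`, because the k-th power has order k.
  geomₚ-truncated : ∀ M f → d < M → Order 1 f → geomₚ f ≈ ∑ (downFrom M) (λ m → f ^ m)
  geomₚ-truncated M f d<M p = trans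
    (agree (λ α le → ≡.trans
      (≡.sym (ℤ↓.∑-upTo-truncate M (suc (Vec.sum α)) (λ k → (f ^ₚ k) α) (ℕₚ.≤-<-trans le d<M)
        (λ k lt → Order-^ p k α lt)))
      (≡.trans (∑-downFrom M (λ k → (f ^ₚ k) α)) (≡.sym (∑-at (downFrom M) (λ k → f ^ₚ k) α)))))
    (∑-cong (downFrom M) (^ₚ-^ f))

  pfaffian-pf : ∀ a k is → pfaffian a k is ≈ pf a k is
  pfaffian-pf a zero [] = refl
  pfaffian-pf a zero (_ ∷ _) = refl
  pfaffian-pf a (suc k) [] = refl
  pfaffian-pf a (suc k) (i ∷ is) = trans
    (∑-picks is (λ j js → a i j *ₚ pfaffian a k js))
    (alt-cong is (λ j js → *-congˡ {a i j} (pfaffian-pf a k js)))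

  monomial-Order : ∀ s → All (_≤ 2 ℕ.* n) s → Order (length s) (∏ s (xv n))
  monomial-Order [] [] = Order-0 _
  monomial-Order (i ∷ s) (i≤ ∷ s≤) = Order-* (Order-xv n i i≤) (monomial-Order s s≤)

  -- The first row of each tableau already contributes a monomial of degree a > d.
  schur-vanish : ∀ a la → d < a → schur n (a ∷ la) ≈ 0#
  schur-vanish a la d<a = begin
    schur n (a ∷ la)
      ≈⟨ schur-tableaux (2 ℕ.* n) (a ∷ la) ⟩
    tableaux (2 ℕ.* n) [] (a ∷ la)
      ≈⟨ ∑-rows-cong (2 ℕ.* n) 0 a (λ { s s≤ ≡.refl →
           trans (*-congʳ (Order⇒≈0 d<a (monomial-Order s s≤))) (zeroˡ (tableaux (2 ℕ.* n) s la)) }) ⟩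
    ∑-rows (2 ℕ.* n) 0 a (λ _ → 0#)
      ≈⟨ vanish (∑-rows-linear (2 ℕ.* n) 0 a) (λ _ → refl) ⟩
    0#
      ∎

  summand : List ℕ → PS (nv n)
  summand la = lhsFactor n la *ₚ schur n la

  summand-vanish : ∀ a la → d < a → summand (a ∷ la) ≈ 0#
  summand-vanish a la d<a = trans
    (*-congˡ {lhsFactor n (a ∷ la)} (schur-vanish a la d<a)) (zeroʳ (lhsFactor n (a ∷ la)))

  lhsFactor-∏ : ∀ la → lhsFactor n la ≈ ∏ (lhsExponents n la) weight
  lhsFactor-∏ la = go (range 1 n)
    where
    e : ℕ → ℕ
    e i = (la ‼ (2 ℕ.* i)) ℕ.+ (2 ℕ.* n ∸ 2 ℕ.* i)
    go : ∀ is → prodₚ (map (λ i → 1ₚ -ₚ uv n *ₚ (tv n ^ₚ e i)) is) ≈ ∏ (map e is) weight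
    go [] = refl
    go (i ∷ is) = *-cong (+-congˡ {1ₚ} (-‿cong (*-congˡ {uv n} (^ₚ-^ (tv n) (e i))))) (go is)

lhs-schurSum : ∀ n d → let open Truncation n d in
  CommutativeRing._≈_ R (lhs n) (LittlewoodSums.schurSum R (xv n) (tv n) (uv n) n d)
lhs-schurSum n d = trans truncated (∑-cong (evenColPartitions n d) (λ la → *-congʳ (lhsFactor-∏ la)))
  where
  open Truncation n d
  open CommutativeRing R hiding (zero)
  open LinearFunctionals R
  truncated : lhs n ≈ ∑ (evenColPartitions n d) summand
  truncated = agree (λ α le → let e = Vec.sum α in ≡.trans
    (ℤ↓.∑-evenColPartitions n e (λ la → summand la α)) (≡.trans
    -- The coefficient at α uses parts up to its own degree e ≤ d. The partitions added by raising
    -- the bound to d have a first part above e, so their terms vanish in degrees up to e: hence the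
    -- appeal to truncation at e instead of d.
    (≡.sym (ℤ↓.∑↓-truncate n d e (λ μ → summand (double μ) α) le
      (λ a μ e<a → _≃_.at (Truncation.summand-vanish n e a (a ∷ double μ) e<a) α ℕₚ.≤-refl))) (≡.trans
    (≡.sym (ℤ↓.∑-evenColPartitions n d (λ la → summand la α)))
    (≡.sym (∑-at (evenColPartitions n d) summand α)))))

pfaffian-identity : ∀ n d → CommutativeRing._≈_ (Truncation.R n d) (vandermonde n *ₚ lhs n) (rhsPf n)
pfaffian-identity n d = begin
  vandermonde n *ₚ lhs n
    ≈⟨ *-cong (vand-range (2 ℕ.* n)) (lhs-schurSum n d) ⟩
  vand (range 1 (2 ℕ.* n)) * schurSum n d
    ≈⟨ identity n ≡.refl ⟩
  pf (pfEntry n) n (range 1 (2 ℕ.* n))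
    ≈⟨ pfaffian-pf (pfEntry n) n (range 1 (2 ℕ.* n)) ⟨
  rhsPf n
    ∎
  where
  open Truncation n d
  open CommutativeRing R hiding (zero)
  open import Relation.Binary.Reasoning.Setoid setoid
  open Pfaffians R
  open Bialternants R (xv n)
  open LittlewoodSums R (xv n) (tv n) (uv n)
  identity : ∀ k → n ≡ k → vand (range 1 (2 ℕ.* n)) * schurSum n d ≈ pf (pfEntry n) n (range 1 (2 ℕ.* n))
  -- Without variables only the empty partition occurs and both sides are 1. The case is separate
  -- because the interval of exponents has length d + 2n - 1.
  identity zero ≡.refl = trans (*-identityˡ _) (trans (+-identityʳ _) (trans (*-identityˡ _) (+-identityʳ _)))
  identity (suc k) ≡.refl = schurSum-pfaffian k d (pfEntry n) (λ i j (_ , i≤) (_ , j≤) →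
    -- The factor `xv n i` alone provides order 1, so that the M-th powers have order M > d.
    let X-order = Order-* (Order-xv n i i≤) (Order-0 (xv n j))
        tX-order = Order-* (Order-* (Order-0 (tv n)) (Order-xv n i i≤)) (Order-0 (xv n j))
    in entry-expand i j M
      (trans (sym (^ₚ-^ (xv n i *ₚ xv n j) M)) (Order⇒≈0 d<M (Order-^ X-order M)))
      (geomₚ-truncated M _ d<M X-order) (geomₚ-truncated M _ d<M tX-order))
    where
    -- This bound serves twice: it exceeds the largest exponent λ₂ + 2n - 2, which is at most d +
    -- 2k, and it exceeds d, so that the geometric series terminate.
    M = d ℕ.+ suc (2 ℕ.* k)
    d<M : d < M
    d<M = ℕₚ.m<m+n d (s≤s z≤n)

theorem6 : (n : ℕ) (α : Vec ℕ (nv n)) → (vandermonde n *ₚ lhs n) α ≡ rhsPf n α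
-- Truncation at the degree of α does not affect the coefficient at α.
theorem6 n α = _≃_.at (pfaffian-identity n (Vec.sum α)) α ℕₚ.≤-refl
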